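{- In the Weihrauch degrees, each of $\mathsf{wRSg}$ and $\mathsf{wRSgr}$ is strictly below $\mathsf{RT}^2_2$ (i.e. $\le_\mathrm{W}\mathsf{RT}^2_2$ but $\mathsf{RT}^2_2\not\le_\mathrm{W}$ it); strictly above $\mathsf{COH}$ and strictly above $\mathsf{RT}^1_{<\infty}$; and Weihrauch incomparable with each of $\lim$, $\mathsf{SRT}^2_2$, $\mathsf{SADC}$, and $\mathsf{DNR}$.
   Context: Problems are multi-valued partial functions $\mathcal{F}\colon\subseteq\omega^\omega\rightrightarrows\omega^\omega$ (countable objects coded in $\omega^\omega$ in the standard way). $\mathcal{F}\le_\mathrm{W}\mathcal{G}$ if there are Turing functionals $\Phi,\Psi$ with $\Phi(f)\in\mathrm{dom}(\mathcal{G})$ for all $f\in\mathrm{dom}(\mathcal{F})$ and $\Psi(\langle f,g\rangle)\in\mathcal{F}(f)$ for all $f\in\mathrm{dom}(\mathcal F)$, $g\in\mathcal{G}(\Phi(f))$. Graphs $G=(V,E)$ are simple with $V\subseteq\omega$ infinite, $E\subseteq[V]^2$; $N(v)=\{y:(v,y)\in E\}$. $\mathsf{wRSg}$: input an infinite graph $G=(V,E)$; output an infinite $H\subseteq V$ such that for all $v\in H$, $|H\cap N(v)|=\omega$ or $|H\cap N(v)|\le1$. $\mathsf{wRSgr}$: input an infinite graph; output an infinite $H\subseteq V$ such that for all $v\in H$, $|H\cap N(v)|=\omega$ or $|H\cap N(v)|=0$. $\mathsf{RT}^2_2$: input $c\colon[\omega]^2\to\{0,1\}$; output an infinite $H$ homogeneous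 for $c$ ($c$ constant on $[H]^2$). $\mathsf{SRT}^2_2$: same, restricted to stable $c$ (for each $n$, $\lim_s c(n,s)$ exists). $\mathsf{COH}$: input a sequence $(A_i:i\in\omega)$ of subsets of $\omega$; output an infinite $C$ such that for each $i$, $C\setminus A_i$ or $C\cap A_i$ is finite. $\mathsf{RT}^1_{<\infty}$: input $c\colon\omega\to\omega$ with finite range; output an infinite $H$ on which $c$ is constant. $\lim$: input $f\colon\omega\times\omega\to\omega$ such that $g(n)=\lim_s f(n,s)$ exists for all $n$; output $g$. $\mathsf{DNR}$: input $p\in\omega^\omega$; output $f\in\omega^\omega$ with $f(e)\ne\Phi_e(p)(e)$ whenever $\Phi_e(p)(e)$ converges ($(\Phi_e)$ the standard list of Turing functionals). $\mathsf{SADC}$: input an infinite linear order $(L,<_L)$ with $L\subseteq\omega$ of order type $\omega+\omega^*$; output an infinite $C\subseteq L$ which is an ascending chain ($\{x\in C:x<_L y\}$ finite for every $y\in C$) or a descending chain ($\{x\in C:y<_Lx\}$ finite for every $y\in C$). -}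

module Defs where

open import Data.Nat using (ℕ; zero; suc; _+_; _*_; _≤_; _<_; _/_; _%_)
open import Data.Product using (Σ; ∃; _×_; _,_; proj₁; proj₂)
open import Data.Sum using (_⊎_; inj₁; inj₂)
open import Data.Unit using (⊤)
open import Relation.Nullary using (¬_)
open import Relation.Binary.PropositionalEquality using (_≡_; _≢_)

Baire : Set
Baire = ℕ → ℕ

tri : ℕ → ℕ
tri zero    = zero
tri (suc n) = suc n + tri n

pair : ℕ → ℕ → ℕ
pair a b = tri (a + b) + b

-- enumerate pairs in the order of their codes: successor of (a,b) is
-- (b+1,0) if a = 0 and (a-1,b+1) otherwise
nextPair : ℕ × ℕ → ℕ × ℕ
nextPair (zero  , b) = (suc b , zero)
nextPair (suc a , b) = (a , suc b)

unpair : ℕ → ℕ × ℕ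
unpair zero    = (zero , zero)
unpair (suc n) = nextPair (unpair n)

join : Baire → Baire → Baire
join f g zero          = f zero
join f g (suc zero)    = g zero
join f g (suc (suc n)) = join (λ k → f (suc k)) (λ k → g (suc k)) n

-- Turing functionals.
-- Primitive recursive (unary, with Cantor pairing) terms relative to an
-- oracle p; a Turing functional is given in Kleene normal form by such a
-- term t:  Φ_t(p)(n) = y  iff  for the least s with t^p(⟨n,s⟩) ≠ 0 we
-- have t^p(⟨n,s⟩) = y+1.

data Tm : Set where
  Zₜ Sₜ Iₜ Lₜ Rₜ Oₜ : Tm
  _∘ₜ_  : Tm → Tm → Tm
  ⟪_,_⟫ : Tm → Tm → Tm
  recₜ  : Tm → Tm → Tm

recAux : (ℕ → ℕ) → (ℕ → ℕ) → ℕ → ℕ → ℕ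
recAux F G y zero    = F y
recAux F G y (suc n) = G (pair (pair y n) (recAux F G y n))

eval : Tm → Baire → ℕ → ℕ
eval Zₜ p x = zero
eval Sₜ p x = suc x
eval Iₜ p x = x
eval Lₜ p x = proj₁ (unpair x)
eval Rₜ p x = proj₂ (unpair x)
eval Oₜ p x = p x
eval (f ∘ₜ g) p x = eval f p (eval g p x)
eval ⟪ f , g ⟫ p x = pair (eval f p x) (eval g p x)
eval (recₜ f g) p x = recAux (eval f p) (eval g p) (proj₁ (unpair x)) (proj₂ (unpair x))

Conv : Tm → Baire → ℕ → ℕ → Set
Conv t p n y = Σ ℕ λ s → (eval t p (pair n s) ≡ suc y) × (∀ s′ → s′ < s → eval t p (pair n s′) ≡ zero)

Computes : Tm → Baire → Baire → Set
Computes t p q = ∀ n → Conv t p n (q n)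

-- Gödel numbering e ↦ Φ_e of all Turing functionals (surjective onto Tm)
pick : ℕ → Tm → Tm → Tm
pick 0 a b = Zₜ
pick 1 a b = Sₜ
pick 2 a b = Iₜ
pick 3 a b = Lₜ
pick 4 a b = Rₜ
pick 5 a b = Oₜ
pick 6 a b = a ∘ₜ b
pick 7 a b = ⟪ a , b ⟫
pick _ a b = recₜ a b

decode′ : ℕ → ℕ → Tm
decode′ zero     k = Zₜ
decode′ (suc fu) k =
  pick (k % 9) (decode′ fu (proj₁ (unpair (k / 9)))) (decode′ fu (proj₂ (unpair (k / 9))))

decode : ℕ → Tm
decode k = decode′ (suc k) k

record Problem : Set₁ where
  field
    dom : Baire → Set
    sol : Baire → Baire → Set      -- sol f g : g ∈ F(f)
open Problem public

_≤W_ : Problem → Problem → Set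
F ≤W G = Σ Tm λ Φ → Σ Tm λ Ψ → ∀ f → dom F f →
  Σ Baire λ q → Computes Φ f q × dom G q ×
    (∀ g → sol G q g → Σ Baire λ r → Computes Ψ (join f g) r × sol F f r)

_<W_ : Problem → Problem → Set
F <W G = (F ≤W G) × ¬ (G ≤W F)

_|W_ : Problem → Problem → Set
F |W G = ¬ (F ≤W G) × ¬ (G ≤W F)

Char : Baire → Set
Char q = ∀ n → q n ≤ 1

_∋_ : Baire → ℕ → Set
q ∋ x = q x ≡ 1

Infinite : (ℕ → Set) → Set
Infinite P = ∀ n → Σ ℕ λ m → n ≤ m × P m

Finite : (ℕ → Set) → Set
Finite P = Σ ℕ λ b → ∀ x → P x → x < b

AtMostOne : (ℕ → Set) → Set
AtMostOne P = ∀ x y → P x → P y → x ≡ y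

Empty : (ℕ → Set) → Set
Empty P = ∀ x → ¬ P x

InfSubset : (ℕ → Set) → Baire → Set
InfSubset A q = Char q × (∀ x → q ∋ x → A x) × Infinite (λ x → q ∋ x)

Vx : Baire → ℕ → Set
Vx p x = p (pair 0 x) ≡ 1

Ex : Baire → ℕ → ℕ → Set
Ex p x y = p (pair 1 (pair x y)) ≡ 1

IsGraph : Baire → Set
IsGraph p = Char p × Infinite (Vx p) ×
  (∀ x y → Ex p x y → Vx p x × Vx p y × x ≢ y) × (∀ x y → Ex p x y → Ex p y x)

HN : Baire → Baire → ℕ → ℕ → Set
HN p q v y = q ∋ y × Ex p v y

wRSg : Problem
wRSg = record
  { dom = IsGraph
  ; sol = λ p q → InfSubset (Vx p) q ×
      (∀ v → q ∋ v → Infinite (HN p q v) ⊎ AtMostOne (HN p q v)) }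

wRSgr : Problem
wRSgr = record
  { dom = IsGraph
  ; sol = λ p q → InfSubset (Vx p) q ×
      (∀ v → q ∋ v → Infinite (HN p q v) ⊎ Empty (HN p q v)) }

Is2Col : Baire → Set
Is2Col p = ∀ x y → x < y → p (pair x y) ≤ 1

Stable : Baire → Set
Stable p = ∀ x → Σ ℕ λ i → Σ ℕ λ s₀ → ∀ s → s₀ ≤ s → x < s → p (pair x s) ≡ i

Homog : Baire → Baire → Set
Homog p q = Σ ℕ λ i → ∀ x y → q ∋ x → q ∋ y → x < y → p (pair x y) ≡ i

RT22 : Problem
RT22 = record
  { dom = Is2Col
  ; sol = λ p q → InfSubset (λ _ → ⊤) q × Homog p q }

SRT22 : Problem
SRT22 = record
  { dom = λ p → Is2Col p × Stable p
  ; sol = λ p q → InfSubset (λ _ → ⊤) q × Homog p q }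

COH : Problem
COH = record
  { dom = Char
  ; sol = λ p q → InfSubset (λ _ → ⊤) q ×
      (∀ i → Finite (λ x → q ∋ x × ¬ (p (pair i x) ≡ 1))
           ⊎ Finite (λ x → q ∋ x × p (pair i x) ≡ 1)) }

RT1fin : Problem
RT1fin = record
  { dom = λ c → Σ ℕ λ k → ∀ n → c n < k
  ; sol = λ c q → InfSubset (λ _ → ⊤) q × (∀ x y → q ∋ x → q ∋ y → c x ≡ c y) }

lim : Problem
lim = record
  { dom = λ p → ∀ n → Σ ℕ λ y → Σ ℕ λ s₀ → ∀ s → s₀ ≤ s → p (pair n s) ≡ y
  ; sol = λ p g → ∀ n → Σ ℕ λ s₀ → ∀ s → s₀ ≤ s → p (pair n s) ≡ g n }

DNR : Problem
DNR = record
  { dom = λ _ → ⊤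
  ; sol = λ p f → ∀ e y → Conv (decode e) p e y → f e ≢ y }

data _≺_ : ℕ ⊎ ℕ → ℕ ⊎ ℕ → Set where
  ω<ω   : ∀ {a b} → a < b → inj₁ a ≺ inj₁ b
  ω<ω*  : ∀ {a b} → inj₁ a ≺ inj₂ b
  ω*<ω* : ∀ {a b} → b < a → inj₂ a ≺ inj₂ b

Lx : Baire → ℕ → Set
Lx p x = p (pair 0 x) ≡ 1

Ltx : Baire → ℕ → ℕ → Set
Ltx p x y = p (pair 1 (pair x y)) ≡ 1

IsLinOrd : Baire → Set
IsLinOrd p = Char p × Infinite (Lx p) ×
  (∀ x y → Ltx p x y → Lx p x × Lx p y) ×
  (∀ x → ¬ Ltx p x x) ×
  (∀ x y z → Ltx p x y → Ltx p y z → Ltx p x z) ×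
  (∀ x y → Lx p x → Lx p y → x ≢ y → Ltx p x y ⊎ Ltx p y x)

TypeωPlusωStar : Baire → Set
TypeωPlusωStar p = Σ (ℕ → ℕ ⊎ ℕ) λ h →
  (∀ x y → Lx p x → Lx p y → (Ltx p x y → h x ≺ h y) × (h x ≺ h y → Ltx p x y)) ×
  (∀ z → Σ ℕ λ x → Lx p x × h x ≡ z)

SADC : Problem
SADC = record
  { dom = λ p → IsLinOrd p × TypeωPlusωStar p
  ; sol = λ p q → InfSubset (Lx p) q ×
      ((∀ y → q ∋ y → Finite (λ x → q ∋ x × Ltx p x y))
       ⊎ (∀ y → q ∋ y → Finite (λ x → q ∋ x × Ltx p y x))) }

Claims611 : Problem → Set
Claims611 X =
  (X <W RT22) × (COH <W X) × (RT1fin <W X) ×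
  (X |W lim) × (X |W SRT22) × (X |W SADC) × (X |W DNR)

{-# OPTIONS --safe #-}

-- All non-reductions hold already for continuous instead of computable reductions.
--
-- An infinite clique or an infinite independent set solves wRSgr, so both problems lie below RT22.  Joining
-- vertices of equal colour gives RT1fin: once a solution shows a vertex of degree at least two, its colour is
-- infinite.  For COH, join x < y when the sequence of bits of x is lexicographically at most that of y: if two
-- vertices of the solution have infinite degree, then almost all have, and the left-to-right maxima converge;
-- otherwise the solution is descending and converges itself.
--
-- RT1fin does not reduce to lim or DNR (a limit of continuous functions has a point of continuity), to COH
-- (finite changes preserve cohesiveness), or to SRT22 (with three colours, each of the two stable colours can be
-- made to commit to a wrong colour), and COH does not reduce to RT1fin.
--
-- Neither SADC nor DNR reduces to wRSgr.  Call a finite set of vertices blocked if no solution of the current or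
-- of a later instance extends it.  If no instance has an infinite independent set, then all but finitely many
-- vertices have infinite degree, and blocking later and later tails of the vertex set fails in the limit.
-- Otherwise block initial parts F₀, F₁, … of independent sets of uniform type over everything before them.
-- A later independent set is attached to every earlier Fₖ, since otherwise it would extend Fₖ to a solution.
-- In the limit the types converge along a subsequence, and one Fₖ together with the vertices of later parts
-- attached to almost all of the subsequence is a solution, a contradiction.
module Submission where

open import Defs
open import Axiom.ExcludedMiddle using (ExcludedMiddle)
open import Data.Empty using (⊥; ⊥-elim)
open import Data.Fin using (Fin; zero; suc; toℕ; fromℕ<)
open import Data.Fin.Properties using (pigeonhole; toℕ-fromℕ<)
open import Data.Maybe using (Maybe; just; nothing)
open import Data.Nat using (ℕ; zero; suc; _+_; _*_; _∸_; _⊔_; _⊓_; _≤_; _<_; _/_; _%_; z≤n; s≤s; pred)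
open import Data.Nat.Properties
open import Data.Nat.Divisibility using (n∣m*n)
open import Data.Nat.DivMod using ([m+kn]%n≡m%n; +-distrib-/-∣ʳ; m<n⇒m/n≡0; m*n/n≡m)
open import Data.Product using (Σ; ∃; _×_; _,_; proj₁; proj₂)
open import Data.Sum using (_⊎_; inj₁; inj₂; [_,_]′; swap)
open import Data.Sum.Properties using (swap-involutive)
open import Data.Unit using (⊤; tt)
open import Data.Vec using (Vec; []; _∷_; lookup)
open import Function using (_∘_; id; case_of_)
open import Level using (0ℓ)
open import Relation.Binary using (tri<; tri≈; tri>)
open import Relation.Binary.PropositionalEquality using (_≡_; _≢_; refl; sym; trans; cong; cong₂; subst)
open import Relation.Nullary using (¬_; Dec; yes; no)

-- A subset of a solution of `wRSgr` need not be a solution, since infinite degrees can be lost.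
-- This is the obstacle to the usual construction with finite parts and shrinking reservoirs, and
-- the reason for the case distinction on independent sets, which do pass to subsets. The identity
-- reduces `wRSg` to `wRSgr`, so reductions are proved into `wRSg` and non-reductions against
-- `wRSgr`. Few are needed, as the rest follows by composition: `RT1fin` lies below both problems,
-- and `SADC` and `DNR` lie below `lim`. On the other side `SADCω`, the restriction of `SADC` to
-- orders on all of ω, lies below `RT22`, `SRT22`, `SADC` and `lim`. Continuous reductions compose
-- without any programming, and a construction against them may freely use non-computable choices;
-- only the positive claims need explicit terms.

-- Agreement on initial segments, and the pairing function

infix 4 _~[_]_

_~[_]_ : {A : Set} → (ℕ → A) → ℕ → (ℕ → A) → Set
f ~[ n ] g = ∀ i → i < n → f i ≡ g i

~-trans : ∀ {A : Set} {f g h : ℕ → A} {n} → f ~[ n ] g → g ~[ n ] h → f ~[ n ] h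
~-trans e e′ i l = trans (e i l) (e′ i l)

~-≤ : ∀ {A : Set} {f g : ℕ → A} {m n} → m ≤ n → f ~[ n ] g → f ~[ m ] g
~-≤ m≤n e i l = e i (<-≤-trans l m≤n)

fst snd : ℕ → ℕ
fst k = proj₁ (unpair k)
snd k = proj₂ (unpair k)

unpair-tri : ∀ n b a → a + b ≡ n → unpair (tri n + b) ≡ (a , b)
unpair-tri zero    zero    zero    _  = refl
unpair-tri (suc n) zero    a       eq
  rewrite +-identityʳ (n + tri n) | +-comm n (tri n) | unpair-tri n n 0 refl
        | trans (sym (+-identityʳ a)) eq = refl
unpair-tri n       (suc b) a       eq
  rewrite +-suc (tri n) b | unpair-tri n b (suc a) (trans (sym (+-suc a b)) eq) = refl

unpair-pair : ∀ a b → unpair (pair a b) ≡ (a , b)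
unpair-pair a b = unpair-tri (a + b) b a refl

left-pair : ∀ a b → fst (pair a b) ≡ a
left-pair a b = cong proj₁ (unpair-pair a b)

right-pair : ∀ a b → snd (pair a b) ≡ b
right-pair a b = cong proj₂ (unpair-pair a b)

pair-unpair : ∀ n → pair (fst n) (snd n) ≡ n
pair-unpair zero    = refl
pair-unpair (suc n) with unpair n | pair-unpair n
... | zero  , b | eq rewrite +-identityʳ b | +-identityʳ (b + tri b) = cong suc (trans (+-comm b (tri b)) eq)
... | suc a , b | eq = trans (+-suc (tri (a + suc b)) b) (cong suc (trans (cong (λ k → tri k + b) (+-suc a b)) eq))

n≤tri : ∀ n → n ≤ tri n
n≤tri zero    = z≤n
n≤tri (suc n) = m≤m+n (suc n) (tri n)

left≤pair : ∀ a b → a ≤ pair a b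
left≤pair a b = ≤-trans (≤-trans (m≤m+n a b) (n≤tri (a + b))) (m≤m+n (tri (a + b)) b)

right≤pair : ∀ a b → b ≤ pair a b
right≤pair a b = m≤n+m b (tri (a + b))

pair-injective : ∀ a b c d → pair a b ≡ pair c d → a ≡ c × b ≡ d
pair-injective a b c d eq with trans (sym (unpair-pair a b)) (trans (cong unpair eq) (unpair-pair c d))
... | refl = refl , refl

-- Source of the bounds that are uniform over an initial segment: finitely many bounds have a
-- maximum, and `Q i` is monotone in its bound.
collect : (Q : ℕ → ℕ → Set) → (∀ {i m n} → m ≤ n → Q i m → Q i n) →
          ∀ n → (∀ i → i < n → ∃ (Q i)) → ∃ λ m → ∀ i → i < n → Q i m
collect Q mono zero    q = 0 , λ _ ()
collect Q mono (suc n) q with collect Q mono n (λ i l → q i (m≤n⇒m≤1+n l)) | q n ≤-refl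
... | a , qa | b , qb = a ⊔ b , λ i l → case m≤n⇒m<n∨m≡n (≤-pred l) of λ where
  (inj₁ i<n)  → mono (m≤m⊔n a b) (qa i i<n)
  (inj₂ refl) → mono (m≤n⊔m a b) qb

-- Classical logic and characteristic functions

module Classical (em : ExcludedMiddle 0ℓ) where

  by-contra : {P : Set} → ¬ ¬ P → P
  by-contra {P} nn with em {P}
  ... | yes p = p
  ... | no ¬p = ⊥-elim (nn ¬p)

  not-∀ : {A : Set} {P : A → Set} → ¬ (∀ a → P a) → ∃ λ a → ¬ P a
  not-∀ n = by-contra λ k → n λ a → by-contra λ np → k (a , np)

  least-below : (P : ℕ → Set) → ∀ n →
    (∃ λ m → m < n × P m × (∀ k → k < m → ¬ P k)) ⊎ (∀ k → k < n → ¬ P k)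
  least-below P zero = inj₂ λ _ ()
  least-below P (suc n) with least-below P n
  ... | inj₁ (m , l , r) = inj₁ (m , m≤n⇒m≤1+n l , r)
  ... | inj₂ none with em {P n}
  ...   | yes p = inj₁ (n , ≤-refl , p , none)
  ...   | no ¬p = inj₂ λ k l q → case m≤n⇒m<n∨m≡n (≤-pred l) of λ where
            (inj₁ k<n)  → none k k<n q
            (inj₂ refl) → ¬p q

  least : (P : ℕ → Set) → ∃ P → ∃ λ m → P m × (∀ k → k < m → ¬ P k)
  least P (n , p) with least-below P (suc n)
  ... | inj₁ (m , _ , r) = m , r
  ... | inj₂ none = ⊥-elim (none n ≤-refl p)

  not-infinite : {P : ℕ → Set} → ¬ Infinite P → ∃ λ b → ∀ m → b ≤ m → ¬ P m
  not-infinite n with not-∀ n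
  ... | b , h = b , λ m l p → h (m , l , p)

  abstract
    char : (ℕ → Set) → Baire
    char P n with em {P n}
    ... | yes _ = 1
    ... | no  _ = 0

    char-Char : ∀ P → Char (char P)
    char-Char P n with em {P n}
    ... | yes _ = ≤-refl
    ... | no  _ = z≤n

    char-in : ∀ P {n} → P n → char P ∋ n
    char-in P {n} p with em {P n}
    ... | yes _ = refl
    ... | no ¬p = ⊥-elim (¬p p)

    char-out : ∀ P {n} → char P ∋ n → P n
    char-out P {n} e with em {P n}
    char-out P {n} e  | yes p = p
    char-out P {n} () | no _

    char-0 : ∀ P {n} → ¬ P n → char P n ≡ 0
    char-0 P {n} np with em {P n}
    ... | yes p = ⊥-elim (np p)
    ... | no _  = refl

    char-cong : ∀ P Q {n} → (P n → Q n) → (Q n → P n) → char P n ≡ char Q n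
    char-cong P Q {n} to from with em {P n}
    ... | yes p = sym (char-in Q (to p))
    ... | no ¬p = sym (char-0 Q (¬p ∘ from))

Char-cases : ∀ {q} → Char q → ∀ n → q n ≡ 0 ⊎ q n ≡ 1
Char-cases {q} c n with q n | c n
... | zero        | _ = inj₁ refl
... | suc zero    | _ = inj₂ refl
... | suc (suc _) | s≤s ()

Char-≡ : ∀ {q r} → Char q → Char r → ∀ {n} → (q ∋ n → r ∋ n) → (r ∋ n → q ∋ n) → q n ≡ r n
Char-≡ cq cr {n} to from with Char-cases cq n | Char-cases cr n
... | inj₁ a | inj₁ b = trans a (sym b)
... | inj₁ a | inj₂ b = trans (from b) (sym b)
... | inj₂ a | _      = trans a (sym (to a))

-- Continuous reductions

-- Partial functions take the membership proofs `d` and `s` as arguments. The moduli quantify over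
-- all `d′` and `s′`, so the case of equal inputs shows that the values do not depend on these
-- proofs.
record _≤C_ (F G : Problem) : Set where
  field
    fwd      : ∀ f → dom F f → Baire
    fwd-dom  : ∀ f d → dom G (fwd f d)
    fwd-cont : ∀ f d n → ∃ λ u → ∀ f′ d′ → f ~[ u ] f′ → fwd f d n ≡ fwd f′ d′ n
    bwd      : ∀ f d g → sol G (fwd f d) g → Baire
    bwd-sol  : ∀ f d g s → sol F f (bwd f d g s)
    bwd-cont : ∀ f d g s n → ∃ λ u → ∀ f′ d′ g′ s′ → f ~[ u ] f′ → g ~[ u ] g′ →
               bwd f d g s n ≡ bwd f′ d′ g′ s′ n

  fwd-cont* : ∀ f d n → ∃ λ u → ∀ f′ d′ → f ~[ u ] f′ → fwd f d ~[ n ] fwd f′ d′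
  fwd-cont* f d n with collect (λ i u → ∀ f′ d′ → f ~[ u ] f′ → fwd f d i ≡ fwd f′ d′ i)
      (λ l q f′ d′ e → q f′ d′ (~-≤ l e)) n (λ i _ → fwd-cont f d i)
  ... | u , q = u , λ f′ d′ e i l → q i l f′ d′ e

  bwd-cont* : ∀ f d g s n → ∃ λ u → ∀ f′ d′ g′ s′ → f ~[ u ] f′ → g ~[ u ] g′ →
              bwd f d g s ~[ n ] bwd f′ d′ g′ s′
  bwd-cont* f d g s n with collect (λ i u → ∀ f′ d′ g′ s′ → f ~[ u ] f′ → g ~[ u ] g′ → bwd f d g s i ≡ bwd f′ d′ g′ s′ i)
      (λ l q f′ d′ g′ s′ e e′ → q f′ d′ g′ s′ (~-≤ l e) (~-≤ l e′)) n (λ i _ → bwd-cont f d g s i)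
  ... | u , q = u , λ f′ d′ g′ s′ e e′ i l → q i l f′ d′ g′ s′ e e′

≤C-trans : ∀ {F G H} → F ≤C G → G ≤C H → F ≤C H
≤C-trans {F} {G} {H} φ ψ = record
  { fwd      = λ f d → ψ.fwd (φ.fwd f d) (φ.fwd-dom f d)
  ; fwd-dom  = λ f d → ψ.fwd-dom _ _
  ; fwd-cont = λ f d n →
      let (u , p) = ψ.fwd-cont (φ.fwd f d) (φ.fwd-dom f d) n
          (w , q) = φ.fwd-cont* f d u
      in w , λ f′ d′ e → p _ _ (q f′ d′ e)
  ; bwd      = λ f d g s → φ.bwd f d (ψ.bwd _ _ g s) (ψ.bwd-sol _ _ g s)
  ; bwd-sol  = λ f d g s → φ.bwd-sol _ _ _ _
  ; bwd-cont = λ f d g s n →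
      let (u , p) = φ.bwd-cont f d (ψ.bwd _ _ g s) (ψ.bwd-sol _ _ g s) n
          (v , q) = ψ.bwd-cont* (φ.fwd f d) (φ.fwd-dom f d) g s u
          (w , r) = φ.fwd-cont* f d v
      in u ⊔ (v ⊔ w) , λ f′ d′ g′ s′ e e′ →
         p _ _ _ _ (~-≤ (m≤m⊔n u (v ⊔ w)) e)
           (q _ _ _ _ (r f′ d′ (~-≤ (≤-trans (m≤n⊔m v w) (m≤n⊔m u (v ⊔ w))) e))
              (~-≤ (≤-trans (m≤m⊔n v w) (m≤n⊔m u (v ⊔ w))) e′))
  }
  where
  module φ = _≤C_ φ
  module ψ = _≤C_ ψ

recAux-cong : ∀ {F G F′ G′ : ℕ → ℕ} y n → F y ≡ F′ y →
  (∀ i → i < n → G (pair (pair y i) (recAux F G y i)) ≡ G′ (pair (pair y i) (recAux F G y i))) →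
  recAux F G y n ≡ recAux F′ G′ y n
recAux-cong y zero    eF eG = eF
recAux-cong {G′ = G′} y (suc n) eF eG =
  trans (eG n ≤-refl) (cong (λ k → G′ (pair (pair y n) k)) (recAux-cong y n eF (λ i l → eG i (m≤n⇒m≤1+n l))))

eval-cont : ∀ t p x → ∃ λ u → ∀ p′ → p ~[ u ] p′ → eval t p x ≡ eval t p′ x
eval-cont Zₜ p x = 0 , λ _ _ → refl
eval-cont Sₜ p x = 0 , λ _ _ → refl
eval-cont Iₜ p x = 0 , λ _ _ → refl
eval-cont Lₜ p x = 0 , λ _ _ → refl
eval-cont Rₜ p x = 0 , λ _ _ → refl
eval-cont Oₜ p x = suc x , λ _ e → e x ≤-refl
eval-cont (f ∘ₜ g) p x with eval-cont g p x | eval-cont f p (eval g p x)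
... | u , a | v , b = u ⊔ v , λ p′ e →
  trans (b p′ (~-≤ (m≤n⊔m u v) e)) (cong (eval f p′) (a p′ (~-≤ (m≤m⊔n u v) e)))
eval-cont ⟪ f , g ⟫ p x with eval-cont f p x | eval-cont g p x
... | u , a | v , b = u ⊔ v , λ p′ e → cong₂ pair (a p′ (~-≤ (m≤m⊔n u v) e)) (b p′ (~-≤ (m≤n⊔m u v) e))
eval-cont (recₜ f g) p x
  with eval-cont f p (fst x)
     | collect (λ i u → ∀ p′ → p ~[ u ] p′ → eval g p (arg i) ≡ eval g p′ (arg i))
               (λ l q p′ e → q p′ (~-≤ l e)) (snd x) (λ i _ → eval-cont g p (arg i))
  where
  arg : ℕ → ℕ
  arg i = pair (pair (fst x) i) (recAux (eval f p) (eval g p) (fst x) i)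
... | u , a | v , b = u ⊔ v , λ p′ e → recAux-cong (fst x) (snd x)
        (a p′ (~-≤ (m≤m⊔n u v) e)) (λ i l → b i l p′ (~-≤ (m≤n⊔m u v) e))

Conv-unique : ∀ {t p n y z} → Conv t p n y → Conv t p n z → y ≡ z
Conv-unique (s , e , m) (s′ , e′ , m′) with <-cmp s s′
... | tri< l _ _ = case trans (sym e) (m′ s l) of λ ()
... | tri≈ _ refl _ = suc-injective (trans (sym e) e′)
... | tri> _ _ l = case trans (sym e′) (m s′ l) of λ ()

-- Use principle: the halting stage `s` and the stages before it are finitely many evaluations, each
-- reading finitely many oracle values.
Conv-cont : ∀ {t p n y} → Conv t p n y → ∃ λ u → ∀ p′ → p ~[ u ] p′ → Conv t p′ n y
Conv-cont {t} {p} {n} (s , e , m)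
  with collect (λ i u → ∀ p′ → p ~[ u ] p′ → eval t p (pair n i) ≡ eval t p′ (pair n i))
         (λ l q p′ e → q p′ (~-≤ l e)) (suc s) (λ i _ → eval-cont t p (pair n i))
... | u , q = u , λ p′ e′ → s , trans (sym (q s ≤-refl p′ e′)) e ,
        λ s′ l → trans (sym (q s′ (m≤n⇒m≤1+n l) p′ e′)) (m s′ l)

join-~ : ∀ {f g f′ g′ u} → f ~[ u ] f′ → g ~[ u ] g′ → join f g ~[ u ] join f′ g′
join-~ e e′ zero          l = e 0 l
join-~ e e′ (suc zero)    l = e′ 0 (<-trans ≤-refl l)
join-~ {u = suc (suc u)} e e′ (suc (suc i)) (s≤s (s≤s l)) =
  join-~ {u = suc u} (λ k h → e (suc k) (s≤s h)) (λ k h → e′ (suc k) (s≤s h)) i (m≤n⇒m≤1+n l)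

≤W⇒≤C : ∀ {F G} → F ≤W G → F ≤C G
≤W⇒≤C {F} {G} (Φ , Ψ , red) = record
  { fwd      = fwd
  ; fwd-dom  = λ f d → proj₁ (proj₂ (proj₂ (red f d)))
  ; fwd-cont = λ f d n →
      let (u , c) = Conv-cont {Φ} {f} {n} (proj₁ (proj₂ (red f d)) n)
      in u , λ f′ d′ e → Conv-unique {Φ} {f′} {n} (c f′ e) (proj₁ (proj₂ (red f′ d′)) n)
  ; bwd      = bwd
  ; bwd-sol  = λ f d g s → proj₂ (proj₂ (proj₂ (proj₂ (proj₂ (red f d))) g s))
  ; bwd-cont = λ f d g s n →
      let (u , c) = Conv-cont {Ψ} {join f g} {n} (comp f d g s n)
      in u , λ f′ d′ g′ s′ e e′ → Conv-unique {Ψ} {join f′ g′} {n} (c (join f′ g′) (join-~ e e′)) (comp f′ d′ g′ s′ n)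
  }
  where
  fwd : ∀ f → dom F f → Baire
  fwd f d = proj₁ (red f d)
  bwd : ∀ f d g → sol G (fwd f d) g → Baire
  bwd f d g s = proj₁ (proj₂ (proj₂ (proj₂ (red f d))) g s)
  comp : ∀ f d g s → Computes Ψ (join f g) (bwd f d g s)
  comp f d g s = proj₁ (proj₂ (proj₂ (proj₂ (proj₂ (red f d))) g s))

-- Baire category and lim

splice : Baire → ℕ → Baire → Baire
splice f n g i with i <? n
... | yes _ = f i
... | no  _ = g i

splice-< : ∀ f n g {i} → i < n → splice f n g i ≡ f i
splice-< f n g {i} l with i <? n
... | yes _ = refl
... | no ¬l = ⊥-elim (¬l l)

splice-≥ : ∀ f n g {i} → n ≤ i → splice f n g i ≡ g i
splice-≥ f n g {i} l with i <? n
... | yes l′ = ⊥-elim (<⇒≱ l′ l)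
... | no _   = refl

splice-all : ∀ {P : ℕ → Set} f n g → (∀ i → P (f i)) → (∀ i → P (g i)) → ∀ i → P (splice f n g i)
splice-all f n g pf pg i with i <? n
... | yes _ = pf i
... | no  _ = pg i

max₁ : ∀ a b c → a ≤ a ⊔ (b ⊔ c)
max₁ a b c = m≤m⊔n a (b ⊔ c)

max₂ : ∀ a b c → b ≤ a ⊔ (b ⊔ c)
max₂ a b c = ≤-trans (m≤m⊔n b c) (m≤n⊔m a (b ⊔ c))

max₃ : ∀ a b c → c ≤ a ⊔ (b ⊔ c)
max₃ a b c = ≤-trans (m≤n⊔m b c) (m≤n⊔m a (b ⊔ c))

module Limit {A : Set} (F : ℕ → ℕ → A) (n : ℕ → ℕ) (k≤n : ∀ k → k ≤ n k) (n-step : ∀ k → n k ≤ n (suc k))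
             (F-step : ∀ k → F k ~[ n k ] F (suc k)) where

  n-mono : ∀ k j → n k ≤ n (j + k)
  n-mono k zero    = ≤-refl
  n-mono k (suc j) = ≤-trans (n-mono k j) (n-step (j + k))

  F-later : ∀ k j → F k ~[ n k ] F (j + k)
  F-later k zero    i l = refl
  F-later k (suc j) i l = trans (F-later k j i l) (F-step (j + k) i (<-≤-trans l (n-mono k j)))

  F-≤ : ∀ {k l} → k ≤ l → F k ~[ n k ] F l
  F-≤ {k} {l} k≤l = subst (λ j → F k ~[ n k ] F j) (m∸n+n≡m k≤l) (F-later k (l ∸ k))

  limit : ℕ → A
  -- `n (suc i)` is at least `suc i`, so the value at `i` is final from index `suc i` on; index `i`
  -- could be one too early.
  limit i = F (suc i) i

  F-limit : ∀ k → F k ~[ n k ] limit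
  F-limit k i l with ≤-total k (suc i)
  ... | inj₁ k≤i = F-≤ k≤i i l
  ... | inj₂ i≤k = sym (F-≤ i≤k i (<-≤-trans ≤-refl (k≤n (suc i))))

module _ (em : ExcludedMiddle 0ℓ) where
  open Classical em

  -- Whenever some point of the current cylinder lets `V x` still change after `t₀`, the
  -- construction moves there and protects the two different values. At the limit point `V x` is
  -- constant from some `t₀` on, so no change was available at the stages for this `t₀`, and all
  -- nearby points share the value of the limit point.
  module BaireCategory
    (S : Baire → Set)
    (closed : ∀ f → (∀ n → ∃ λ f′ → S f′ × f′ ~[ n ] f) → S f)
    (V : ∀ f → S f → ℕ → ℕ → ℕ)
    (V-cont : ∀ f s x t → ∃ λ u → ∀ f′ s′ → f ~[ u ] f′ → V f s x t ≡ V f′ s′ x t)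
    (V-conv : ∀ f s x → ∃ λ y → ∃ λ t₀ → ∀ t → t₀ ≤ t → V f s x t ≡ y)
    (f₀ : Baire) (s₀ : S f₀) where

    State : Set
    State = Σ Baire λ f → S f × ℕ

    Change : State → ℕ → ℕ → Set
    Change (f , _ , n) x t₀ = Σ Baire λ f′ → Σ (S f′) λ s′ → f ~[ n ] f′ ×
      ∃ λ t → ∃ λ t′ → t₀ ≤ t × t₀ ≤ t′ × V f′ s′ x t ≢ V f′ s′ x t′

    -- A stage codes `x`, `t₀` and a third, free component, which makes every pair of `x` and `t₀`
    -- recur at arbitrarily late stages.
    stage-x stage-t : ℕ → ℕ
    stage-x k = fst (fst k)
    stage-t k = snd (fst k)

    next : ℕ → State → State
    next k st@(f , s , n) with em {Change st (stage-x k) (stage-t k)}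
    ... | yes (f′ , s′ , _ , t , t′ , _) =
      f′ , s′ , suc n ⊔ (proj₁ (V-cont f′ s′ (stage-x k) t) ⊔ proj₁ (V-cont f′ s′ (stage-x k) t′))
    ... | no _ = f , s , suc n

    state : ℕ → State
    state zero    = f₀ , s₀ , 0
    state (suc k) = next k (state k)

    F : ℕ → Baire
    F k = proj₁ (state k)

    N : ℕ → ℕ
    N k = proj₂ (proj₂ (state k))

    N-step : ∀ k → suc (N k) ≤ N (suc k)
    N-step k with em {Change (state k) (stage-x k) (stage-t k)}
    ... | yes (f′ , s′ , _ , t , t′ , _) = max₁ _ (proj₁ (V-cont f′ s′ (stage-x k) t)) (proj₁ (V-cont f′ s′ (stage-x k) t′))
    ... | no _  = ≤-refl

    k≤N : ∀ k → k ≤ N k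
    k≤N zero    = z≤n
    k≤N (suc k) = ≤-trans (s≤s (k≤N k)) (N-step k)

    F-step : ∀ k → F k ~[ N k ] F (suc k)
    F-step k with em {Change (state k) (stage-x k) (stage-t k)}
    ... | yes (_ , _ , e , _) = e
    ... | no _  = λ _ _ → refl

    open Limit F N k≤N (λ k → ≤-trans (n≤1+n _) (N-step k)) F-step

    S-limit : S limit
    S-limit = closed limit λ n → F n , proj₁ (proj₂ (state n)) , ~-≤ (k≤N n) (F-limit n)

    change-persists : ∀ k → Change (state k) (stage-x k) (stage-t k) →
      ∃ λ t → ∃ λ t′ → stage-t k ≤ t × stage-t k ≤ t′ × V limit S-limit (stage-x k) t ≢ V limit S-limit (stage-x k) t′
    change-persists k c with em {Change (state k) (stage-x k) (stage-t k)} | F-limit (suc k)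
    ... | no ¬c | _ = ⊥-elim (¬c c)
    ... | yes (f′ , s′ , _ , t , t′ , l , l′ , ne) | near = t , t′ , l , l′ , λ eq → ne (trans
            (proj₂ (V-cont f′ s′ _ t) limit S-limit (~-≤ (max₂ (suc (N k)) _ (proj₁ (V-cont f′ s′ (stage-x k) t′))) near))
            (trans eq (sym (proj₂ (V-cont f′ s′ _ t′) limit S-limit (~-≤ (max₃ (suc (N k)) (proj₁ (V-cont f′ s′ (stage-x k) t)) _) near)))))

    locally-constant : ∀ x → ∃ λ m → ∃ λ t₀ → ∃ λ y →
      ∀ f s → limit ~[ m ] f → ∀ t → t₀ ≤ t → V f s x t ≡ y
    locally-constant x = N k , t₀ , y , λ f s e t l →
        trans (by-contra λ ne → unchanged (f , s , ~-trans (F-limit k) e , t , t₀ ,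
                 subst (_≤ t) (sym k-t) l , ≤-reflexive k-t , subst (λ z → V f s z t ≢ V f s z t₀) (sym k-x) ne))
          (trans (sym (proj₂ (V-cont limit S-limit x t₀) f s (~-≤ u≤N e))) (proj₂ (proj₂ cv) t₀ ≤-refl))
      where
      cv = V-conv limit S-limit x
      y = proj₁ cv
      t₀ = proj₁ (proj₂ cv)
      u = proj₁ (V-cont limit S-limit x t₀)
      -- The free component is the use of `V limit S-limit x t₀`: it delays the stage until the
      -- cylinder also determines this value.
      k = pair (pair x t₀) u
      u≤N : u ≤ N k
      u≤N = ≤-trans (right≤pair (pair x t₀) u) (k≤N k)
      k-x : stage-x k ≡ x
      k-x = trans (cong fst (left-pair (pair x t₀) u)) (left-pair x t₀)
      k-t : stage-t k ≡ t₀
      k-t = trans (cong snd (left-pair (pair x t₀) u)) (right-pair x t₀)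
      settled : ∀ z t → z ≡ x → t₀ ≤ t → V limit S-limit z t ≡ y
      settled z t refl l = proj₂ (proj₂ cv) t l
      unchanged : ¬ Change (state k) (stage-x k) (stage-t k)
      unchanged c with change-persists k c
      ... | t , t′ , l , l′ , ne = ne (trans (settled _ t k-x (subst (_≤ t) k-t l)) (sym (settled _ t′ k-x (subst (_≤ t′) k-t l′))))

    abstract
      continuity-point : Σ Baire λ f → Σ (S f) λ _ → ∀ x → ∃ λ m → ∃ λ t₀ → ∃ λ y →
        ∀ f′ s′ → f ~[ m ] f′ → ∀ t → t₀ ≤ t → V f′ s′ x t ≡ y
      continuity-point = limit , S-limit , locally-constant

module RT1fin≤lim (em : ExcludedMiddle 0ℓ) (φ : RT1fin ≤C lim) where
  open _≤C_ φ

  S : Baire → Set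
  S f = ∀ n → f n < 2

  closed : ∀ f → (∀ n → ∃ λ f′ → S f′ × f′ ~[ n ] f) → S f
  closed f near n = let (f′ , s , e) = near (suc n) in subst (_< 2) (e n ≤-refl) (s n)

  V : ∀ f → S f → ℕ → ℕ → ℕ
  V f s x t = fwd f (2 , s) (pair x t)

  V-cont : ∀ f s x t → ∃ λ u → ∀ f′ s′ → f ~[ u ] f′ → V f s x t ≡ V f′ s′ x t
  V-cont f s x t = let (u , c) = fwd-cont f (2 , s) (pair x t) in u , λ f′ s′ e → c f′ (2 , s′) e

  g : ∀ f → S f → Baire
  g f s n = proj₁ (fwd-dom f (2 , s) n)

  g-sol : ∀ f s → sol lim (fwd f (2 , s)) (g f s)
  g-sol f s n = proj₂ (fwd-dom f (2 , s) n)

  H : ∀ f (s : S f) → Baire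
  H f s = bwd f (2 , s) (g f s) (g-sol f s)

  H-sol : ∀ f s → sol RT1fin f (H f s)
  H-sol f s = bwd-sol f (2 , s) (g f s) (g-sol f s)

  flip-≢ : ∀ {a} → a < 2 → a ≢ 1 ∸ a
  flip-≢ {zero} _ ()
  flip-≢ {suc zero} _ ()
  flip-≢ {suc (suc _)} (s≤s (s≤s ())) _

  module _ (f : Baire) (s : S f)
    (lc : ∀ x → ∃ λ m → ∃ λ t₀ → ∃ λ y → ∀ f′ s′ → f ~[ m ] f′ → ∀ t → t₀ ≤ t → V f′ s′ x t ≡ y) where

    g-cont : ∀ n → ∃ λ m → ∀ f′ s′ → f ~[ m ] f′ → g f s n ≡ g f′ s′ n
    g-cont n with lc n
    ... | m , t₀ , y , c = m , λ f′ s′ e → trans (value f s (λ _ _ → refl)) (sym (value f′ s′ e))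
      where
      value : ∀ f′ s′ → f ~[ m ] f′ → g f′ s′ n ≡ y
      value f′ s′ e with g-sol f′ s′ n
      ... | t₁ , c₁ = trans (sym (c₁ (t₀ ⊔ t₁) (m≤n⊔m t₀ t₁))) (c f′ s′ e (t₀ ⊔ t₁) (m≤m⊔n t₀ t₁))

    g-cont* : ∀ u → ∃ λ m → ∀ f′ s′ → f ~[ m ] f′ → g f s ~[ u ] g f′ s′
    g-cont* u with collect (λ n m → ∀ f′ s′ → f ~[ m ] f′ → g f s n ≡ g f′ s′ n)
                     (λ l q f′ s′ e → q f′ s′ (~-≤ l e)) u (λ n _ → g-cont n)
    ... | m , c = m , λ f′ s′ e n l → c n l f′ s′ e

    -- At `f` the limit `g` is continuous, so finitely many colours of `f` already put some `x` into
    -- the output. Giving all later numbers the opposite of the colour of `x` leaves `x` in an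
    -- output that should be infinite and monochromatic.
    discontinuous : ⊥
    discontinuous with proj₂ (proj₂ (proj₁ (H-sol f s))) 0
    ... | x , _ , x∈H with bwd-cont f (2 , s) (g f s) (g-sol f s) x
    ... | u , use with g-cont* u
    ... | m , near = case proj₂ (proj₂ (proj₁ (H-sol f′ s′))) M of λ where
          (y , M≤y , y∈H′) → flip-≢ (s x) (trans (sym (splice-< f M other (max₃ m u (suc x))))
            (trans (proj₂ (H-sol f′ s′) x y x∈H′ y∈H′) (splice-≥ f M other M≤y)))
      where
      M : ℕ
      M = m ⊔ (u ⊔ suc x)
      other : Baire
      other _ = 1 ∸ f x
      f′ : Baire
      f′ = splice f M other
      s′ : S f′
      s′ = splice-all {_< 2} f M other s (λ _ → s≤s (m∸n≤m 1 (f x)))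
      e : f ~[ M ] f′
      e i l = sym (splice-< f M other l)
      x∈H′ : H f′ s′ ∋ x
      x∈H′ = trans (sym (use f′ (2 , s′) (g f′ s′) (g-sol f′ s′)
        (~-≤ (max₂ m u (suc x)) e) (near f′ s′ (~-≤ (max₁ m u (suc x)) e)))) x∈H

  impossible : ⊥
  impossible = let (f , s , lc) = BaireCategory.continuity-point em S closed V V-cont
                                    (λ f s → fwd-dom f (2 , s)) (λ _ → 0) (λ _ → s≤s z≤n)
               in discontinuous f s lc

-- Thinning, cohesive sets and COH

module _ (em : ExcludedMiddle 0ℓ) where
  open Classical em

  -- Greedy choice: `b` accumulates the thresholds of all elements chosen so far, and the next
  -- element is taken beyond it. This is the common source of homogeneous sets, independent sets and
  -- sets of uniform indices.
  module Thin (P : ℕ → Set) (R : ℕ → ℕ → Set) (P-inf : Infinite P)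
    (eventually : ∀ x → P x → ∃ λ b → ∀ y → b ≤ y → P y → R x y) (n₀ : ℕ) where

    private
      next : ℕ → Σ ℕ P → Σ ℕ P × ℕ
      next b (x , px) = (proj₁ q , proj₂ (proj₂ q)) , b′
        where
        b′ = b ⊔ (suc x ⊔ proj₁ (eventually x px))
        q = P-inf b′

      state : ℕ → Σ ℕ P × ℕ
      state zero    = (proj₁ (P-inf n₀) , proj₂ (proj₂ (P-inf n₀))) , n₀
      state (suc k) = next (proj₂ (state k)) (proj₁ (state k))

      x : ℕ → ℕ
      x k = proj₁ (proj₁ (state k))

      px : ∀ k → P (x k)
      px k = proj₂ (proj₁ (state k))

      θ : ℕ → ℕ
      θ k = proj₁ (eventually (x k) (px k))

      b : ℕ → ℕ
      b k = proj₂ (state k)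

      b≤x : ∀ k → b k ≤ x k
      b≤x zero    = proj₁ (proj₂ (P-inf n₀))
      b≤x (suc k) = proj₁ (proj₂ (P-inf (b k ⊔ (suc (x k) ⊔ proj₁ (eventually (x k) (px k))))))

      b-step : ∀ k → b k ⊔ (suc (x k) ⊔ proj₁ (eventually (x k) (px k))) ≤ b (suc k)
      b-step k = ≤-refl

      b-mono : ∀ {k l} → k < l → b (suc k) ≤ b l
      b-mono {k} {suc l} (s≤s k≤l) with m≤n⇒m<n∨m≡n k≤l
      ... | inj₁ k<l  = ≤-trans (b-mono k<l) (≤-trans (max₁ (b l) (suc (x l)) (θ l)) (b-step l))
      ... | inj₂ refl = ≤-refl

      x<x : ∀ {k l} → k < l → x k < x l
      x<x {k} {l} k<l = ≤-trans (≤-trans (max₂ (b k) (suc (x k)) (θ k)) (b-step k)) (≤-trans (b-mono k<l) (b≤x l))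

      n₀≤x : ∀ k → n₀ ≤ x k
      n₀≤x zero    = b≤x 0
      n₀≤x (suc k) = ≤-trans (n₀≤x k) (<⇒≤ (x<x {k} ≤-refl))

      k≤x : ∀ k → k ≤ x k
      k≤x zero    = z≤n
      k≤x (suc k) = ≤-<-trans (k≤x k) (x<x {k} ≤-refl)

      xRx : ∀ {k l} → k < l → R (x k) (x l)
      xRx {k} {l} k<l = proj₂ (eventually (x k) (px k)) (x l)
        (≤-trans (≤-trans (max₃ (b k) (suc (x k)) (θ k)) (b-step k)) (≤-trans (b-mono k<l) (b≤x l))) (px l)

      Member : ℕ → Set
      Member y = ∃ λ k → y ≡ x k

    abstract
      thin : ∃ λ H → Char H × (∀ y → H ∋ y → P y × n₀ ≤ y) × Infinite (H ∋_) ×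
               (∀ y z → H ∋ y → H ∋ z → y < z → R y z)
      thin = char Member , char-Char Member
           , (λ y h → case char-out Member h of λ where (k , refl) → px k , n₀≤x k)
           , (λ n → x n , k≤x n , char-in Member (n , refl))
           , λ y z hy hz y<z → case (char-out Member hy , char-out Member hz) of λ where
               ((k , refl) , (l , refl)) → xRx {k} {l} (≰⇒> λ l≤k → case m≤n⇒m<n∨m≡n l≤k of λ where
                  (inj₁ l<k)  → <-asym y<z (x<x {l} {k} l<k)
                  (inj₂ refl) → <-irrefl refl y<z)

  infinite-or : ∀ {P Q : ℕ → Set} → Infinite (λ x → P x ⊎ Q x) → Infinite P ⊎ Infinite Q
  infinite-or {P} {Q} inf with em {Infinite P}
  ... | yes i = inj₁ i
  ... | no ¬i with not-infinite ¬i
  ...   | b , none = inj₂ λ n → case inf (b ⊔ n) of λ where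
            (m , l , inj₁ p) → ⊥-elim (none m (≤-trans (m≤m⊔n b n) l) p)
            (m , l , inj₂ q) → m , ≤-trans (m≤n⊔m b n) l , q

  -- A descent through the binary tree of bit vectors that always enters an infinite cell; the
  -- `n`-th element of the set comes from the `n`-th cell. The branch `v` is returned as well,
  -- because the limit type of the vertices is needed later.
  module Cohesive (X : ℕ → Set) (X-inf : Infinite X) (a : ℕ → ℕ → ℕ) (a≤1 : ∀ i x → a i x ≤ 1) where

    private
      Cell : ℕ → Baire → ℕ → Set
      Cell n v x = X x × (λ i → a i x) ~[ n ] v

      refine : ∀ n v → Infinite (Cell n v) → Σ Baire λ v′ → v ~[ n ] v′ × Infinite (Cell (suc n) v′)
      refine n v inf = case infinite-or {Half 0} {Half 1} (λ m → let (y , l , c) = inf m in y , l , split y c) of λ where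
          (inj₁ i) → choose 0 , near 0 , i
          (inj₂ i) → choose 1 , near 1 , i
        where
        choose : ℕ → Baire
        choose e = splice v n (λ _ → e)
        near : ∀ e → v ~[ n ] choose e
        near e i l = sym (splice-< v n (λ _ → e) l)
        Half : ℕ → ℕ → Set
        Half e = Cell (suc n) (choose e)
        put : ∀ e y → Cell n v y → a n y ≡ e → Half e y
        put e y (xy , c) eq = xy , λ i l → case m≤n⇒m<n∨m≡n (≤-pred l) of λ where
          (inj₁ i<n)  → trans (c i i<n) (near e i i<n)
          (inj₂ refl) → trans eq (sym (splice-≥ v n (λ _ → e) ≤-refl))
        split : ∀ y → Cell n v y → Half 0 y ⊎ Half 1 y
        split y c with Char-cases {λ n → a n y} (λ n → a≤1 n y) n
        ... | inj₁ e = inj₁ (put 0 y c e)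
        ... | inj₂ e = inj₂ (put 1 y c e)

      state : ∀ n → Σ Baire λ v → Infinite (Cell n v)
      state zero    = (λ _ → 0) , λ m → let (y , l , xy) = X-inf m in y , l , xy , λ _ ()
      state (suc n) = let (v′ , _ , i) = refine n (proj₁ (state n)) (proj₂ (state n)) in v′ , i

      open Limit (proj₁ ∘ state) id (λ _ → ≤-refl) n≤1+n
                 (λ n → proj₁ (proj₂ (refine n (proj₁ (state n)) (proj₂ (state n)))))

      cell-inf : ∀ n → Infinite (Cell n limit)
      cell-inf n m = let (y , l , xy , c) = proj₂ (state n) m in y , l , xy , ~-trans c (F-limit n)

      c : ℕ → ℕ
      c zero    = 0
      c (suc n) = suc (proj₁ (cell-inf n (c n)))

      c-step : ∀ n → c n < c (suc n)
      c-step n = s≤s (proj₁ (proj₂ (cell-inf n (c n))))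

      c-mono : ∀ {m n} → m ≤ n → c m ≤ c n
      c-mono {m} {n} m≤n with m≤n⇒m<n∨m≡n m≤n
      ... | inj₂ refl = ≤-refl
      c-mono {m} {suc n} m≤n | inj₁ m<n = ≤-trans (c-mono (≤-pred m<n)) (<⇒≤ (c-step n))

      n≤c : ∀ n → n ≤ c n
      n≤c zero    = z≤n
      n≤c (suc n) = ≤-<-trans (n≤c n) (c-step n)

      Member : ℕ → Set
      -- `c (suc n)` is one more than the `n`-th element, so that it can serve as the lower bound
      -- for the next one.
      Member y = ∃ λ n → suc y ≡ c (suc n)

    abstract
      cohesive : ∃ λ C → Char C × (∀ x → C ∋ x → X x) × Infinite (C ∋_) ×
                 Σ Baire λ v → ∀ i → ∃ λ b → ∀ x → C ∋ x → b ≤ x → a i x ≡ v i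
      cohesive = char Member , char-Char Member
        , (λ x h → case char-out Member h of λ where (n , refl) → proj₁ (proj₂ (proj₂ (cell-inf n (c n)))))
        , (λ n → proj₁ (cell-inf n (c n)) , ≤-trans (n≤c n) (proj₁ (proj₂ (cell-inf n (c n)))) , char-in Member (n , refl))
        , limit
        , λ i → c (suc i) , λ x h l → case char-out Member h of λ where
            (n , refl) → proj₂ (proj₂ (proj₂ (cell-inf n (c n)))) i
              (≰⇒> λ n≤i → <⇒≱ (<-≤-trans ≤-refl (c-mono (s≤s n≤i))) l)

  COH-solvable : ∀ p → Char p → ∃ (sol COH p)
  COH-solvable p cp with Cohesive.cohesive (λ _ → ⊤) (λ n → n , ≤-refl , tt) (λ i x → p (pair i x)) (λ i x → cp (pair i x))
  ... | C , cC , _ , inf , v , lim-v = C , (cC , (λ _ _ → tt) , inf) , side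
    where
    side : ∀ i → Finite (λ x → C ∋ x × ¬ (p (pair i x) ≡ 1)) ⊎ Finite (λ x → C ∋ x × p (pair i x) ≡ 1)
    side i with lim-v i | v i ≟ 1
    ... | b , h | yes e = inj₁ (b , λ x (x∈C , ne) → ≰⇒> λ l → ne (trans (h x x∈C l) e))
    ... | b , h | no ne = inj₂ (b , λ x (x∈C , e) → ≰⇒> λ l → ne (trans (sym (h x x∈C l)) e))

  -- For the constant colouring 0 a finite part of `C` puts some `x` into the output. All later
  -- numbers then get colour 1, and this finite part is grafted onto a cohesive set for the new
  -- instance, which keeps `x` in the output.
  RT1fin≰COH : ¬ (RT1fin ≤C COH)
  RT1fin≰COH φ with COH-solvable (fwd f₀ d₀) (fwd-dom f₀ d₀)
    where
    open _≤C_ φ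
    f₀ : Baire
    f₀ _ = 0
    d₀ : dom RT1fin f₀
    d₀ = 2 , λ _ → s≤s z≤n
  ... | C , C-sol with proj₂ (proj₂ (proj₁ (_≤C_.bwd-sol φ _ _ C C-sol))) 0
  ...   | x , _ , x∈H with _≤C_.bwd-cont φ _ _ C C-sol x
  ...     | u , use = case proj₂ (proj₂ (proj₁ (bwd-sol f′ d′ C′ C′-sol))) M of λ where
      (y , M≤y , y∈H) → case trans (sym (splice-< (λ _ → 0) M (λ _ → 1) (m≤n⊔m u (suc x))))
        (trans (proj₂ (bwd-sol f′ d′ C′ C′-sol) x y x∈H′ y∈H) (splice-≥ (λ _ → 0) M (λ _ → 1) M≤y)) of λ ()
    where
    open _≤C_ φ
    M : ℕ
    M = u ⊔ suc x
    f′ : Baire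
    f′ = splice (λ _ → 0) M (λ _ → 1)
    d′ : dom RT1fin f′
    d′ = 2 , splice-all {_< 2} (λ _ → 0) M (λ _ → 1) (λ _ → s≤s z≤n) (λ _ → ≤-refl)
    D : ∃ (sol COH (fwd f′ d′))
    D = COH-solvable (fwd f′ d′) (fwd-dom f′ d′)
    C′ : Baire
    C′ = splice C u (proj₁ D)
    widen : ∀ {Q : ℕ → Set} → Finite (λ z → proj₁ D ∋ z × Q z) → Finite (λ z → C′ ∋ z × Q z)
    widen (b , h) = b ⊔ u , λ z (z∈C′ , q) → ≰⇒> λ l →
      <⇒≱ (h z (trans (sym (splice-≥ C u (proj₁ D) (≤-trans (m≤n⊔m b u) l))) z∈C′ , q)) (≤-trans (m≤m⊔n b u) l)
    C′-sol : sol COH (fwd f′ d′) C′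
    C′-sol with proj₂ D
    ... | (cD , _ , inf) , side =
        ( splice-all {_≤ 1} C u (proj₁ D) (proj₁ (proj₁ C-sol)) cD , (λ _ _ → tt)
        , λ n → let (m , l , h) = inf (n ⊔ u)
                in m , ≤-trans (m≤m⊔n n u) l , trans (splice-≥ C u (proj₁ D) (≤-trans (m≤n⊔m n u) l)) h )
      , λ i → [ inj₁ ∘ widen , inj₂ ∘ widen ]′ (side i)
    x∈H′ : bwd f′ d′ C′ C′-sol ∋ x
    x∈H′ = trans (sym (use f′ d′ C′ C′-sol
      (λ i l → sym (splice-< (λ _ → 0) M (λ _ → 1) (≤-trans l (m≤m⊔n u (suc x)))))
      (λ i l → sym (splice-< C u (proj₁ D) l)))) x∈H

-- Stable colourings

tri-mono : ∀ {m n} → m ≤ n → tri m ≤ tri n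
tri-mono z≤n     = z≤n
tri-mono (s≤s l) = s≤s (+-mono-≤ l (tri-mono l))

pair-mono : ∀ {a b c d} → a ≤ c → b ≤ d → pair a b ≤ pair c d
pair-mono a≤c b≤d = +-mono-≤ (tri-mono (+-mono-≤ a≤c b≤d)) b≤d

third-colour : ∀ {a b} → a < 3 → b < 3 → ∃ λ e → e < 3 × e ≢ a × e ≢ b
third-colour {0} {0} _ _ = 1 , s≤s (s≤s z≤n) , (λ ()) , (λ ())
third-colour {0} {1} _ _ = 2 , ≤-refl , (λ ()) , (λ ())
third-colour {0} {2} _ _ = 1 , s≤s (s≤s z≤n) , (λ ()) , (λ ())
third-colour {1} {0} _ _ = 2 , ≤-refl , (λ ()) , (λ ())
third-colour {1} {1} _ _ = 0 , s≤s z≤n , (λ ()) , (λ ())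
third-colour {1} {2} _ _ = 0 , s≤s z≤n , (λ ()) , (λ ())
third-colour {2} {0} _ _ = 1 , s≤s (s≤s z≤n) , (λ ()) , (λ ())
third-colour {2} {1} _ _ = 0 , s≤s z≤n , (λ ()) , (λ ())
third-colour {2} {2} _ _ = 0 , s≤s z≤n , (λ ()) , (λ ())
third-colour {suc (suc (suc _))} (s≤s (s≤s (s≤s ()))) _
third-colour {0} {suc (suc (suc _))} _ (s≤s (s≤s (s≤s ())))
third-colour {1} {suc (suc (suc _))} _ (s≤s (s≤s (s≤s ())))
third-colour {2} {suc (suc (suc _))} _ (s≤s (s≤s (s≤s ())))

EventualColour : (ℕ → ℕ → ℕ) → ℕ → ℕ → Set
EventualColour c i x = ∃ λ b → ∀ y → b ≤ y → c x y ≡ i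

module _ (em : ExcludedMiddle 0ℓ) where
  open Classical em

  -- The finitely many elements of `H` below `u` have a common bound from which their colours are
  -- settled; beyond it a thinned set of numbers of eventual colour `i` is appended.
  extend-homogeneous : ∀ (c : ℕ → ℕ → ℕ) i u H → Char H →
    (∀ x y → H ∋ x → H ∋ y → x < y → y < u → c x y ≡ i) →
    (∀ x → x < u → H ∋ x → EventualColour c i x) →
    Infinite (EventualColour c i) →
    ∃ λ H′ → Char H′ × H ~[ u ] H′ × Infinite (H′ ∋_) × (∀ x → H′ ∋ x → EventualColour c i x) ×
      (∀ x y → H′ ∋ x → H′ ∋ y → x < y → c x y ≡ i)
  extend-homogeneous c i u H cH hom lims inf
    with collect (λ x m → H ∋ x → ∀ y → m ≤ y → c x y ≡ i) (λ l q h y l′ → q h y (≤-trans l l′)) u modulus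
    where
    modulus : ∀ x → x < u → ∃ λ m → H ∋ x → ∀ y → m ≤ y → c x y ≡ i
    modulus x l with H x ≟ 1
    ... | yes h = let (b , q) = lims x l h in b , λ _ → q
    ... | no ¬h = 0 , λ h → ⊥-elim (¬h h)
  ... | n , settled with Thin.thin em (EventualColour c i) (λ x y → c x y ≡ i) inf
                           (λ x (b , h) → b , λ y l _ → h y l) (n ⊔ u)
  ...   | T , cT , T-in , T-inf , T-hom =
      H′ , splice-all {_≤ 1} H u T cH cT , (λ x l → sym (splice-< H u T l))
    , (λ m → let (y , l , y∈T) = T-inf m
             in y , l , trans (splice-≥ H u T (≤-trans (m≤n⊔m n u) (proj₂ (T-in y y∈T)))) y∈T)
    , (λ x h → case split x h of λ where
         (inj₁ (l , h′)) → lims x l h′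
         (inj₂ h′) → proj₁ (T-in x h′))
    , λ x y hx hy x<y → case (split x hx , split y hy) of λ where
         (inj₁ (_ , h) , inj₁ (l , h′)) → hom x y h h′ x<y l
         (inj₁ (l , h) , inj₂ h′) → settled x l h y (≤-trans (m≤m⊔n n u) (proj₂ (T-in y h′)))
         (inj₂ h , inj₁ (l , h′)) → ⊥-elim (<⇒≱ (<-trans x<y l) (≤-trans (m≤n⊔m n u) (proj₂ (T-in x h))))
         (inj₂ h , inj₂ h′) → T-hom x y h h′ x<y
    where
    H′ : Baire
    H′ = splice H u T
    split : ∀ x → H′ ∋ x → (x < u × H ∋ x) ⊎ T ∋ x
    split x h with x <? u
    ... | yes l = inj₁ (l , h)
    ... | no ¬l = inj₂ h

module RT1fin≤SRT22 (em : ExcludedMiddle 0ℓ) (φ : RT1fin ≤C SRT22) where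
  open Classical em
  open _≤C_ φ

  S : Baire → Set
  S f = ∀ n → f n < 3

  c : ∀ f → S f → ℕ → ℕ → ℕ
  c f s x y = fwd f (3 , s) (pair x y)

  Often : ∀ f → S f → ℕ → Set
  Often f s i = Infinite (EventualColour (c f s) i)

  some-often : ∀ f s → Often f s 0 ⊎ Often f s 1
  some-often f s = infinite-or em λ n → n , ≤-refl , colour n
    where
    colour : ∀ x → EventualColour (c f s) 0 x ⊎ EventualColour (c f s) 1 x
    colour x with fwd-dom f (3 , s)
    ... | two , stable with stable x
    ...   | i , s₀ , h = case c≤1 of λ where
              (inj₁ e) → inj₁ (b , λ y l → trans (h′ y l) e)
              (inj₂ e) → inj₂ (b , λ y l → trans (h′ y l) e)
      where
      b : ℕ
      b = s₀ ⊔ suc x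
      h′ : ∀ y → b ≤ y → c f s x y ≡ i
      h′ y l = h y (≤-trans (m≤m⊔n s₀ (suc x)) l) (≤-trans (m≤n⊔m s₀ (suc x)) l)
      c≤1 : i ≡ 0 ⊎ i ≡ 1
      c≤1 = Char-cases {λ _ → i} (λ _ → subst (_≤ 1) (h′ b ≤-refl) (two x b (m≤n⊔m s₀ (suc x)))) 0

  Space : (ℕ → Set) → Baire → ℕ → Baire → Set
  Space K f₀ n₀ f = f₀ ~[ n₀ ] f × (∀ i → n₀ ≤ i → K (f i)) × S f

  Blocked : (ℕ → Set) → Baire → ℕ → ℕ → Set
  Blocked K f₀ n₀ i = ∀ f (sp : Space K f₀ n₀ f) → ¬ Often f (proj₂ (proj₂ sp)) i

  Minus : (ℕ → Set) → ℕ → ℕ → Set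
  Minus K a e = K e × e ≢ a

  -- One round of the argument: giving up the single colour `a` of the input makes the stable colour
  -- `i` unusable. Two rounds, one for each stable colour, use up two input colours, which is why a
  -- third one is needed.
  Progress : (ℕ → Set) → Baire → ℕ → ℕ → Set
  Progress K f₀ n₀ i = Σ Baire λ f → Σ (Space K f₀ n₀ f) λ sp → ∃ λ m → ∃ λ a →
    K a × n₀ ≤ m × Often f (proj₂ (proj₂ sp)) i × Blocked (Minus K a) f m i

  module _ (K : ℕ → Set) (f₀ : Baire) (n₀ : ℕ) where

    Sp : Baire → Set
    Sp = Space K f₀ n₀

    closed : ∀ f → (∀ n → ∃ λ f′ → Sp f′ × f′ ~[ n ] f) → Sp f
    closed f near =
        (λ i l → let (f′ , (e , _) , e′) = near (suc i) in trans (e i l) (e′ i ≤-refl))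
      , (λ i l → let (f′ , (_ , k , _) , e′) = near (suc i) in subst K (e′ i ≤-refl) (k i l))
      , (λ i → let (f′ , (_ , _ , s) , e′) = near (suc i) in subst (_< 3) (e′ i ≤-refl) (s i))

    V : ∀ f → Sp f → ℕ → ℕ → ℕ
    -- Stability only concerns pairs with second entry above `x`; the offset `suc x` skips the
    -- others.
    V f (_ , _ , s) x t = c f s x (suc x + t)

    V-cont : ∀ f s x t → ∃ λ u → ∀ f′ s′ → f ~[ u ] f′ → V f s x t ≡ V f′ s′ x t
    V-cont f (_ , _ , s) x t =
      let (u , h) = fwd-cont f (3 , s) (pair x (suc x + t)) in u , λ f′ (_ , _ , s′) e → h f′ (3 , s′) e

    V-conv : ∀ f s x → ∃ λ y → ∃ λ t₀ → ∀ t → t₀ ≤ t → V f s x t ≡ y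
    V-conv f (_ , _ , s) x with proj₂ (fwd-dom f (3 , s)) x
    ... | i , s₀ , h = i , s₀ , λ t l → h (suc x + t) (≤-trans l (m≤n+m t (suc x))) (s≤s (m≤m+n x t))

    module _ (f : Baire) (sp : Sp f) (i : ℕ)
      (lc : ∀ x → ∃ λ m → ∃ λ t₀ → ∃ λ y → ∀ f′ s′ → f ~[ m ] f′ → ∀ t → t₀ ≤ t → V f′ s′ x t ≡ y)
      (often : Often f (proj₂ (proj₂ sp)) i) where

      s : S f
      s = proj₂ (proj₂ sp)

      -- At a point of continuity both the limit colour of `y` and a stage from which it holds are
      -- shared by all nearby colourings of the space.
      forced : ∀ y → ∃ λ m → EventualColour (c f s) i y →
               ∀ f′ (sp′ : Sp f′) → f ~[ m ] f′ → EventualColour (c f′ (proj₂ (proj₂ sp′))) i y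
      forced y with lc y
      ... | m , t₀ , v , h = m , λ (b , q) f′ sp′ e → suc y + t₀ , λ z l →
          trans (trans (cong (c f′ (proj₂ (proj₂ sp′)) y) (sym (m+[n∸m]≡n (≤-trans (m≤m+n (suc y) t₀) l))))
            (h f′ sp′ e (z ∸ suc y) (subst (_≤ z ∸ suc y) (m+n∸m≡n (suc y) t₀) (∸-monoˡ-≤ (suc y) l))))
            (trans (sym (h f sp (λ _ _ → refl) (t₀ ⊔ b) (m≤m⊔n t₀ b)))
              (q (suc y + (t₀ ⊔ b)) (≤-trans (m≤n⊔m t₀ b) (m≤n+m (t₀ ⊔ b) (suc y)))))

      module _ (H : Baire) (cH : Char H) (H-lim : ∀ x → H ∋ x → EventualColour (c f s) i x)
        (H-hom : ∀ x y → H ∋ x → H ∋ y → x < y → c f s x y ≡ i)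
        (H-sol : sol SRT22 (fwd f (3 , s)) H)
        (x : ℕ) (x∈ : bwd f (3 , s) H H-sol ∋ x)
        (u : ℕ) (use : ∀ f′ d′ g′ s′ → f ~[ u ] f′ → H ~[ u ] g′ → bwd f (3 , s) H H-sol x ≡ bwd f′ d′ g′ s′ x)
        (m₁ : ℕ) (near : ∀ f′ d′ → f ~[ m₁ ] f′ → fwd f (3 , s) ~[ pair u u ] fwd f′ d′)
        (m₂ : ℕ) (lims : ∀ y → y < u → EventualColour (c f s) i y → ∀ f′ (sp′ : Sp f′) →
                         f ~[ m₂ ] f′ → EventualColour (c f′ (proj₂ (proj₂ sp′))) i y) where

        m : ℕ
        m = (n₀ ⊔ (u ⊔ suc x)) ⊔ (m₁ ⊔ m₂)

        m≥ : ∀ {k} → k ≤ n₀ ⊔ (u ⊔ suc x) → k ≤ m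
        m≥ l = ≤-trans l (m≤m⊔n (n₀ ⊔ (u ⊔ suc x)) (m₁ ⊔ m₂))

        -- A nearby colouring in which `i` is still frequent would let the part of `H` below `u`
        -- extend to a homogeneous set. The output would then contain `x`, of colour `f x`, together
        -- with numbers beyond `m`, where this colour is no longer used.
        blocked : Blocked (Minus K (f x)) f m i
        blocked f′ sp′@(e , k , s′) often′
          with extend-homogeneous em (c f′ s′) i u H cH
                 (λ y z hy hz y<z z<u → trans (sym (near f′ (3 , s′) (~-≤ (max₂ (n₀ ⊔ (u ⊔ suc x)) m₁ m₂) e)
                    (pair y z) (<-pair y<z z<u))) (H-hom y z hy hz y<z))
                 (λ y l hy → lims y l (H-lim y hy) f′ inK (~-≤ (max₃ (n₀ ⊔ (u ⊔ suc x)) m₁ m₂) e))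
                 often′
          where
          <-pair : ∀ {y z} → y < z → z < u → pair y z < pair u u
          <-pair {y} {z} y<z z<u = +-mono-≤-< (tri-mono (+-mono-≤ (<⇒≤ (<-trans y<z z<u)) (<⇒≤ z<u))) z<u
          inK : Sp f′
          inK = ~-trans (proj₁ sp) (~-≤ (m≥ (max₁ n₀ u (suc x))) e)
              , (λ j l → case j <? m of λ where
                   (yes j<m) → subst K (e j j<m) (proj₁ (proj₂ sp) j l)
                   (no ¬j<m) → proj₁ (k j (≮⇒≥ ¬j<m)))
              , s′
        ... | H′ , cH′ , H~H′ , inf , _ , hom =
          case proj₂ (proj₂ (proj₁ (bwd-sol f′ (3 , s′) H′ H′-sol))) m of λ where
            (y , m≤y , y∈) → proj₂ (k y m≤y) (trans (proj₂ (bwd-sol f′ (3 , s′) H′ H′-sol) y x y∈ x∈′)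
                               (sym (e x (m≥ (max₃ n₀ u (suc x))))))
          where
          H′-sol : sol SRT22 (fwd f′ (3 , s′)) H′
          H′-sol = (cH′ , (λ _ _ → tt) , inf) , i , hom
          x∈′ : bwd f′ (3 , s′) H′ H′-sol ∋ x
          x∈′ = trans (sym (use f′ (3 , s′) H′ H′-sol (~-≤ (m≥ (max₂ n₀ u (suc x))) e) H~H′)) x∈

      from-solution : ∀ H → Char H → (∀ x → H ∋ x → EventualColour (c f s) i x) →
        (∀ x y → H ∋ x → H ∋ y → x < y → c f s x y ≡ i) → sol SRT22 (fwd f (3 , s)) H → Progress K f₀ n₀ i
      from-solution H cH H-lim hom H-sol =
        case proj₂ (proj₂ (proj₁ (bwd-sol f (3 , s) H H-sol))) n₀ of λ where
          (x , n₀≤x , x∈) → case bwd-cont f (3 , s) H H-sol x of λ where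
            (u , use) → case fwd-cont* f (3 , s) (pair u u) of λ where
              (m₁ , near) → case collect (λ y m → EventualColour (c f s) i y → ∀ f′ (sp′ : Sp f′) → f ~[ m ] f′ →
                                           EventualColour (c f′ (proj₂ (proj₂ sp′))) i y)
                                   (λ l q ec f′ sp′ e → q ec f′ sp′ (~-≤ l e)) u (λ y _ → forced y) of λ where
                (m₂ , lims) →
                    f , sp , m H cH H-lim hom H-sol x x∈ u use m₁ near m₂ lims , f x
                  , proj₁ (proj₂ sp) x n₀≤x
                  , ≤-trans (m≤m⊔n n₀ (u ⊔ suc x)) (m≤m⊔n (n₀ ⊔ (u ⊔ suc x)) (m₁ ⊔ m₂))
                  , often , blocked H cH H-lim hom H-sol x x∈ u use m₁ near m₂ lims

      progress : Progress K f₀ n₀ i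
      progress = case extend-homogeneous em (c f s) i 0 (λ _ → 0) (λ _ → z≤n) (λ _ _ ()) (λ _ ()) often of λ where
        (H , cH , _ , inf , H-lim , hom) → from-solution H cH H-lim hom ((cH , (λ _ _ → tt) , inf) , i , hom)

    progresses : ∀ f → Sp f → Progress K f₀ n₀ 0 ⊎ Progress K f₀ n₀ 1
    progresses f₁ sp₁ = case BaireCategory.continuity-point em Sp closed V V-cont V-conv f₁ sp₁ of λ where
      (f , sp , lc) → case some-often f (proj₂ (proj₂ sp)) of λ where
        (inj₁ o) → inj₁ (progress f sp 0 lc o)
        (inj₂ o) → inj₂ (progress f sp 1 lc o)

  module _ (i j : ℕ) (either : ∀ f s → Often f s i ⊎ Often f s j)
    (choose : ∀ K f₀ n₀ f → Space K f₀ n₀ f → Progress K f₀ n₀ i ⊎ Progress K f₀ n₀ j) where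

    -- Continuing `f′` by the colour different from `a` and `b` gives a point of both blocked
    -- spaces, yet one of the two stable colours must be frequent for it.
    last-colour : ∀ {f m a f′ m′ b} → S f′ → a < 3 → b < 3 → f ~[ m ] f′ → m ≤ m′ →
      (∀ n → m ≤ n → Minus (_< 3) a (f′ n)) →
      Blocked (Minus (_< 3) a) f m i → Blocked (Minus (Minus (_< 3) a) b) f′ m′ j → ⊥
    last-colour {f} {m} {a} {f′} {m′} {b} s′ a<3 b<3 e′ m≤m′ k′ blocked blocked′ = case third-colour a<3 b<3 of λ where
        (g , g<3 , g≢a , g≢b) → finish g g<3 ((g<3 , g≢a) , g≢b)
      where
      finish : ∀ g → g < 3 → Minus (Minus (_< 3) a) b g → ⊥
      finish g g<3 gK = case either f″ s″ of λ where
          (inj₁ o) → blocked f″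
            ( ~-trans e′ (~-≤ m≤m′ e″)
            , (λ n l → case n <? m′ of λ where
                 (yes n<m′) → subst (Minus (_< 3) a) (e″ n n<m′) (k′ n l)
                 (no ¬n<m′) → proj₁ (k″ n (≮⇒≥ ¬n<m′)))
            , s″) o
          (inj₂ o) → blocked′ f″ (e″ , k″ , s″) o
        where
        f″ : Baire
        f″ = splice f′ m′ (λ _ → g)
        e″ : f′ ~[ m′ ] f″
        e″ i l = sym (splice-< f′ m′ (λ _ → g) l)
        k″ : ∀ n → m′ ≤ n → Minus (Minus (_< 3) a) b (f″ n)
        k″ n l = subst (Minus (Minus (_< 3) a) b) (sym (splice-≥ f′ m′ (λ _ → g) l)) gK
        s″ : S f″
        s″ = splice-all {_< 3} f′ m′ (λ _ → g) s′ (λ _ → g<3)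

    -- After the first round, `f` is continued by a colour other than `a` in order to have a point
    -- of the smaller space. The second round cannot concern `i` again, as `i` is blocked there, so
    -- it blocks `j`.
    exhausted : Progress (_< 3) (λ _ → 0) 0 i → ⊥
    exhausted (f , (_ , _ , s) , m , a , a<3 , _ , _ , blocked) = case third-colour a<3 a<3 of λ where
      (e , e<3 , e≢a , _) →
        case choose (Minus (_< 3) a) f m (splice f m (λ _ → e))
               ( (λ i l → sym (splice-< f m (λ _ → e) l))
               , (λ i l → subst (Minus (_< 3) a) (sym (splice-≥ f m (λ _ → e) l)) (e<3 , e≢a))
               , splice-all {_< 3} f m (λ _ → e) s (λ _ → e<3)) of λ where
          (inj₁ (f′ , sp′ , _ , _ , _ , _ , often , _)) → blocked f′ sp′ often
          (inj₂ (f′ , (e′ , k′ , s′) , m′ , b , (b<3 , _) , m≤m′ , _ , blocked′)) →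
            last-colour s′ a<3 b<3 e′ m≤m′ k′ blocked blocked′

  start : Progress (_< 3) (λ _ → 0) 0 0 ⊎ Progress (_< 3) (λ _ → 0) 0 1
  start = progresses (_< 3) (λ _ → 0) 0 (λ _ → 0) ((λ _ _ → refl) , (λ _ _ → s≤s z≤n) , λ _ → s≤s z≤n)

  case-0 : Progress (_< 3) (λ _ → 0) 0 0 → ⊥
  case-0 = exhausted 0 1 some-often progresses

  case-1 : Progress (_< 3) (λ _ → 0) 0 1 → ⊥
  case-1 = exhausted 1 0 (λ f s → swap (some-often f s)) (λ K f₀ n₀ f sp → swap (progresses K f₀ n₀ f sp))

  impossible : ⊥
  impossible = [ case-0 , case-1 ]′ start

-- COH does not reduce to RT1fin

module COH≤RT1fin (em : ExcludedMiddle 0ℓ) (φ : COH ≤C RT1fin) where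
  open Classical em
  open _≤C_ φ

  Class : ∀ a → Char a → ℕ → ℕ → Set
  Class a ca i n = fwd a ca n ≡ i

  H : ∀ a → Char a → ℕ → Baire
  H a ca i = char (Class a ca i)

  H-sol : ∀ a ca i → Infinite (Class a ca i) → sol RT1fin (fwd a ca) (H a ca i)
  H-sol a ca i inf =
      ( char-Char (Class a ca i) , (λ _ _ → tt)
      , λ n → let (m , l , h) = inf n in m , l , char-in (Class a ca i) h )
    , λ x y hx hy → trans (char-out (Class a ca i) hx) (sym (char-out (Class a ca i) hy))

  -- Each infinite colour class is itself a solution, so there is one cohesive set for each such
  -- colour. Column `i` of the instance is reserved for spoiling the set of colour `i`: it shall
  -- take both values infinitely often on this set, or else the class shall be finite.
  C : ∀ a ca i → Infinite (Class a ca i) → Baire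
  C a ca i inf = bwd a ca (H a ca i) (H-sol a ca i inf)

  C-sol : ∀ a ca i inf → sol COH a (C a ca i inf)
  C-sol a ca i inf = bwd-sol a ca (H a ca i) (H-sol a ca i inf)

  -- `char` is not computable, but whether `n` lies in the class depends only on the colour of `n`,
  -- which is continuous in `a`.
  C-cont : ∀ a ca i inf x → ∃ λ u → ∀ a′ ca′ inf′ → a ~[ u ] a′ → C a ca i inf x ≡ C a′ ca′ i inf′ x
  C-cont a ca i inf x = u ⊔ w , λ a′ ca′ inf′ e →
      use a′ ca′ (H a′ ca′ i) (H-sol a′ ca′ i inf′) (~-≤ (m≤m⊔n u w) e)
        (λ n l → let eq = near a′ ca′ (~-≤ (m≤n⊔m u w) e) n l
                 in char-cong (Class a ca i) (Class a′ ca′ i) (trans (sym eq)) (trans eq))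
    where
    u : ℕ
    u = proj₁ (bwd-cont a ca (H a ca i) (H-sol a ca i inf) x)
    use = proj₂ (bwd-cont a ca (H a ca i) (H-sol a ca i inf) x)
    w : ℕ
    w = proj₁ (fwd-cont* a ca u)
    near = proj₂ (fwd-cont* a ca u)

  Locks : Set
  Locks = ℕ → Maybe ℕ

  record Space (a : Baire) (n : ℕ) (ℓ : Locks) (a′ : Baire) : Set where
    constructor space
    field
      bits   : Char a′
      near   : a ~[ n ] a′
      locked : ∀ i v → ℓ i ≡ just v → ∀ x → n ≤ pair i x → a′ (pair i x) ≡ v
  open Space

  record State : Set where
    constructor state
    field
      a    : Baire
      n    : ℕ
      ℓ    : Locks
      self : Space a n ℓ a

    Sp : Baire → Set
    Sp = Space a n ℓ

    Hit : ℕ → ℕ → Set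
    Hit i v = Σ Baire λ a′ → Σ (Sp a′) λ sp → Σ (Infinite (Class a′ (bits sp) i)) λ inf →
      ∃ λ x → n ≤ x × C a′ (bits sp) i inf ∋ x × a′ (pair i x) ≡ v
  open State

  -- Freezing column i to v when no extension puts a new x with Aᵢ(x) = v into Cᵢ makes colour class i finite.
  data Outcome (st st′ : State) (i v : ℕ) : Set where
    skipped : ∀ w → ℓ st i ≡ just w → (∀ j → ℓ st′ j ≡ ℓ st j) → Outcome st st′ i v
    forced  : (∀ j → ℓ st′ j ≡ ℓ st j) →
              (∀ a′ (sp : Sp st′ a′) inf → ∃ λ x → n st ≤ x × C a′ (bits sp) i inf ∋ x × a′ (pair i x) ≡ v) →
              Outcome st st′ i v
    frozen  : ¬ Hit st i v → ℓ st′ i ≡ just v → (∀ j → j ≢ i → ℓ st′ j ≡ ℓ st j) → Outcome st st′ i v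

  Next : State → ℕ → ℕ → Set
  Next st i v = Σ State λ st′ → n st < n st′ × (∀ {a′} → Sp st′ a′ → Sp st a′) × Outcome st st′ i v

  shrink : ∀ {a a₁ n m ℓ} → Space a n ℓ a₁ → n ≤ m → ∀ {a′} → Space a₁ m ℓ a′ → Space a n ℓ a′
  shrink {a} {a₁} {n} {m} sp l sp′ = space (bits sp′) (~-trans (near sp) (~-≤ l (near sp′)))
    λ i v e x l′ → case pair i x <? m of λ where
      (yes lt) → trans (sym (near sp′ (pair i x) lt)) (locked sp i v e x l′)
      (no ¬lt) → locked sp′ i v e x (≮⇒≥ ¬lt)

  self-at : ∀ {a a₁ n m ℓ} → Space a n ℓ a₁ → n ≤ m → Space a₁ m ℓ a₁
  self-at sp l = space (bits sp) (λ _ _ → refl) (λ i v e x l′ → locked sp i v e x (≤-trans l l′))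

  module _ (st : State) (i v : ℕ) (v≤1 : v ≤ 1) where

    force : Hit st i v → Next st i v
    force (a′ , sp , inf , x , n≤x , x∈C , val) =
      state a′ m (ℓ st) (self-at sp n≤m) , max₁ (suc (n st)) u (suc (pair i x)) , shrink sp n≤m
      , forced (λ _ → refl) (λ a″ sp″ inf″ → x , n≤x
          , trans (sym (use a″ (bits sp″) inf″ (~-≤ (max₂ (suc (n st)) u (suc (pair i x))) (near sp″)))) x∈C
          , trans (sym (near sp″ (pair i x) (max₃ (suc (n st)) u (suc (pair i x))))) val)
      where
      u : ℕ
      u = proj₁ (C-cont a′ (bits sp) i inf x)
      use = proj₂ (C-cont a′ (bits sp) i inf x)
      m : ℕ
      m = suc (n st) ⊔ (u ⊔ suc (pair i x))
      n≤m : n st ≤ m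
      n≤m = ≤-trans (n≤1+n _) (max₁ (suc (n st)) u (suc (pair i x)))

    freeze : ℓ st i ≡ nothing → ¬ Hit st i v → Next st i v
    freeze unlocked ¬hit =
        state b (suc (n st)) ℓ′ (space b-Char (λ _ _ → refl) b-locked)
      , ≤-refl , back , frozen ¬hit ℓ′-i ℓ′-j
      where
      ℓ′ : Locks
      ℓ′ j with j ≟ i
      ... | yes _ = just v
      ... | no _  = ℓ st j
      ℓ′-i : ℓ′ i ≡ just v
      ℓ′-i with i ≟ i
      ... | yes _ = refl
      ... | no ne = ⊥-elim (ne refl)
      ℓ′-j : ∀ j → j ≢ i → ℓ′ j ≡ ℓ st j
      ℓ′-j j ne with j ≟ i
      ... | yes e = ⊥-elim (ne e)
      ... | no _  = refl
      b₀ : Baire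
      b₀ m with fst m ≟ i
      ... | yes _ = v
      ... | no _  = a st m
      b₀-col : ∀ x → b₀ (pair i x) ≡ v
      b₀-col x with fst (pair i x) ≟ i
      ... | yes _ = refl
      ... | no ne = ⊥-elim (ne (left-pair i x))
      b₀-other : ∀ j x → j ≢ i → b₀ (pair j x) ≡ a st (pair j x)
      b₀-other j x ne with fst (pair j x) ≟ i
      ... | yes e = ⊥-elim (ne (trans (sym (left-pair j x)) e))
      ... | no _  = refl
      b₀-Char : Char b₀
      b₀-Char m with fst m ≟ i
      ... | yes _ = v≤1
      ... | no _  = bits (self st) m
      b : Baire
      b = splice (a st) (n st) b₀
      b-Char : Char b
      b-Char = splice-all {_≤ 1} (a st) (n st) b₀ (bits (self st)) b₀-Char
      b-locked : ∀ j w → ℓ′ j ≡ just w → ∀ x → suc (n st) ≤ pair j x → b (pair j x) ≡ w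
      b-locked j w e x l with j ≟ i
      b-locked j w refl x l | yes refl = trans (splice-≥ (a st) (n st) b₀ (<⇒≤ l)) (b₀-col x)
      ... | no ne = trans (splice-≥ (a st) (n st) b₀ (<⇒≤ l)) (trans (b₀-other j x ne) (locked (self st) j w e x (<⇒≤ l)))
      near-b : a st ~[ n st ] b
      near-b k l = sym (splice-< (a st) (n st) b₀ l)
      back : ∀ {a′} → Space b (suc (n st)) ℓ′ a′ → Sp st a′
      back sp = space (bits sp) (~-trans near-b (~-≤ (n≤1+n _) (near sp))) λ j w e x l →
        case pair j x <? suc (n st) of λ where
          (yes lt) → trans (sym (near sp (pair j x) lt))
                       (trans (splice-≥ (a st) (n st) b₀ l) (trans (b₀-other j x (differs j w e)) (locked (self st) j w e x l)))
          (no ¬lt) → locked sp j w (trans (ℓ′-j j (differs j w e)) e) x (≮⇒≥ ¬lt)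
        where
        differs : ∀ j w → ℓ st j ≡ just w → j ≢ i
        differs j w e refl = case trans (sym e) unlocked of λ ()

    next : Next st i v
    next = by-lock (ℓ st i) refl
      where
      by-lock : ∀ m → ℓ st i ≡ m → Next st i v
      by-lock (just w) e = state (a st) (suc (n st)) (ℓ st) (self-at (self st) (n≤1+n _)) , ≤-refl
        , shrink (self st) (n≤1+n _) , skipped w e (λ _ → refl)
      by-lock nothing e = case em {Hit st i v} of λ where
        (yes h) → force h
        (no ¬h) → freeze e ¬h

  -- Both read `fst k` only, so that each requirement recurs infinitely often; the minimum with 1
  -- turns an arbitrary code into a bit.
  col bit : ℕ → ℕ
  col k = fst (fst k)
  bit k = snd (fst k) ⊓ 1

  record Run : Set where
    field
      st      : ℕ → State
      start   : ∀ i → ℓ (st 0) i ≡ nothing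
      grow    : ∀ k → n (st k) < n (st (suc k))
      back    : ∀ k {a′} → Sp (st (suc k)) a′ → Sp (st k) a′
      outcome : ∀ k → Outcome (st k) (st (suc k)) (col k) (bit k)

  abstract
    run : Run
    run = record { st = st ; start = λ _ → refl ; grow = λ k → proj₁ (proj₂ (step k)) ; back = λ k → proj₁ (proj₂ (proj₂ (step k)))
                 ; outcome = λ k → proj₂ (proj₂ (proj₂ (step k))) }
      where
      st : ℕ → State
      step : ∀ k → Next (st k) (col k) (bit k)
      st zero    = state (λ _ → 0) 0 (λ _ → nothing) (space (λ _ → z≤n) (λ _ _ → refl) (λ _ _ ()))
      st (suc k) = proj₁ (step k)
      step k = next (st k) (col k) (bit k) (m⊓n≤n (snd (fst k)) 1)

  module _ (r : Run) where
    open Run r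

    k≤n : ∀ k → k ≤ n (st k)
    k≤n zero    = z≤n
    k≤n (suc k) = ≤-trans (s≤s (k≤n k)) (grow k)

    back* : ∀ k j {a′} → Sp (st (j + k)) a′ → Sp (st k) a′
    back* k zero    sp = sp
    back* k (suc j) sp = back* k j (back (j + k) sp)

    open Limit (λ k → a (st k)) (λ k → n (st k)) k≤n (λ k → <⇒≤ (grow k))
               (λ k → near (back k (self (st (suc k)))))

    in-all : ∀ k → Sp (st k) limit
    in-all k = space
      (λ m → subst (_≤ 1) (F-limit (suc m) m (k≤n (suc m))) (bits (self (st (suc m))) m))
      (F-limit k)
      (λ i v e x l → trans (sym (F-limit (suc (pair i x) + k) (pair i x) (≤-trans (s≤s (m≤m+n (pair i x) k)) (k≤n _))))
                       (locked (back* k (suc (pair i x)) (self (st (suc (pair i x) + k)))) i v e x l))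

    L-Char : Char limit
    L-Char = bits (in-all 0)

    -- Different proofs of `Char limit` could give different colours; continuity at the same point
    -- excludes this.
    class-irr : ∀ ca ca′ i → Infinite (Class limit ca i) → Infinite (Class limit ca′ i)
    class-irr ca ca′ i inf m = let (x , l , h) = inf m
      in x , l , trans (proj₂ (fwd-cont limit ca′ x) limit ca (λ _ _ → refl)) h

    -- At the stage that froze column `i` to `v` no hit was possible. If the class were infinite at
    -- the limit, its cohesive set would have an element so late that column `i` is `v` there, which
    -- is a hit.
    locked-finite : ∀ k i v → ℓ (st k) i ≡ just v → ¬ Infinite (Class limit L-Char i)
    locked-finite zero i v e inf = case trans (sym e) (start i) of λ ()
    locked-finite (suc k) i v e inf = by-outcome (outcome k)
      where
      by-outcome : Outcome (st k) (st (suc k)) (col k) (bit k) → ⊥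
      by-outcome (skipped _ _ same) = locked-finite k i v (trans (sym (same i)) e) inf
      by-outcome (forced same _)    = locked-finite k i v (trans (sym (same i)) e) inf
      by-outcome (frozen ¬hit e′ same) = case i ≟ col k of λ where
          (no ne) → locked-finite k i v (trans (sym (same i ne)) e) inf
          (yes eq) → ¬hit (hit (subst (λ j → Infinite (Class limit L-Char j)) eq inf))
        where
        hit : Infinite (Class limit L-Char (col k)) → Hit (st k) (col k) (bit k)
        hit inf₁ = let inf₂ = class-irr L-Char (bits (in-all k)) (col k) inf₁
                       (x , l , x∈) = proj₂ (proj₂ (proj₁ (C-sol limit (bits (in-all k)) (col k) inf₂))) (n (st (suc k)))
          in limit , in-all k , inf₂ , x , ≤-trans (<⇒≤ (grow k)) l , x∈
           , locked (in-all (suc k)) (col k) (bit k) e′ x (≤-trans l (right≤pair (col k) x))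

    module _ (i : ℕ) (unlocked : ∀ k → ℓ (st k) i ≡ nothing) (inf : Infinite (Class limit L-Char i)) where

      -- A column that is never locked had its requirement for `v` forced at each of its stages, in
      -- particular at the one with free component `N`.
      hits : ∀ v → v ≤ 1 → ∀ N → ∃ λ x → N ≤ x × C limit L-Char i inf ∋ x × limit (pair i x) ≡ v
      hits v v≤1 N = by-outcome (col k) (bit k) col≡ bit≡ (outcome k)
        where
        k : ℕ
        k = pair (pair i v) N
        col≡ : col k ≡ i
        col≡ = trans (cong fst (left-pair (pair i v) N)) (left-pair i v)
        bit≡ : bit k ≡ v
        bit≡ = trans (cong (λ z → snd z ⊓ 1) (left-pair (pair i v) N))
                 (trans (cong (_⊓ 1) (right-pair i v)) (m≤n⇒m⊓n≡m v≤1))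
        by-outcome : ∀ j w → j ≡ i → w ≡ v → Outcome (st k) (st (suc k)) j w →
                     ∃ λ x → N ≤ x × C limit L-Char i inf ∋ x × limit (pair i x) ≡ v
        by-outcome j w refl refl (skipped _ e _) = case trans (sym e) (unlocked k) of λ ()
        by-outcome j w refl refl (frozen _ e _)  = case trans (sym e) (unlocked (suc k)) of λ ()
        by-outcome j w refl refl (forced _ h) =
          let inf₂ = class-irr L-Char (bits (in-all (suc k))) i inf
              (x , l , x∈ , val) = h limit (in-all (suc k)) inf₂
          in x , ≤-trans (≤-trans (right≤pair (pair i v) N) (k≤n k)) l
               , trans (proj₂ (C-cont limit L-Char i inf x) limit (bits (in-all (suc k))) inf₂ (λ _ _ → refl)) x∈
               , val

      unlocked-finite : ⊥
      unlocked-finite = case proj₂ (C-sol limit L-Char i inf) i of λ where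
        (inj₁ (b , fin)) → case hits 0 z≤n b of λ where
          (x , l , x∈ , e) → <⇒≱ (fin x (x∈ , λ e′ → case trans (sym e) e′ of λ ())) l
        (inj₂ (b , fin)) → case hits 1 ≤-refl b of λ where
          (x , l , x∈ , e) → <⇒≱ (fin x (x∈ , e)) l

    class-finite : ∀ i → ¬ Infinite (Class limit L-Char i)
    class-finite i inf = case em {∃ λ k → ∃ λ v → ℓ (st k) i ≡ just v} of λ where
        (yes (k , v , e)) → locked-finite k i v e inf
        (no none) → unlocked-finite i (λ k → to-nothing (λ v e → none (k , v , e))) inf
      where
      to-nothing : ∀ {m : Maybe ℕ} → (∀ v → m ≢ just v) → m ≡ nothing
      to-nothing {just v}  h = ⊥-elim (h v refl)
      to-nothing {nothing} h = refl

    no-colour : ⊥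
    no-colour =
      let (k , bound) = fwd-dom limit L-Char
          (b , none)  = collect (λ i b → ∀ m → b ≤ m → ¬ Class limit L-Char i m) (λ l q m l′ → q m (≤-trans l l′)) k
                          (λ i _ → not-infinite (class-finite i))
      in none (fwd limit L-Char b) (bound b) b ≤-refl refl

  impossible : ⊥
  impossible = no-colour run

-- Diagonalising against wRSgr

-- The order of the quantifiers matters: `M` is fixed before `m`, because `m` will be the use of the
-- computation of the first `M` values of `r`. The new instance must agree up to this use and still
-- doom these values for good.
Refutes : (P : Problem) {I : Set} → (I → Baire) → (I → ℕ → I → Set) → I → ℕ → Baire → Set
Refutes P {I} inst _≈[_]_ c n r = ∃ λ M → ∀ m → Σ I λ d → ∃ λ n′ → c ≈[ n ] d × inst c ~[ m ] inst d ×
  (∀ e → d ≈[ n′ ] e → ∀ r′ → r ~[ M ] r′ → ¬ sol P (inst e) r′)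

-- Closeness is measured on `I`, which may carry more data than the instance, for example a witness
-- that it lies in the domain. This is what keeps the limit of a convergent sequence in the domain.
record Diagonal (P : Problem) : Set₁ where
  field
    I         : Set
    inst      : I → Baire
    inst-dom  : ∀ c → dom P (inst c)
    _≈[_]_    : I → ℕ → I → Set
    ≈-refl    : ∀ {c n} → c ≈[ n ] c
    ≈-trans   : ∀ {c d e n} → c ≈[ n ] d → d ≈[ n ] e → c ≈[ n ] e
    ≈-mono    : ∀ {c d m n} → m ≤ n → c ≈[ n ] d → c ≈[ m ] d
    inst-cont : ∀ c m → ∃ λ n → ∀ d → c ≈[ n ] d → inst c ~[ m ] inst d
    complete  : (c : ℕ → I) (n : ℕ → ℕ) → (∀ k → k ≤ n k) → (∀ k → n k ≤ n (suc k)) →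
                (∀ k → c k ≈[ n k ] c (suc k)) → ∃ λ d → ∀ k → c k ≈[ n k ] d
    refute    : ∀ c n r → sol P (inst c) r → Refutes P inst _≈[_]_ c n r

-- Agreement below `bnd u` fixes the vertices below `u` and the edges between them.
bnd : ℕ → ℕ
bnd u = suc (pair 1 (pair u u))

vertex<bnd : ∀ {x u} → x < u → pair 0 x < bnd u
vertex<bnd {x} {u} l = s≤s (pair-mono {0} {x} {1} z≤n (≤-trans (<⇒≤ l) (left≤pair u u)))

edge<bnd : ∀ {x y u} → x < u → y < u → pair 1 (pair x y) < bnd u
edge<bnd {x} {y} {u} l l′ = s≤s (pair-mono {1} ≤-refl (pair-mono (<⇒≤ l) (<⇒≤ l′)))

Independent : Baire → Baire → Set
Independent p K = ∀ x y → K ∋ x → K ∋ y → ¬ Ex p x y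

independent-solution : ∀ {p K} → InfSubset (Vx p) K → Independent p K → sol wRSgr p K
independent-solution K⊆V ind = K⊆V , λ v v∈K → inj₂ λ y (y∈K , e) → ind v y v∈K y∈K e

module _ (em : ExcludedMiddle 0ℓ) where
  open Classical em

  -- If infinitely many elements of `X` have finite degree inside `X`, each of them is non-adjacent
  -- to all late ones, and thinning gives an independent set.
  independent-or-cofinite : ∀ {p} → IsGraph p → (X : ℕ → Set) → Infinite X →
    (∃ λ K → InfSubset X K × Independent p K) ⊎
    (∃ λ N → ∀ x → N ≤ x → X x → Infinite (λ y → X y × Ex p x y))
  independent-or-cofinite {p} (_ , _ , simple , symm) X inf = case em {Infinite P} of λ where
      (yes i) → inj₁ (from-thin (Thin.thin em P (λ x y → ¬ Ex p x y) i eventually 0))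
      (no ¬i) → inj₂ (let (b , none) = not-infinite ¬i
                      in b , λ x l xX → by-contra λ ¬inf → none x l (xX , ¬inf))
    where
    P : ℕ → Set
    P x = X x × ¬ Infinite (λ y → X y × Ex p x y)
    eventually : ∀ x → P x → ∃ λ b → ∀ y → b ≤ y → P y → ¬ Ex p x y
    eventually x (_ , ¬inf) = let (b , none) = not-infinite ¬inf in b , λ y l (yX , _) e → none y l (yX , e)
    from-thin : (∃ λ H → Char H × (∀ y → H ∋ y → P y × 0 ≤ y) × Infinite (H ∋_) ×
                  (∀ y z → H ∋ y → H ∋ z → y < z → ¬ Ex p y z)) → ∃ λ K → InfSubset X K × Independent p K
    from-thin (K , cK , K-in , K-inf , ind) = K , (cK , (λ x h → proj₁ (proj₁ (K-in x h))) , K-inf) ,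
      λ x y hx hy e → case <-cmp x y of λ where
        (tri< l _ _) → ind x y hx hy l e
        (tri≈ _ eq _) → proj₂ (proj₂ (simple x y e)) eq
        (tri> _ _ l) → ind y x hy hx l (symm x y e)

module Diagonal≤wRSgr (em : ExcludedMiddle 0ℓ) {P : Problem} (Δ : Diagonal P) (φ : P ≤C wRSgr) where
  open Classical em
  open Diagonal Δ
  open _≤C_ φ

  G : I → Baire
  G c = fwd (inst c) (inst-dom c)

  G-graph : ∀ c → IsGraph (G c)
  G-graph c = fwd-dom (inst c) (inst-dom c)

  Block : I → ℕ → ℕ → Baire → Set
  Block c n u H = ∀ d → c ≈[ n ] d → ∀ H′ → H ~[ u ] H′ → ¬ sol wRSgr (G d) H′

  record Extension (c : I) (n : ℕ) (H : Baire) (v : ℕ) : Set where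
    field
      next    : I
      level   : ℕ
      use     : ℕ
      v≤use   : v ≤ use
      n<level : n < level
      close   : c ≈[ n ] next
      agree   : ∀ d → next ≈[ level ] d → G c ~[ bnd use ] G d
      block   : Block next level use H

  abstract
    -- The first `M` values of the output `r` come from finitely many values of `H` and of the
    -- instance. The new instance agrees with the old one beyond this use, so every solution
    -- extending `H` below `use` gives an output that begins like `r`, which is doomed. The argument
    -- `v` forces `use` to reach past a chosen element.
    extend : ∀ c n H → sol wRSgr (G c) H → ∀ v → Extension c n H v
    extend c n H H-sol v = from (refute c n r (bwd-sol (inst c) (inst-dom c) H H-sol))
      where
      r : Baire
      r = bwd (inst c) (inst-dom c) H H-sol
      from : Refutes P inst _≈[_]_ c n r → Extension c n H v
      from (M , h) = case bwd-cont* (inst c) (inst-dom c) H H-sol M of λ where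
          (u₀ , r-cont) → with-u u₀ r-cont
        where
        with-u : ∀ u₀ → (∀ f′ d′ g′ s′ → inst c ~[ u₀ ] f′ → H ~[ u₀ ] g′ → r ~[ M ] bwd f′ d′ g′ s′) → Extension c n H v
        with-u u₀ r-cont = case fwd-cont* (inst c) (inst-dom c) (bnd (u₀ ⊔ v)) of λ where
          (m₁ , G-near) → case h (m₁ ⊔ u₀) of λ where
            (d , n₂ , c≈d , near , no-sol) → case inst-cont d (m₁ ⊔ u₀) of λ where
              (n₃ , d-near) → record
                { next = d ; level = suc n ⊔ (n₂ ⊔ n₃) ; use = u₀ ⊔ v ; v≤use = m≤n⊔m u₀ v
                ; n<level = max₁ (suc n) n₂ n₃ ; close = c≈d
                ; agree = λ e d≈e → G-near (inst e) (inst-dom e)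
                    (~-≤ (m≤m⊔n m₁ u₀) (~-trans near (d-near e (≈-mono (max₃ (suc n) n₂ n₃) d≈e))))
                ; block = λ e d≈e H′ H~H′ H′-sol →
                    no-sol e (≈-mono (max₂ (suc n) n₂ n₃) d≈e) (bwd (inst e) (inst-dom e) H′ H′-sol)
                      (r-cont (inst e) (inst-dom e) H′ H′-sol
                        (~-≤ (m≤n⊔m m₁ u₀) (~-trans near (d-near e (≈-mono (max₃ (suc n) n₂ n₃) d≈e))))
                        (~-≤ (m≤m⊔n u₀ v) H~H′))
                      (bwd-sol (inst e) (inst-dom e) H′ H′-sol) }

  module Chain (c : ℕ → I) (n : ℕ → ℕ) (grow : ∀ k → n k < n (suc k)) (close : ∀ k → c k ≈[ n k ] c (suc k)) where

    k≤n : ∀ k → k ≤ n k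
    k≤n zero    = z≤n
    k≤n (suc k) = ≤-trans (s≤s (k≤n k)) (grow k)

    n-mono : ∀ k j → n k ≤ n (j + k)
    n-mono k zero    = ≤-refl
    n-mono k (suc j) = ≤-trans (n-mono k j) (<⇒≤ (grow (j + k)))

    later : ∀ k j → c k ≈[ n k ] c (j + k)
    later k zero    = ≈-refl
    later k (suc j) = ≈-trans (later k j) (≈-mono (n-mono k j) (close (j + k)))

    c-≤ : ∀ {k l} → k ≤ l → c k ≈[ n k ] c l
    c-≤ {k} {l} k≤l = subst (λ j → c k ≈[ n k ] c j) (m∸n+n≡m k≤l) (later k (l ∸ k))

    abstract
      lim-exists : ∃ λ d → ∀ k → c k ≈[ n k ] d
      lim-exists = complete c n k≤n (λ k → <⇒≤ (grow k)) close

  Tail : Baire → ℕ → ℕ → Set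
  Tail p N v = Vx p v × N ≤ v

  tail-solution : ∀ {p} → IsGraph p → ∀ {N M} → (∀ x → N ≤ x → Vx p x → Infinite (λ y → Vx p y × Ex p x y)) →
    N ≤ M → sol wRSgr p (char (Tail p M))
  tail-solution {p} (_ , V-inf , _) {N} {M} degree N≤M =
      ( char-Char T , (λ x h → proj₁ (char-out T h))
      , λ k → let (m , l , h) = V-inf (M ⊔ k) in m , ≤-trans (m≤n⊔m M k) l , char-in T (h , ≤-trans (m≤m⊔n M k) l))
    , λ v h → inj₁ λ k →
        let (xV , M≤x) = char-out T h
            (m , l , mV , e) = degree v (≤-trans N≤M M≤x) xV (M ⊔ k)
        in m , ≤-trans (m≤n⊔m M k) l , char-in T (mV , ≤-trans (m≤m⊔n M k) l) , e
    where
    T : ℕ → Set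
    T = Tail p M

  module NoIndependent (none : ∀ c K → InfSubset (Vx (G c)) K → ¬ Independent (G c) K) where

    abstract
      threshold : ∀ c → ∃ λ N → ∀ x → N ≤ x → Vx (G c) x → Infinite (λ y → Vx (G c) y × Ex (G c) x y)
      threshold c = case independent-or-cofinite em (G-graph c) (Vx (G c)) (proj₁ (proj₂ (G-graph c))) of λ where
        (inj₁ (K , sub , ind)) → ⊥-elim (none c K sub ind)
        (inj₂ t) → t

    record Run : Set where
      field
        c     : ℕ → I
        n u N : ℕ → ℕ
        grow  : ∀ k → n k < n (suc k)
        close : ∀ k → c k ≈[ n k ] c (suc k)
        k≤N   : ∀ k → k ≤ N k
        agree : ∀ k d → c (suc k) ≈[ n (suc k) ] d → G (c k) ~[ bnd (u k) ] G d
        block : ∀ k → Block (c (suc k)) (n (suc k)) (u k) (char (Tail (G (c k)) (N k)))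

    module Build (c₀ : I) where
      open Extension
      H′ : I → ℕ → Baire
      H′ c k = char (Tail (G c) (proj₁ (threshold c) ⊔ k))
      H′-sol : ∀ c k → sol wRSgr (G c) (H′ c k)
      H′-sol c k = tail-solution (G-graph c) (proj₂ (threshold c)) (m≤m⊔n (proj₁ (threshold c)) k)
      ext′ : ∀ k c n → Extension c n (H′ c k) 0
      ext′ k c n = extend c n (H′ c k) (H′-sol c k) 0
      st : ℕ → I × ℕ
      st zero    = c₀ , 0
      st (suc k) = next (ext′ k (proj₁ (st k)) (proj₂ (st k))) , level (ext′ k (proj₁ (st k)) (proj₂ (st k)))
      run : Run
      run = record
        { c = λ k → proj₁ (st k) ; n = λ k → proj₂ (st k) ; u = λ k → use (ext′ k (proj₁ (st k)) (proj₂ (st k)))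
        ; N = λ k → proj₁ (threshold (proj₁ (st k))) ⊔ k
        ; grow = λ k → n<level (ext′ k (proj₁ (st k)) (proj₂ (st k)))
        ; close = λ k → close (ext′ k (proj₁ (st k)) (proj₂ (st k)))
        ; k≤N = λ k → m≤n⊔m (proj₁ (threshold (proj₁ (st k)))) k
        ; agree = λ k → agree (ext′ k (proj₁ (st k)) (proj₂ (st k)))
        ; block = λ k → block (ext′ k (proj₁ (st k)) (proj₂ (st k))) }

    -- At the limit instance the `k`-th tail is a solution once `k` reaches the threshold of that
    -- instance, because `N k` is at least `k`. It extends the tail blocked at stage `k`.
    absurd : Run → ⊥
    absurd r = case Chain.lim-exists c n grow close of λ where
        (d , near) → at-limit d near
      where
      open Run r
      at-limit : ∀ d → (∀ k → c k ≈[ n k ] d) → ⊥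
      at-limit d near = block k d (near (suc k)) (char (Tail (G d) (N k)))
          (λ x l → char-cong (Tail (G (c k)) (N k)) (Tail (G d) (N k))
             (λ (xV , l′) → trans (sym (same x l)) xV , l′) (λ (xV , l′) → trans (same x l) xV , l′))
          (tail-solution (G-graph d) (proj₂ (threshold d)) (k≤N k))
        where
        k : ℕ
        k = proj₁ (threshold d)
        same : ∀ x → x < u k → G (c k) (pair 0 x) ≡ G d (pair 0 x)
        same x l = agree k d (near (suc k)) (pair 0 x) (vertex<bnd l)

  -- An independent set beyond `u` all of whose elements have the same neighbours below `u`, namely
  -- those prescribed by `type`.
  record Layer (c : I) (u : ℕ) : Set where
    field
      K    : Baire
      type : Baire
      sub  : InfSubset (Vx (G c)) K
      ind  : Independent (G c) K
      u≤K  : ∀ x → K ∋ x → u ≤ x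
      same : ∀ v x → v < u → K ∋ x → G c (pair 1 (pair v x)) ≡ type v

  module _ {c₁ n₁ u₀ K₀} (K₀-Char : Char K₀) (block₀ : Block c₁ n₁ u₀ K₀)
    (sub₀ : ∀ d → c₁ ≈[ n₁ ] d → ∀ x → K₀ ∋ x → x < u₀ → Vx (G d) x)
    (ind₀ : ∀ d → c₁ ≈[ n₁ ] d → ∀ x y → K₀ ∋ x → K₀ ∋ y → x < u₀ → y < u₀ → ¬ Ex (G d) x y) where

    module _ (c : I) (c₁≈c : c₁ ≈[ n₁ ] c) (u : ℕ) (u₀≤u : u₀ ≤ u) where

      module _ (C : Baire) (C⊆V : ∀ x → C ∋ x → Vx (G c) x) (C-inf : Infinite (C ∋_)) (τ : Baire)
        (b : ℕ) (uniform : ∀ v → v < u → ∀ x → C ∋ x → b ≤ x → G c (pair 1 (pair v x)) ≡ τ v) where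

        X : ℕ → Set
        X x = C ∋ x × b ⊔ u ≤ x

        X-inf : Infinite X
        X-inf n = let (m , l , h) = C-inf (n ⊔ (b ⊔ u)) in m , ≤-trans (m≤m⊔n n (b ⊔ u)) l , h , ≤-trans (m≤n⊔m n (b ⊔ u)) l

        X-type : ∀ v x → v < u → X x → G c (pair 1 (pair v x)) ≡ τ v
        X-type v x l (h , l′) = uniform v l x h (≤-trans (m≤m⊔n b u) l′)

        u≤X : ∀ x → X x → u ≤ x
        u≤X x (_ , l) = ≤-trans (m≤n⊔m b u) l

        module _ (N : ℕ) (degree : ∀ x → N ≤ x → X x → Infinite (λ y → X y × Ex (G c) x y)) where

          Glued : ℕ → Set
          Glued x = (x < u₀ × K₀ ∋ x) ⊎ (X x × N ≤ x)

          X-glued-inf : ∀ {Q : ℕ → Set} → Infinite (λ y → X y × Q y) → Infinite (λ y → char Glued ∋ y × Q y)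
          X-glued-inf inf k = let (m , l , mX , q) = inf (N ⊔ k)
            in m , ≤-trans (m≤n⊔m N k) l , char-in Glued (inj₂ (mX , ≤-trans (m≤m⊔n N k) l)) , q

          glued-degrees : ∀ v → Glued v → Infinite (HN (G c) (char Glued) v) ⊎ Empty (HN (G c) (char Glued) v)
          glued-degrees v (inj₂ (vX , l)) = inj₁ (X-glued-inf (degree v l vX))
          glued-degrees v (inj₁ (v<u₀ , v∈K)) = case τ v ≟ 1 of λ where
            (yes e) → inj₁ (X-glued-inf λ k → let (m , l , mX) = X-inf k
                        in m , l , mX , trans (X-type v m (≤-trans v<u₀ u₀≤u) mX) e)
            (no ne) → inj₂ λ y (y∈ , e) → case char-out Glued y∈ of λ where
                        (inj₁ (y<u₀ , y∈K)) → ind₀ c c₁≈c v y v∈K y∈K v<u₀ y<u₀ e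
                        (inj₂ (yX , _)) → ne (trans (sym (X-type v y (≤-trans v<u₀ u₀≤u) yX)) e)

          -- A vertex of the blocked part is adjacent to all of `X` or to none of it, according to
          -- `τ`. So this part and a tail of `X` with infinite degrees form a solution that extends
          -- a blocked set; hence `X` must contain an infinite independent set.
          extends-blocked : ⊥
          extends-blocked = block₀ c c₁≈c (char Glued)
            (λ x l → Char-≡ K₀-Char (char-Char Glued) (λ h → char-in Glued (inj₁ (l , h)))
               λ h → case char-out Glued h of λ where
                 (inj₁ (_ , h′)) → h′
                 (inj₂ (xX , _)) → ⊥-elim (<⇒≱ l (≤-trans u₀≤u (u≤X x xX))))
            ( ( char-Char Glued
              , (λ x h → case char-out Glued h of λ where
                   (inj₁ (l , h′)) → sub₀ c c₁≈c x h′ l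
                   (inj₂ ((h′ , _) , _)) → C⊆V x h′)
              , λ k → let (m , l , h , _) = X-glued-inf {λ _ → ⊤} (λ k → let (m , l , h) = X-inf k in m , l , h , tt) k
                      in m , l , h )
            , λ v h → glued-degrees v (char-out Glued h) )

        from-class : Layer c u
        from-class = case independent-or-cofinite em (G-graph c) X X-inf of λ where
          (inj₂ (N , degree)) → ⊥-elim (extends-blocked N degree)
          (inj₁ (K , (cK , K⊆X , K-inf) , ind)) → record
            { K = K ; type = τ ; sub = cK , (λ x h → C⊆V x (proj₁ (K⊆X x h))) , K-inf ; ind = ind
            ; u≤K = λ x h → u≤X x (K⊆X x h) ; same = λ v x l h → X-type v x l (K⊆X x h) }

      class-layer : (C : Baire) → (∀ x → C ∋ x → Vx (G c) x) → Infinite (C ∋_) → (τ : Baire) →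
        (∀ v → ∃ λ b → ∀ x → C ∋ x → b ≤ x → G c (pair 1 (pair v x)) ≡ τ v) → Layer c u
      class-layer C C⊆V C-inf τ C-lim =
        let (b , uniform) = collect (λ v b → ∀ x → C ∋ x → b ≤ x → G c (pair 1 (pair v x)) ≡ τ v)
                              (λ l q x h l′ → q x h (≤-trans l l′)) u (λ v _ → C-lim v)
        in from-class C C⊆V C-inf τ b uniform

      layer : Layer c u
      layer =
        let (C , _ , C⊆V , C-inf , τ , C-lim) =
              Cohesive.cohesive em (Vx (G c)) (proj₁ (proj₂ (G-graph c))) (λ v x → G c (pair 1 (pair v x)))
                (λ v x → proj₁ (G-graph c) (pair 1 (pair v x)))
        in class-layer C C⊆V C-inf τ C-lim

  record Layers : Set where
    field
      c     : ℕ → I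
      n u   : ℕ → ℕ
      grow  : ∀ k → n k < n (suc k)
      close : ∀ k → c k ≈[ n k ] c (suc k)
      lay   : ∀ k → Layer (c k) (u k)
      rep   : ℕ → ℕ
      rep∈  : ∀ k → Layer.K (lay k) ∋ rep k
      rep<u : ∀ k → rep k < u (suc k)
      agree : ∀ k d → c (suc k) ≈[ n (suc k) ] d → G (c k) ~[ bnd (u (suc k)) ] G d
      block : ∀ k → Block (c (suc k)) (n (suc k)) (u (suc k)) (Layer.K (lay k))

  module BuildLayers (c₀ : I) (K₀ : Baire) (sub₀ : InfSubset (Vx (G c₀)) K₀) (ind₀ : Independent (G c₀) K₀) where
    open Extension

    rep′ : ∀ {c u} → Layer c u → ℕ
    rep′ L = proj₁ (proj₂ (proj₂ (Layer.sub L)) 0)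

    rep∈′ : ∀ {c u} (L : Layer c u) → Layer.K L ∋ rep′ L
    rep∈′ L = proj₂ (proj₂ (proj₂ (proj₂ (Layer.sub L)) 0))

    ext′ : ∀ {c u} n (L : Layer c u) → Extension c n (Layer.K L) (suc (rep′ L))
    ext′ {c} n L = extend c n (Layer.K L) (independent-solution {G c} (Layer.sub L) (Layer.ind L)) (suc (rep′ L))

    L₀ : Layer c₀ 0
    -- For `u = 0` the type condition is empty, so the given independent set is the first layer. Its
    -- blocked part is the one from which `layer` produces all later layers.
    L₀ = record { K = K₀ ; type = λ _ → 0 ; sub = sub₀ ; ind = ind₀ ; u≤K = λ _ _ → z≤n ; same = λ _ _ () }

    E₀ : Extension c₀ 0 K₀ (suc (rep′ L₀))
    E₀ = ext′ 0 L₀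

    record State : Set where
      constructor mk
      field
        c : I
        n u : ℕ
        from-E₀ : next E₀ ≈[ level E₀ ] c
        n≥ : level E₀ ≤ n
        u≥ : use E₀ ≤ u
    module S = State

    layer′ : (s : State) → Layer (S.c s) (S.u s)
    layer′ s = layer (proj₁ sub₀) (block E₀)
        (λ d e x h x<u → trans (sym (agree E₀ d e (pair 0 x) (vertex<bnd x<u))) (proj₁ (proj₂ sub₀) x h))
        (λ d e x y hx hy x<u y<u edge → ind₀ x y hx hy (trans (agree E₀ d e (pair 1 (pair x y)) (edge<bnd x<u y<u)) edge))
        (S.c s) (S.from-E₀ s) (S.u s) (S.u≥ s)

    ext : (s : State) → Extension (S.c s) (S.n s) (Layer.K (layer′ s)) (suc (rep′ (layer′ s)))
    ext s = ext′ (S.n s) (layer′ s)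

    advance : State → State
    advance s = mk (next (ext s)) (level (ext s)) (use (ext s))
      (≈-trans (S.from-E₀ s) (≈-mono (S.n≥ s) (close (ext s))))
      (≤-trans (S.n≥ s) (<⇒≤ (n<level (ext s))))
      (≤-trans (S.u≥ s) (≤-trans (Layer.u≤K (layer′ s) (rep′ (layer′ s)) (rep∈′ (layer′ s))) (<⇒≤ (v≤use (ext s)))))

    st : ℕ → State
    st zero    = mk (next E₀) (level E₀) (use E₀) ≈-refl ≤-refl ≤-refl
    st (suc k) = advance (st k)

    c : ℕ → I
    c zero    = c₀
    c (suc k) = S.c (st k)

    n u : ℕ → ℕ
    n zero    = 0
    n (suc k) = S.n (st k)
    u zero    = 0
    u (suc k) = S.u (st k)

    lay : ∀ k → Layer (c k) (u k)
    lay zero    = L₀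
    lay (suc k) = layer′ (st k)

    layers : Layers
    layers = record
      { c = c ; n = n ; u = u
      ; grow = λ { zero → n<level E₀ ; (suc k) → n<level (ext (st k)) }
      ; close = λ { zero → close E₀ ; (suc k) → close (ext (st k)) }
      ; lay = lay ; rep = λ k → rep′ (lay k) ; rep∈ = λ k → rep∈′ (lay k)
      ; rep<u = λ { zero → v≤use E₀ ; (suc k) → v≤use (ext (st k)) }
      ; agree = λ { zero → agree E₀ ; (suc k) → agree (ext (st k)) }
      ; block = λ { zero → block E₀ ; (suc k) → block (ext (st k)) } }

  module Diagonalise (r : Layers) (d : I) (near : ∀ k → Layers.c r k ≈[ Layers.n r k ] d) where
    open Layers r
    open Chain c n grow close using (c-≤)
    module L k = Layer (lay k)

    g : Baire
    g = G d

    Part : ℕ → ℕ → Set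
    Part k x = L.K k ∋ x × x < u (suc k)

    u-step : ∀ k → u k < u (suc k)
    u-step k = ≤-<-trans (L.u≤K k (rep k) (rep∈ k)) (rep<u k)

    k≤u : ∀ k → k ≤ u k
    k≤u zero    = z≤n
    k≤u (suc k) = ≤-trans (s≤s (k≤u k)) (u-step k)

    u-mono : ∀ {k l} → k < l → u (suc k) ≤ u l
    u-mono {k} {suc l} (s≤s k≤l) with m≤n⇒m<n∨m≡n k≤l
    ... | inj₁ k<l  = ≤-trans (u-mono k<l) (<⇒≤ (u-step l))
    ... | inj₂ refl = ≤-refl

    part-vertex : ∀ k e → c (suc k) ≈[ n (suc k) ] e → ∀ {x} → Part k x → Vx (G e) x
    part-vertex k e ≈e {x} (x∈ , l) = trans (sym (agree k e ≈e (pair 0 x) (vertex<bnd l))) (proj₁ (proj₂ (L.sub k)) x x∈)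

    part-independent : ∀ k e → c (suc k) ≈[ n (suc k) ] e → ∀ {x y} → Part k x → Part k y → ¬ Ex (G e) x y
    part-independent k e ≈e {x} {y} (x∈ , l) (y∈ , l′) edge =
      L.ind k x y x∈ y∈ (trans (agree k e ≈e (pair 1 (pair x y)) (edge<bnd l l′)) edge)

    part-type : ∀ l {v x} → v < u l → Part l x → g (pair 1 (pair v x)) ≡ L.type l v
    part-type l {v} {x} v<u (x∈ , x<u) =
      trans (sym (agree l d (near (suc l)) (pair 1 (pair v x)) (edge<bnd (<-trans v<u (u-step l)) x<u))) (L.same l v x v<u x∈)

    module Unattached {k l} (k<l : k < l) (none : ∀ v → Part k v → L.type l v ≢ 1) where

      close-l : c (suc k) ≈[ n (suc k) ] c l
      close-l = c-≤ k<l

      Member : ℕ → Set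
      Member x = Part k x ⊎ L.K l ∋ x

      no-edge : ∀ x y → Part k x → L.K l ∋ y → ¬ Ex (G (c l)) x y
      no-edge x y px y∈ e = none x px (trans (sym (L.same l x y (<-≤-trans (proj₂ px) (u-mono k<l)) y∈)) e)

      independent : ∀ x y → Member x → Member y → ¬ Ex (G (c l)) x y
      independent x y (inj₁ px) (inj₁ py) e = part-independent k (c l) close-l px py e
      independent x y (inj₁ px) (inj₂ y∈) e = no-edge x y px y∈ e
      independent x y (inj₂ x∈) (inj₁ py) e = no-edge y x py x∈ (proj₂ (proj₂ (proj₂ (G-graph (c l)))) x y e)
      independent x y (inj₂ x∈) (inj₂ y∈) e = L.ind l x y x∈ y∈ e

      vertex : ∀ x → Member x → Vx (G (c l)) x
      vertex x (inj₁ px) = part-vertex k (c l) close-l px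
      vertex x (inj₂ x∈) = proj₁ (proj₂ (L.sub l)) x x∈

      to-K : ∀ x → x < u (suc k) → Member x → L.K k ∋ x
      to-K x l (inj₁ (x∈ , _)) = x∈
      to-K x l′ (inj₂ x∈) = ⊥-elim (<⇒≱ l′ (≤-trans (u-mono k<l) (L.u≤K l x x∈)))

      absurd : ⊥
      absurd = block k (c l) close-l (char Member)
        (λ x l → Char-≡ (proj₁ (L.sub k)) (char-Char Member) (λ h → char-in Member (inj₁ (h , l)))
                   (λ h → to-K x l (char-out Member h)))
        (independent-solution {G (c l)}
          ( char-Char Member , (λ x h → vertex x (char-out Member h))
          , λ m → let (x , b , x∈) = proj₂ (proj₂ (L.sub l)) m in x , b , char-in Member (inj₂ x∈) )
          (λ x y hx hy → independent x y (char-out Member hx) (char-out Member hy)))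

    attached : ∀ {k l} → k < l → ∃ λ v → Part k v × L.type l v ≡ 1
    attached k<l = by-contra λ none → Unattached.absurd k<l λ v pv e → none (v , pv , e)

    -- The single vertex `rep l` stands for the whole of layer `l`, whose elements agree in their
    -- adjacency to vertices below `u l`.
    adj : ℕ → ℕ → ℕ
    adj v l = g (pair 1 (pair v (rep l)))

    adj-type : ∀ l {v} → v < u l → adj v l ≡ L.type l v
    adj-type l v<u = part-type l v<u (rep∈ l , rep<u l)

    -- Along `Q` the limit type `τ` is reached in time: for `k < l` in `Q`, layer `l` has type `τ`
    -- on all vertices below `u (suc k)`. So a vertex of `Part k` is adjacent to all later parts in
    -- `Q` or to none of them.
    module _ (Q : Baire) (τ : Baire) (Q-inf : Infinite (Q ∋_))
      (Q-type : ∀ k l → Q ∋ k → Q ∋ l → k < l → ∀ v → v < u (suc k) → adj v l ≡ τ v)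
      (k₀ : ℕ) (k₀∈Q : Q ∋ k₀) where

      type-τ : ∀ {k l v} → Q ∋ k → Q ∋ l → k < l → v < u (suc k) → L.type l v ≡ τ v
      type-τ {k} {l} {v} qk ql k<l v<u = trans (sym (adj-type l (<-≤-trans v<u (u-mono k<l)))) (Q-type k l qk ql k<l v v<u)

      -- A vertex of a later part with `τ v` other than 1 might have neighbours in earlier parts
      -- only, hence finitely many; such vertices are left out. `Part k₀` has to be kept whole in
      -- order to extend the blocked set, but nothing precedes it, so its vertices of this kind have
      -- no neighbours at all.
      Active : ℕ → ℕ → Set
      Active l v = Q ∋ l × k₀ < l × Part l v × τ v ≡ 1

      -- The next layer in `Q` is attached to `Part l` at some vertex, and its type there is already
      -- the limit type.
      active : ∀ l → Q ∋ l → k₀ < l → ∃ (Active l)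
      active l ql k₀<l =
        let (l′ , l<l′ , ql′) = Q-inf (suc l)
            (v , pv , e) = attached l<l′
        in v , ql , k₀<l , pv , trans (sym (type-τ ql ql′ l<l′ (proj₂ pv))) e

      Member : ℕ → Set
      Member v = Part k₀ v ⊎ ∃ λ l → Active l v

      later-active : ∀ m → ∃ λ l → m ≤ l × ∃ (Active l)
      later-active m = let (l , b , ql) = Q-inf (m ⊔ suc k₀)
        in l , ≤-trans (m≤m⊔n m (suc k₀)) b , active l ql (≤-trans (m≤n⊔m m (suc k₀)) b)

      above : ∀ {l v} → Active l v → l ≤ v
      above {l} {v} (_ , _ , (v∈ , _) , _) = ≤-trans (k≤u l) (L.u≤K l v v∈)

      infinite-degree : ∀ {k v} → Q ∋ k → Part k v → τ v ≡ 1 → Infinite (HN g (char Member) v)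
      infinite-degree {k} {v} qk (v∈ , v<u) e m =
        let (l , b , w , aw) = later-active (m ⊔ suc k)
            (ql , _ , pw , _) = aw
            k<l = ≤-trans (m≤n⊔m m (suc k)) b
        in w , ≤-trans (≤-trans (m≤m⊔n m (suc k)) b) (above aw) , char-in Member (inj₂ (l , aw))
         , trans (part-type l (<-≤-trans v<u (u-mono k<l)) pw) (trans (type-τ qk ql k<l v<u) e)

      no-degree : ∀ {v} → Part k₀ v → τ v ≢ 1 → ∀ w → Member w → ¬ Ex g v w
      no-degree pv ne w (inj₁ pw) e = part-independent k₀ d (near (suc k₀)) pv pw e
      no-degree {v} pv ne w (inj₂ (l , ql , k₀<l , pw , _)) e =
        ne (trans (sym (type-τ k₀∈Q ql k₀<l (proj₂ pv)))
             (trans (sym (part-type l (<-≤-trans (proj₂ pv) (u-mono k₀<l)) pw)) e))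

      degrees : ∀ v → Member v → Infinite (HN g (char Member) v) ⊎ Empty (HN g (char Member) v)
      degrees v (inj₂ (l , ql , _ , pv , e)) = inj₁ (infinite-degree ql pv e)
      degrees v (inj₁ pv) with τ v ≟ 1
      ... | yes e = inj₁ (infinite-degree k₀∈Q pv e)
      ... | no ne = inj₂ λ w (w∈ , e) → no-degree pv ne w (char-out Member w∈) e

      vertex : ∀ x → Member x → Vx g x
      vertex x (inj₁ px) = part-vertex k₀ d (near (suc k₀)) px
      vertex x (inj₂ (l , _ , _ , px , _)) = part-vertex l d (near (suc l)) px

      to-K : ∀ x → x < u (suc k₀) → Member x → L.K k₀ ∋ x
      to-K x l (inj₁ (x∈ , _)) = x∈
      to-K x l′ (inj₂ (l , _ , k₀<l , (x∈ , _) , _)) = ⊥-elim (<⇒≱ l′ (≤-trans (u-mono k₀<l) (L.u≤K l x x∈)))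

      absurd-Q : ⊥
      absurd-Q = block k₀ d (near (suc k₀)) (char Member)
        (λ x l → Char-≡ (proj₁ (L.sub k₀)) (char-Char Member) (λ h → char-in Member (inj₁ (h , l)))
                   (λ h → to-K x l (char-out Member h)))
        ( ( char-Char Member , (λ x h → vertex x (char-out Member h))
          , λ m → let (l , b , v , av) = later-active m in v , ≤-trans b (above av) , char-in Member (inj₂ (l , av)) )
        , λ v h → degrees v (char-out Member h) )

    module _ (C : Baire) (τ : Baire) (C-inf : Infinite (C ∋_))
      (C-lim : ∀ v → ∃ λ b → ∀ l → C ∋ l → b ≤ l → adj v l ≡ τ v) where

      Uniform : ℕ → ℕ → Set
      Uniform k l = ∀ v → v < u (suc k) → adj v l ≡ τ v

      eventually : ∀ k → C ∋ k → ∃ λ b → ∀ l → b ≤ l → C ∋ l → Uniform k l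
      eventually k _ = let (b , h) = collect (λ v b → ∀ l → C ∋ l → b ≤ l → adj v l ≡ τ v)
                                       (λ l q m h l′ → q m h (≤-trans l l′)) (u (suc k)) (λ v _ → C-lim v)
                       in b , λ l b≤l l∈C v v<u → h v v<u l l∈C b≤l

      absurd-C : ⊥
      absurd-C =
        let (Q , _ , Q-in , Q-inf , Q-unif) = Thin.thin em (λ l → C ∋ l) Uniform C-inf eventually 0
            (k₀ , _ , k₀∈Q) = Q-inf 0
        in absurd-Q Q τ Q-inf Q-unif k₀ k₀∈Q

    absurd : ⊥
    absurd =
      let (C , _ , _ , C-inf , τ , C-lim) =
            Cohesive.cohesive em (λ _ → ⊤) (λ n → n , ≤-refl , tt) adj (λ v l → proj₁ (G-graph d) (pair 1 (pair v (rep l))))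
      in absurd-C C τ C-inf C-lim

  independent-absurd : ∀ c₀ K₀ → InfSubset (Vx (G c₀)) K₀ → ¬ Independent (G c₀) K₀
  independent-absurd c₀ K₀ sub₀ ind₀ = go (BuildLayers.layers c₀ K₀ sub₀ ind₀)
    where
    go : Layers → ⊥
    go r = let (d , near) = Chain.lim-exists (Layers.c r) (Layers.n r) (Layers.grow r) (Layers.close r)
           in Diagonalise.absurd r d near

  impossible : I → ⊥
  impossible c₀ = NoIndependent.absurd independent-absurd (NoIndependent.Build.run independent-absurd c₀)

-- DNR

constₜ : ℕ → Tm
constₜ zero    = Zₜ
constₜ (suc n) = Sₜ ∘ₜ constₜ n

eval-const : ∀ n p x → eval (constₜ n) p x ≡ n
eval-const zero    p x = refl
eval-const (suc n) p x = cong suc (eval-const n p x)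

-- As a functional this term finds the first nonzero entry of column `j` and returns its
-- predecessor, whatever the input. It diverges as long as the column is zero and can be given any
-- value by changing one entry.
columnₜ : ℕ → Tm
columnₜ j = Oₜ ∘ₜ ⟪ constₜ j , Rₜ ⟫

eval-column : ∀ j p n s → eval (columnₜ j) p (pair n s) ≡ p (pair j s)
eval-column j p n s = cong₂ (λ a b → p (pair a b)) (eval-const j p (pair n s)) (right-pair n s)

node : ℕ → ℕ → ℕ → ℕ
node r a b = r + pair a b * 9

node-% : ∀ r a b → node r a b % 9 ≡ r % 9
node-% r a b = [m+kn]%n≡m%n r (pair a b) 9

node-/ : ∀ r a b → r < 9 → node r a b / 9 ≡ pair a b
node-/ r a b r<9 = trans (+-distrib-/-∣ʳ r (n∣m*n (pair a b)))
  (cong₂ _+_ (m<n⇒m/n≡0 r<9) (m*n/n≡m (pair a b) 9))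

encode : Tm → ℕ
encode Zₜ = 0
encode Sₜ = 1
encode Iₜ = 2
encode Lₜ = 3
encode Rₜ = 4
encode Oₜ = 5
encode (f ∘ₜ g) = node 6 (encode f) (encode g)
encode ⟪ f , g ⟫ = node 7 (encode f) (encode g)
encode (recₜ f g) = node 8 (encode f) (encode g)

-- Justifies the fuel of `decode′`: the tags 6, 7 and 8 of the compound terms are positive, which
-- makes the inequality strict even for the code 0 of the children.
pair<node : ∀ r a b → pair a b < node (suc r) a b
pair<node r a b = s≤s (≤-trans (m≤m*n (pair a b) 9) (m≤n+m (pair a b * 9) r))

decode′-encode : ∀ t n → encode t < n → decode′ n (encode t) ≡ t
decode′-node : ∀ r f g n → suc r < 9 → node (suc r) (encode f) (encode g) < suc n →
  decode′ (suc n) (node (suc r) (encode f) (encode g)) ≡ pick (suc r % 9) f g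
decode′-encode Zₜ (suc n) l = refl
decode′-encode Sₜ (suc n) l = refl
decode′-encode Iₜ (suc n) l = refl
decode′-encode Lₜ (suc n) l = refl
decode′-encode Rₜ (suc n) l = refl
decode′-encode Oₜ (suc n) l = refl
decode′-encode (f ∘ₜ g) (suc n) l = decode′-node 5 f g n (s≤s (s≤s (s≤s (s≤s (s≤s (s≤s (s≤s z≤n))))))) l
decode′-encode ⟪ f , g ⟫ (suc n) l = decode′-node 6 f g n (s≤s (s≤s (s≤s (s≤s (s≤s (s≤s (s≤s (s≤s z≤n)))))))) l
decode′-encode (recₜ f g) (suc n) l = decode′-node 7 f g n ≤-refl l
decode′-node r f g n r<9 (s≤s l)
  rewrite node-% (suc r) (encode f) (encode g) | node-/ (suc r) (encode f) (encode g) r<9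
        | unpair-pair (encode f) (encode g)
        | decode′-encode f n (≤-<-trans (left≤pair (encode f) (encode g)) (<-≤-trans (pair<node r (encode f) (encode g)) l))
        | decode′-encode g n (≤-<-trans (right≤pair (encode f) (encode g)) (<-≤-trans (pair<node r (encode f) (encode g)) l)) = refl

decode-encode : ∀ t → decode (encode t) ≡ t
decode-encode t = decode′-encode t (suc (encode t)) ≤-refl

update : Baire → ℕ → ℕ → Baire
update f k y i with i ≟ k
... | yes _ = y
... | no _  = f i

update-≡ : ∀ f k y → update f k y k ≡ y
update-≡ f k y with k ≟ k
... | yes _ = refl
... | no ne = ⊥-elim (ne refl)

update-≢ : ∀ f k y {i} → i ≢ k → update f k y i ≡ f i
update-≢ f k y {i} ne with i ≟ k
... | yes e = ⊥-elim (ne e)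
... | no _  = refl

skip : ℕ → ℕ → ℕ
skip n i with i <? n
... | yes _ = i
... | no _  = suc i

skip-< : ∀ {n i} → i < n → skip n i ≡ i
skip-< {n} {i} l with i <? n
... | yes _ = refl
... | no ¬l = ⊥-elim (¬l l)

skip-≢ : ∀ n i → skip n i ≢ n
skip-≢ n i e with i <? n
... | yes l = <-irrefl e l
... | no ¬l = ¬l (≤-reflexive e)

skip-injective : ∀ n i j → skip n i ≡ skip n j → i ≡ j
skip-injective n i j e with i <? n | j <? n
... | yes _ | yes _ = e
... | no _  | no _  = suc-injective e
... | yes l | no ¬l = ⊥-elim (¬l (<-trans ≤-refl (subst (_< n) e l)))
... | no ¬l | yes l = ⊥-elim (¬l (<-trans ≤-refl (subst (_< n) (sym e) l)))

-- `z` lists distinct columns that are still zero, the reserve for further diagonalisation. It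
-- belongs to the data so that a limit of instances still has infinitely many such columns.
record ZeroColumns : Set where
  field
    f     : Baire
    z     : Baire
    zero-col : ∀ i s → f (pair (z i) s) ≡ 0
    z-inj : ∀ i j → z i ≡ z j → i ≡ j

DNR-diagonal : Diagonal DNR
DNR-diagonal = record
  { I         = ZeroColumns
  ; inst      = f
  ; inst-dom  = λ _ → tt
  ; _≈[_]_    = λ c n d → f c ~[ n ] f d × z c ~[ n ] z d
  ; ≈-refl    = (λ _ _ → refl) , (λ _ _ → refl)
  ; ≈-trans   = λ (a , b) (a′ , b′) → ~-trans a a′ , ~-trans b b′
  ; ≈-mono    = λ l (a , b) → ~-≤ l a , ~-≤ l b
  ; inst-cont = λ c m → m , λ d → proj₁
  ; complete  = complete
  ; refute    = refute
  }
  where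
  open ZeroColumns
  complete : (c : ℕ → ZeroColumns) (n : ℕ → ℕ) → (∀ k → k ≤ n k) → (∀ k → n k ≤ n (suc k)) →
    (∀ k → f (c k) ~[ n k ] f (c (suc k)) × z (c k) ~[ n k ] z (c (suc k))) →
    ∃ λ d → ∀ k → f (c k) ~[ n k ] f d × z (c k) ~[ n k ] z d
  complete c n k≤n n-step close = record
      { f = lf.limit ; z = lz.limit
      ; zero-col = λ i s → let k = suc (i ⊔ pair (lz.limit i) s) in
          trans (sym (lf.F-limit k (pair (lz.limit i) s) (<-≤-trans (s≤s (m≤n⊔m i _)) (k≤n k))))
            (trans (cong (λ w → f (c k) (pair w s)) (sym (lz.F-limit k i (<-≤-trans (s≤s (m≤m⊔n i _)) (k≤n k)))))
              (zero-col (c k) i s))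
      ; z-inj = λ i j e → let k = suc (i ⊔ j) in
          z-inj (c k) i j (trans (lz.F-limit k i (<-≤-trans (s≤s (m≤m⊔n i j)) (k≤n k)))
            (trans e (sym (lz.F-limit k j (<-≤-trans (s≤s (m≤n⊔m i j)) (k≤n k))))))
      } , λ k → lf.F-limit k , lz.F-limit k
    where
    module lf = Limit (λ k → f (c k)) n k≤n n-step (λ k → proj₁ (close k))
    module lz = Limit (λ k → z (c k)) n k≤n n-step (λ k → proj₂ (close k))
  refute : ∀ c n r → sol DNR (f c) r → Refutes DNR f (λ c n d → f c ~[ n ] f d × z c ~[ n ] z d) c n r
  refute c n r _ = suc e₀ , λ m → d m , suc (pos m)
      , ((λ i l → unchanged m (<⇒≢ (<-≤-trans l (≤-trans (m≤n⊔m m n) (right≤pair j (m ⊔ n))))))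
        , λ i l → cong (z c) (sym (skip-< l)))
      , (λ i l → unchanged m (<⇒≢ (<-≤-trans l (≤-trans (m≤m⊔n m n) (right≤pair j (m ⊔ n))))))
      , λ e (near , _) r′ r~r′ r′-sol → r′-sol e₀ (r e₀)
          ( m ⊔ n
          , trans (cong (λ t → eval t (f e) (pair e₀ (m ⊔ n))) (decode-encode (columnₜ j)))
              (trans (eval-column j (f e) e₀ (m ⊔ n)) (trans (sym (near (pos m) ≤-refl)) (update-≡ (f c) (pos m) (suc (r e₀)))))
          , λ s l → trans (cong (λ t → eval t (f e) (pair e₀ s)) (decode-encode (columnₜ j)))
              (trans (eval-column j (f e) e₀ s) (trans (sym (near (pair j s) (s≤s (pair-mono {j} ≤-refl (<⇒≤ l)))))
                (trans (update-≢ (f c) (pos m) (suc (r e₀)) (λ eq → <⇒≢ l (proj₂ (pair-injective j s j (m ⊔ n) eq)))) (zero-col c n s)))))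
          (sym (r~r′ e₀ ≤-refl))
    where
    j e₀ : ℕ
    j  = z c n
    e₀ = encode (columnₜ j)
    pos : ℕ → ℕ
    -- This row lies beyond both bounds, so the change respects the agreement up to `m` and the
    -- closeness at level `n`.
    pos m = pair j (m ⊔ n)
    unchanged : ∀ m {i} → i ≢ pos m → f c i ≡ update (f c) (pos m) (suc (r e₀)) i
    unchanged m ne = sym (update-≢ (f c) (pos m) (suc (r e₀)) ne)
    d : ℕ → ZeroColumns
    -- Skipping index `n` removes the spent column from the reserve and leaves `z` unchanged below
    -- `n`.
    d m = record
      { f = update (f c) (pos m) (suc (r e₀)) ; z = λ i → z c (skip n i)
      ; zero-col = λ i s → trans (update-≢ (f c) (pos m) (suc (r e₀))
          (λ eq → skip-≢ n i (z-inj c (skip n i) n (proj₁ (pair-injective (z c (skip n i)) s j (m ⊔ n) eq))))) (zero-col c (skip n i) s)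
      ; z-inj = λ i j e → skip-injective n i j (z-inj c (skip n i) (skip n j) e) }

no-columns : ZeroColumns
no-columns = record { f = λ _ → 0 ; z = id ; zero-col = λ _ _ → refl ; z-inj = λ _ _ e → e }

approx : Tm → Baire → ℕ → ℕ → ℕ
approx t p n zero    = 0
approx t p n (suc s) with approx t p n s
... | zero  = eval t p (pair n s)
... | suc y = suc y

approx-cont : ∀ t p n s → ∃ λ u → ∀ p′ → p ~[ u ] p′ → approx t p n s ≡ approx t p′ n s
approx-cont t p n zero    = 0 , λ _ _ → refl
approx-cont t p n (suc s) = let (u , a) = approx-cont t p n s ; (w , b) = eval-cont t p (pair n s) in
  u ⊔ w , λ p′ e → step p′ (a p′ (~-≤ (m≤m⊔n u w) e)) (b p′ (~-≤ (m≤n⊔m u w) e))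
  where
  step : ∀ p′ → approx t p n s ≡ approx t p′ n s → eval t p (pair n s) ≡ eval t p′ (pair n s) →
         approx t p n (suc s) ≡ approx t p′ n (suc s)
  step p′ e e′ with approx t p n s | approx t p′ n s
  step p′ refl e′ | zero  | zero  = e′
  step p′ refl e′ | suc _ | suc _ = refl

approx-stays : ∀ t p n s y → approx t p n s ≡ suc y → ∀ k → approx t p n (k + s) ≡ suc y
approx-stays t p n s y e zero    = e
approx-stays t p n s y e (suc k) rewrite approx-stays t p n s y e k = refl

approx-settled : ∀ t p n s y → approx t p n s ≡ suc y → ∀ s′ → s ≤ s′ → approx t p n s′ ≡ suc y
approx-settled t p n s y e s′ l = subst (λ k → approx t p n k ≡ suc y) (m∸n+n≡m l) (approx-stays t p n s y e (s′ ∸ s))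

approx-zero : ∀ t p n s → (∀ s′ → s′ < s → eval t p (pair n s′) ≡ 0) → approx t p n s ≡ 0
approx-zero t p n zero    z = refl
approx-zero t p n (suc s) z rewrite approx-zero t p n s (λ s′ l → z s′ (m≤n⇒m≤1+n l)) = z s ≤-refl

approx-Conv : ∀ t p n y → (c : Conv t p n y) → approx t p n (suc (proj₁ c)) ≡ suc y
approx-Conv t p n y (s , e , z) rewrite approx-zero t p n s z = e

module _ (em : ExcludedMiddle 0ℓ) where

  -- The approximation is 0 until the computation halts with value `y` and `suc y` afterwards, so
  -- the limit itself avoids `y`.
  DNR≤lim : DNR ≤C lim
  DNR≤lim = record
    { fwd      = λ p _ k → approx (decode (fst k)) p (fst k) (snd k)
    ; fwd-dom  = λ p _ e → case em {∃ λ s → ∃ λ y → approx (decode e) p e s ≡ suc y} of λ where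
        (yes (s , y , h)) → suc y , s , λ s′ l → trans (at p e s′) (approx-settled (decode e) p e s y h s′ l)
        (no none) → 0 , 0 , λ s′ _ → trans (at p e s′) (zero-if (λ y h → none (s′ , y , h)))
    ; fwd-cont = λ p _ k → let (u , c) = approx-cont (decode (fst k)) p (fst k) (snd k) in u , λ p′ _ e → c p′ e
    ; bwd      = λ _ _ g _ → g
    ; bwd-sol  = λ p _ g g-sol e y conv g≡y → let (s₀ , h) = g-sol e in
        1+n≢n (trans (sym (approx-settled (decode e) p e (suc (proj₁ conv)) y (approx-Conv (decode e) p e y conv) (suc (proj₁ conv) ⊔ s₀) (m≤m⊔n _ s₀)))
          (trans (sym (at p e (suc (proj₁ conv) ⊔ s₀))) (trans (h (suc (proj₁ conv) ⊔ s₀) (m≤n⊔m (suc (proj₁ conv)) s₀)) g≡y)))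
    ; bwd-cont = λ _ _ g _ n → suc n , λ _ _ g′ _ _ e → e n ≤-refl
    }
    where
    at : ∀ p e s → approx (decode (fst (pair e s))) p (fst (pair e s)) (snd (pair e s)) ≡ approx (decode e) p e s
    at p e s = cong₂ (λ a b → approx (decode a) p a b) (left-pair e s) (right-pair e s)
    zero-if : ∀ {k} → (∀ y → k ≢ suc y) → k ≡ 0
    zero-if {zero}  _ = refl
    zero-if {suc y} h = ⊥-elim (h y refl)

-- SADC

≺-irrefl : ∀ {a} → ¬ (a ≺ a)
≺-irrefl (ω<ω l)   = <-irrefl refl l
≺-irrefl (ω*<ω* l) = <-irrefl refl l

≺-trans : ∀ {a b c} → a ≺ b → b ≺ c → a ≺ c
≺-trans (ω<ω l)   (ω<ω l′)   = ω<ω (<-trans l l′)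
≺-trans (ω<ω _)   ω<ω*       = ω<ω*
≺-trans ω<ω*      (ω*<ω* _)  = ω<ω*
≺-trans (ω*<ω* l) (ω*<ω* l′) = ω*<ω* (<-trans l′ l)

≺-total : ∀ a b → a ≺ b ⊎ a ≡ b ⊎ b ≺ a
≺-total (inj₁ a) (inj₁ b) with <-cmp a b
... | tri< l _ _    = inj₁ (ω<ω l)
... | tri≈ _ refl _ = inj₂ (inj₁ refl)
... | tri> _ _ l    = inj₂ (inj₂ (ω<ω l))
≺-total (inj₁ _) (inj₂ _) = inj₁ ω<ω*
≺-total (inj₂ _) (inj₁ _) = inj₂ (inj₂ ω<ω*)
≺-total (inj₂ a) (inj₂ b) with <-cmp a b
... | tri< l _ _    = inj₂ (inj₂ (ω*<ω* l))
... | tri≈ _ refl _ = inj₂ (inj₁ refl)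
... | tri> _ _ l    = inj₁ (ω*<ω* l)

≺-swap : ∀ {a b} → a ≺ b → swap b ≺ swap a
≺-swap (ω<ω l)   = ω*<ω* l
≺-swap ω<ω*      = ω<ω*
≺-swap (ω*<ω* l) = ω<ω l

≺-inj₁ : ∀ {z i} → z ≺ inj₁ i → ∃ λ j → j < i × z ≡ inj₁ j
≺-inj₁ (ω<ω l) = _ , l , refl

inj₂-≺ : ∀ {z i} → inj₂ i ≺ z → ∃ λ j → j < i × z ≡ inj₂ j
inj₂-≺ (ω*<ω* l) = _ , l , refl

less : ℕ ⊎ ℕ → ℕ ⊎ ℕ → ℕ
less a b with ≺-total a b
... | inj₁ _ = 1
... | inj₂ _ = 0

less-in : ∀ {a b} → a ≺ b → less a b ≡ 1
less-in {a} {b} l with ≺-total a b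
... | inj₁ _ = refl
... | inj₂ (inj₁ refl) = ⊥-elim (≺-irrefl l)
... | inj₂ (inj₂ g) = ⊥-elim (≺-irrefl (≺-trans l g))

less-out : ∀ {a b} → less a b ≡ 1 → a ≺ b
less-out {a} {b} e with ≺-total a b
less-out e  | inj₁ l = l
less-out () | inj₂ _

less-0 : ∀ {a b} → ¬ (a ≺ b) → less a b ≡ 0
less-0 {a} {b} n with ≺-total a b
... | inj₁ l = ⊥-elim (n l)
... | inj₂ _ = refl

less≤1 : ∀ a b → less a b ≤ 1
less≤1 a b with ≺-total a b
... | inj₁ _ = ≤-refl
... | inj₂ _ = z≤n

idx : ℕ ⊎ ℕ → ℕ
idx (inj₁ a) = a
idx (inj₂ a) = a

-- Bijections of ω + ω* that move the cut

drop : ℕ → ℕ → ℕ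
drop a c with c <? a
... | yes _ = c
... | no _  = pred c

drop-< : ∀ {a c} → c < a → drop a c ≡ c
drop-< {a} {c} l with c <? a
... | yes _ = refl
... | no ¬l = ⊥-elim (¬l l)

drop-> : ∀ {a c} → a ≤ c → drop a c ≡ pred c
drop-> {a} {c} l with c <? a
... | yes l′ = ⊥-elim (<⇒≱ l′ l)
... | no _   = refl

skip-≥ : ∀ {n i} → n ≤ i → skip n i ≡ suc i
skip-≥ {n} {i} l with i <? n
... | yes l′ = ⊥-elim (<⇒≱ l′ l)
... | no _   = refl

drop-skip : ∀ a c → drop a (skip a c) ≡ c
drop-skip a c with c <? a
... | yes l = drop-< l
... | no ¬l = drop-> (≤-trans (≮⇒≥ ¬l) (n≤1+n c))

skip-drop : ∀ a c → c ≢ a → skip a (drop a c) ≡ c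
skip-drop a c ne with <-cmp c a
... | tri< l _ _ = trans (cong (skip a) (drop-< l)) (skip-< l)
... | tri≈ _ e _ = ⊥-elim (ne e)
skip-drop a (suc c) ne | tri> _ _ (s≤s l) = trans (cong (skip a) (drop-> (≤-trans l (n≤1+n c)))) (skip-≥ l)

-- Moves the a-th element of the ω part to position b of the ω* part.
move : ℕ → ℕ → ℕ ⊎ ℕ → ℕ ⊎ ℕ
move a b (inj₁ c) with c ≟ a
... | yes _ = inj₂ b
... | no _  = inj₁ (drop a c)
move a b (inj₂ c) = inj₂ (skip b c)

move-≡ : ∀ a b → move a b (inj₁ a) ≡ inj₂ b
move-≡ a b with a ≟ a
... | yes _ = refl
... | no ne = ⊥-elim (ne refl)

move-≢ : ∀ a b {c} → c ≢ a → move a b (inj₁ c) ≡ inj₁ (drop a c)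
move-≢ a b {c} ne with c ≟ a
... | yes e = ⊥-elim (ne e)
... | no _  = refl

-- Exchanging the two halves turns the inverse of a move into a move, so one inverse law yields the
-- other.
unmove : ℕ → ℕ → ℕ ⊎ ℕ → ℕ ⊎ ℕ
unmove a b z = swap (move b a (swap z))

unmove-move : ∀ a b z → unmove a b (move a b z) ≡ z
unmove-move a b (inj₁ c) = case c ≟ a of λ where
  (yes refl) → trans (cong (unmove a b) (move-≡ a b)) (cong swap (move-≡ b a))
  (no ne)    → trans (cong (unmove a b) (move-≢ a b ne)) (cong inj₁ (skip-drop a c ne))
unmove-move a b (inj₂ c) = cong swap (trans (move-≢ b a (skip-≢ b c)) (cong inj₁ (drop-skip b c)))

move-unmove : ∀ a b z → move a b (unmove a b z) ≡ z
move-unmove a b z = trans (sym (swap-involutive (move a b (unmove a b z))))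
  (trans (cong swap (unmove-move b a (swap z))) (swap-involutive z))

Used : ℕ → ℕ → ℕ ⊎ ℕ → Set
Used T₁ T₂ (inj₁ c) = c < T₁
Used T₁ T₂ (inj₂ c) = c < T₂

move-fix₁ : ∀ a b {c} → c < a → move a b (inj₁ c) ≡ inj₁ c
move-fix₁ a b l = trans (move-≢ a b (<⇒≢ l)) (cong inj₁ (drop-< l))

move-fix₂ : ∀ a b {c} → c < b → move a b (inj₂ c) ≡ inj₂ c
move-fix₂ a b l = cong inj₂ (skip-< l)

move-used : ∀ a b z → Used (suc a) b z → Used a (suc b) (move a b z)
move-used a b (inj₁ c) (s≤s l) with m≤n⇒m<n∨m≡n l
... | inj₁ c<a  = subst (Used a (suc b)) (sym (move-fix₁ a b c<a)) c<a
... | inj₂ refl = subst (Used a (suc b)) (sym (move-≡ a b)) ≤-refl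
move-used a b (inj₂ c) l = subst (Used a (suc b)) (sym (move-fix₂ a b l)) (m≤n⇒m≤1+n l)

move-mono : ∀ a b {z z′} → Used (suc a) b z → Used (suc a) b z′ → z ≺ z′ → move a b z ≺ move a b z′
move-mono a b {inj₁ c} {inj₁ c′} (s≤s u) (s≤s u′) (ω<ω l) with m≤n⇒m<n∨m≡n u′
... | inj₁ c′<a rewrite move-fix₁ a b (<-trans l c′<a) | move-fix₁ a b c′<a = ω<ω l
... | inj₂ refl rewrite move-fix₁ a b l | move-≡ a b = ω<ω*
move-mono a b {inj₁ c} {inj₂ c′} (s≤s u) u′ ω<ω* with m≤n⇒m<n∨m≡n u
... | inj₁ c<a  rewrite move-fix₁ a b c<a = ω<ω*
... | inj₂ refl rewrite move-≡ a b | skip-< u′ = ω*<ω* u′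
move-mono a b {inj₂ c} {inj₂ c′} u u′ (ω*<ω* l) rewrite skip-< u | skip-< u′ = ω*<ω* l

record Shift (i T₁ T₂ : ℕ) : Set where
  field
    π ρ   : ℕ ⊎ ℕ → ℕ ⊎ ℕ
    ρπ    : ∀ z → ρ (π z) ≡ z
    πρ    : ∀ z → π (ρ z) ≡ z
    fix₁  : ∀ c → c ≤ i → π (inj₁ c) ≡ inj₁ c
    fix₂  : ∀ c → c < T₂ → π (inj₂ c) ≡ inj₂ c
    moves : ∀ c → i < c → c < T₁ → ∃ λ c′ → π (inj₁ c) ≡ inj₂ c′
    mono  : ∀ {z z′} → Used T₁ T₂ z → Used T₁ T₂ z′ → z ≺ z′ → π z ≺ π z′

-- The used elements of the ω part above `i` are moved one at a time, the last one first, so that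
-- `move-mono` applies to every step; each move enlarges the used part of ω* by one.
shift : ∀ i T₁ T₂ → i < T₁ → Shift i T₁ T₂
shift i (suc a) T₂ (s≤s i≤a) with m≤n⇒m<n∨m≡n i≤a
... | inj₂ refl = record
  { π = id ; ρ = id ; ρπ = λ _ → refl ; πρ = λ _ → refl ; fix₁ = λ _ _ → refl ; fix₂ = λ _ _ → refl
  ; moves = λ c l l′ → ⊥-elim (<⇒≱ l (≤-pred l′)) ; mono = λ _ _ l → l }
... | inj₁ i<a = record
  { π = λ z → π (move a T₂ z) ; ρ = λ z → unmove a T₂ (ρ z)
  ; ρπ = λ z → trans (cong (unmove a T₂) (ρπ (move a T₂ z))) (unmove-move a T₂ z)
  ; πρ = λ z → trans (cong π (move-unmove a T₂ (ρ z))) (πρ z)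
  ; fix₁ = λ c l → trans (cong π (move-fix₁ a T₂ (≤-<-trans l i<a))) (fix₁ c l)
  ; fix₂ = λ c l → trans (cong π (move-fix₂ a T₂ l)) (fix₂ c (m≤n⇒m≤1+n l))
  ; moves = λ c l l′ → case m≤n⇒m<n∨m≡n (≤-pred l′) of λ where
      (inj₁ c<a)  → let (c′ , e) = moves c l c<a in c′ , trans (cong π (move-fix₁ a T₂ c<a)) e
      (inj₂ refl) → T₂ , trans (cong π (move-≡ a T₂)) (fix₂ T₂ ≤-refl)
  ; mono = λ {z} {z′} u u′ l → mono (move-used a T₂ z u) (move-used a T₂ z′ u′) (move-mono a T₂ u u′ l)
  }
  where open Shift (shift i a (suc T₂) i<a)

-- `in₁` and `in₂` are the two injections in either order, so that ascending and descending chains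
-- share one argument. The order has to be preserved only on indices below `T`, a finite part.
record Cut (in₁ in₂ : ℕ → ℕ ⊎ ℕ) (i T : ℕ) : Set where
  field
    π ρ   : ℕ ⊎ ℕ → ℕ ⊎ ℕ
    ρπ    : ∀ z → ρ (π z) ≡ z
    πρ    : ∀ z → π (ρ z) ≡ z
    fix   : ∀ z → idx z ≤ i → π z ≡ z
    stays : π (in₁ i) ≡ in₁ i
    moves : ∀ c → i < c → c < T → ∃ λ c′ → π (in₁ c) ≡ in₂ c′
    mono  : ∀ {z z′} → idx z < T → idx z′ < T → z ≺ z′ → π z ≺ π z′

idx-used : ∀ T z → idx z < T → Used T T z
idx-used T (inj₁ _) l = l
idx-used T (inj₂ _) l = l

idx-swap : ∀ z → idx (swap z) ≡ idx z
idx-swap (inj₁ _) = refl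
idx-swap (inj₂ _) = refl

cut₁ : ∀ i T → i < T → Cut inj₁ inj₂ i T
cut₁ i T i<T = record
  { π = π ; ρ = ρ ; ρπ = ρπ ; πρ = πρ
  ; fix = λ { (inj₁ c) l → fix₁ c l ; (inj₂ c) l → fix₂ c (≤-<-trans l i<T) }
  ; stays = fix₁ i ≤-refl ; moves = moves
  ; mono = λ {z} {z′} l l′ → mono (idx-used T z l) (idx-used T z′ l′) }
  where open Shift (shift i T T i<T)

cut₂ : ∀ i T → i < T → Cut inj₂ inj₁ i T
cut₂ i T i<T = record
  { π = λ z → swap (π (swap z)) ; ρ = λ z → swap (ρ (swap z))
  ; ρπ = λ z → trans (cong (swap ∘ ρ) (swap-involutive (π (swap z)))) (trans (cong swap (ρπ (swap z))) (swap-involutive z))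
  ; πρ = λ z → trans (cong (swap ∘ π) (swap-involutive (ρ (swap z)))) (trans (cong swap (πρ (swap z))) (swap-involutive z))
  ; fix = λ z l → trans (cong swap (fix (swap z) (subst (_≤ i) (sym (idx-swap z)) l))) (swap-involutive z)
  ; stays = cong swap stays
  ; moves = λ c l l′ → let (c′ , e) = moves c l l′ in c′ , cong swap e
  ; mono = λ {z} {z′} l l′ h → ≺-swap (mono (subst (_< T) (sym (idx-swap z′)) l′) (subst (_< T) (sym (idx-swap z)) l) (≺-swap h)) }
  where open Cut (cut₁ i T i<T)

-- Chains in orders of type ω + ω*, and upper bounds for SADC

module TypeFacts (p : Baire) (ord : IsLinOrd p) (ty : TypeωPlusωStar p) where

  h : ℕ → ℕ ⊎ ℕ
  h = proj₁ ty

  h-mono : ∀ x y → Ltx p x y → h x ≺ h y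
  h-mono x y l = let (lx , ly) = proj₁ (proj₂ (proj₂ ord)) x y l in proj₁ (proj₁ (proj₂ ty) x y lx ly) l

  h-inj : ∀ {x y} → Lx p x → Lx p y → h x ≡ h y → x ≡ y
  h-inj {x} {y} lx ly e with x ≟ y
  ... | yes eq = eq
  ... | no ne with proj₂ (proj₂ (proj₂ (proj₂ (proj₂ ord)))) x y lx ly ne
  ...   | inj₁ l = ⊥-elim (≺-irrefl (subst (_≺ h y) e (h-mono x y l)))
  ...   | inj₂ l = ⊥-elim (≺-irrefl (subst (h y ≺_) e (h-mono y x l)))

  bounded : ∀ (inn : ℕ → ℕ ⊎ ℕ) i → ∃ λ b → ∀ j → j < i → ∀ y → Lx p y → h y ≡ inn j → y < b
  bounded inn i = collect (λ j b → ∀ y → Lx p y → h y ≡ inn j → y < b) (λ l q y ly e → ≤-trans (q y ly e) l) i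
    λ j _ → let (x , lx , hx) = proj₂ (proj₂ ty) (inn j)
            in suc x , λ y ly hy → s≤s (≤-reflexive (h-inj ly lx (trans hy (sym hx))))

  finite-below : ∀ {x i} → h x ≡ inj₁ i → Finite (λ y → Ltx p y x)
  finite-below {x} {i} hx = let (b , q) = bounded inj₁ i in b , λ y l →
    let (j , j<i , e) = ≺-inj₁ (subst (h y ≺_) hx (h-mono y x l)) in q j j<i y (proj₁ (proj₁ (proj₂ (proj₂ ord)) y x l)) e

  finite-above : ∀ {x i} → h x ≡ inj₂ i → Finite (λ y → Ltx p x y)
  finite-above {x} {i} hx = let (b , q) = bounded inj₂ i in b , λ y l →
    let (j , j<i , e) = inj₂-≺ (subst (_≺ h y) hx (h-mono x y l)) in q j j<i y (proj₂ (proj₁ (proj₂ (proj₂ ord)) x y l)) e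

  connected : ∀ {x y} → Lx p x → Lx p y → x < y → Ltx p x y ⊎ Ltx p y x
  connected lx ly l = proj₂ (proj₂ (proj₂ (proj₂ (proj₂ ord)))) _ _ lx ly (<⇒≢ l)

  asymmetric : ∀ x y → Ltx p x y → ¬ Ltx p y x
  asymmetric x y l l′ = ≺-irrefl (≺-trans (h-mono x y l) (h-mono y x l′))

  module _ {r : Baire} (r⊆L : InfSubset (Lx p) r) where

    not-both-finite : ∀ y {P Q : ℕ → Set} → Finite (λ x → r ∋ x × P x) → Finite Q →
      ¬ (∀ x → y < x → r ∋ x → P x ⊎ Q x)
    not-both-finite y (b , P-fin) (b′ , Q-fin) either =
      let (x , l , x∈) = proj₂ (proj₂ r⊆L) (suc y ⊔ (b ⊔ b′))
      in case either x (≤-trans (max₁ (suc y) b b′) l) x∈ of λ where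
           (inj₁ px) → <⇒≱ (P-fin x (x∈ , px)) (≤-trans (max₂ (suc y) b b′) l)
           (inj₂ qx) → <⇒≱ (Q-fin x qx) (≤-trans (max₃ (suc y) b b′) l)

    comparable : ∀ y → r ∋ y → ∀ x → y < x → r ∋ x → Ltx p y x ⊎ Ltx p x y
    comparable y y∈ x l x∈ = connected (proj₁ (proj₂ r⊆L) y y∈) (proj₁ (proj₂ r⊆L) x x∈) l

    -- An element of the ω* part has only finitely many elements above it. In an ascending chain
    -- finitely many lie below it too, but the chain is infinite.
    ascending-in-ω : (∀ y → r ∋ y → Finite (λ x → r ∋ x × Ltx p x y)) → ∀ y → r ∋ y → ∃ λ i → h y ≡ inj₁ i
    ascending-in-ω asc y y∈ with h y in e
    ... | inj₁ i = i , refl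
    ... | inj₂ i = ⊥-elim (not-both-finite y (asc y y∈) (finite-above e) λ x l x∈ → swap (comparable y y∈ x l x∈))

    descending-in-ω* : (∀ y → r ∋ y → Finite (λ x → r ∋ x × Ltx p y x)) → ∀ y → r ∋ y → ∃ λ i → h y ≡ inj₂ i
    descending-in-ω* desc y y∈ with h y in e
    ... | inj₂ i = i , refl
    ... | inj₁ i = ⊥-elim (not-both-finite y (desc y y∈) (finite-below e) (comparable y y∈))

-- With all numbers in the order, comparing `x` and `y` is a colouring of pairs that needs no search
-- for elements, and it is stable.
SADCω : Problem
SADCω = record { dom = λ p → dom SADC p × (∀ x → Lx p x) ; sol = sol SADC }

SADCω≤SADC : SADCω ≤C SADC
SADCω≤SADC = record
  { fwd = λ p _ → p ; fwd-dom = λ _ d → proj₁ d ; fwd-cont = λ _ _ n → suc n , λ _ _ e → e n ≤-refl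
  ; bwd = λ _ _ g _ → g ; bwd-sol = λ _ _ _ s → s ; bwd-cont = λ _ _ _ _ n → suc n , λ _ _ _ _ _ e → e n ≤-refl }

SADCω-homogeneous : ∀ p → (∀ x → Lx p x) → ∀ g → sol RT22 (λ n → p (pair 1 n)) g → (∀ x y → Ltx p x y → ¬ Ltx p y x) → sol SADC p g
SADCω-homogeneous p all g ((cg , _ , inf) , i , hom) asym = (cg , (λ x _ → all x) , inf) , side (i ≟ 1)
  where
  side : Dec (i ≡ 1) → (∀ y → g ∋ y → Finite (λ x → g ∋ x × Ltx p x y)) ⊎ (∀ y → g ∋ y → Finite (λ x → g ∋ x × Ltx p y x))
  side (yes refl) = inj₁ λ y y∈ → suc y , λ x (x∈ , l) → ≰⇒> λ y<x → asym y x (hom y x y∈ x∈ y<x) l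
  side (no ne)    = inj₂ λ y y∈ → suc y , λ x (x∈ , l) → ≰⇒> λ y<x → ne (trans (sym (hom y x y∈ x∈ y<x)) l)

SADCω≤RT22 : SADCω ≤C RT22
SADCω≤RT22 = record
  { fwd = λ p _ n → p (pair 1 n) ; fwd-dom = λ p ((ord , _) , _) x y _ → proj₁ ord (pair 1 (pair x y))
  ; fwd-cont = λ _ _ n → suc (pair 1 n) , λ _ _ e → e (pair 1 n) ≤-refl
  ; bwd = λ _ _ g _ → g
  ; bwd-sol = λ p ((ord , ty) , all) g s → SADCω-homogeneous p all g s (TypeFacts.asymmetric p ord ty)
  ; bwd-cont = λ _ _ _ _ n → suc n , λ _ _ _ _ _ e → e n ≤-refl }

SADCω-stable : ∀ p → dom SADCω p → Stable (λ n → p (pair 1 n))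
SADCω-stable p ((ord , ty) , all) x = by (h x) refl
  where
  open TypeFacts p ord ty
  by : ∀ z → h x ≡ z → Σ ℕ λ i → Σ ℕ λ s₀ → ∀ s → s₀ ≤ s → x < s → p (pair 1 (pair x s)) ≡ i
  by (inj₁ i) e = let (b , fin) = finite-below e in 1 , b , λ s l x<s → case connected (all x) (all s) x<s of λ where
    (inj₁ lt) → lt
    (inj₂ gt) → ⊥-elim (<⇒≱ (fin s gt) l)
  by (inj₂ i) e = let (b , fin) = finite-above e in 0 , b , λ s l x<s → case Char-cases (proj₁ ord) (pair 1 (pair x s)) of λ where
    (inj₁ z) → z
    (inj₂ lt) → ⊥-elim (<⇒≱ (fin s lt) l)

SADCω≤SRT22 : SADCω ≤C SRT22
SADCω≤SRT22 = record
  { fwd = φ.fwd ; fwd-dom = λ p d → φ.fwd-dom p d , SADCω-stable p d ; fwd-cont = φ.fwd-cont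
  ; bwd = φ.bwd ; bwd-sol = φ.bwd-sol ; bwd-cont = φ.bwd-cont }
  where module φ = _≤C_ SADCω≤RT22

-- A stage need not belong to the order, so `x` is compared with the last element of the order
-- before the stage. As the order is infinite, these comparisons have the limit required for `lim`.
last-≺ : Baire → ℕ → ℕ → ℕ
last-≺ p x zero    = 0
last-≺ p x (suc s) with p (pair 0 s) ≟ 1
... | yes _ = p (pair 1 (pair x s))
... | no _  = last-≺ p x s

last-≺-in : ∀ p x {s} → Lx p s → last-≺ p x (suc s) ≡ p (pair 1 (pair x s))
last-≺-in p x {s} l with p (pair 0 s) ≟ 1
... | yes _ = refl
... | no ne = ⊥-elim (ne l)

last-≺-cont : ∀ p x s → ∃ λ u → ∀ p′ → p ~[ u ] p′ → last-≺ p x s ≡ last-≺ p′ x s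
last-≺-cont p x zero    = 0 , λ _ _ → refl
last-≺-cont p x (suc s) = let (u , c) = last-≺-cont p x s in
    u ⊔ (suc (pair 0 s) ⊔ suc (pair 1 (pair x s))) , λ p′ e → step p′ (c p′ (~-≤ (max₁ u (suc (pair 0 s)) (suc (pair 1 (pair x s)))) e))
      (e (pair 0 s) (max₂ u (suc (pair 0 s)) (suc (pair 1 (pair x s))))) (e (pair 1 (pair x s)) (max₃ u (suc (pair 0 s)) (suc (pair 1 (pair x s)))))
  where
  step : ∀ p′ → last-≺ p x s ≡ last-≺ p′ x s → p (pair 0 s) ≡ p′ (pair 0 s) → p (pair 1 (pair x s)) ≡ p′ (pair 1 (pair x s)) →
         last-≺ p x (suc s) ≡ last-≺ p′ x (suc s)
  step p′ e e₀ e₁ with p (pair 0 s) ≟ 1 | p′ (pair 0 s) ≟ 1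
  ... | yes _ | yes _ = e₁
  ... | no _  | no _  = e
  ... | yes q | no n  = ⊥-elim (n (trans (sym e₀) q))
  ... | no n  | yes q = ⊥-elim (n (trans e₀ q))

last-≺-settled : ∀ p x v b → (∀ s → b ≤ s → Lx p s → p (pair 1 (pair x s)) ≡ v) →
  ∀ m → b ≤ m → Lx p m → ∀ k → last-≺ p x (k + suc m) ≡ v
last-≺-settled p x v b h m l lm zero    = trans (last-≺-in p x lm) (h m l lm)
last-≺-settled p x v b h m l lm (suc k) with p (pair 0 (k + suc m)) ≟ 1
... | yes q = h (k + suc m) (≤-trans l (≤-trans (n≤1+n m) (m≤n+m (suc m) k))) q
... | no _  = last-≺-settled p x v b h m l lm k

injection-unbounded : (x : ℕ → ℕ) → (∀ i j → x i ≡ x j → i ≡ j) → ∀ n → ¬ (∀ i → x i < n)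
injection-unbounded x inj n bounded with pigeonhole (≤-refl {suc n}) (λ i → fromℕ< (bounded (toℕ i)))
... | i , j , i<j , e = <-irrefl (inj (toℕ i) (toℕ j) (trans (sym (toℕ-fromℕ< (bounded (toℕ i))))
        (trans (cong toℕ e) (toℕ-fromℕ< (bounded (toℕ j)))))) i<j

module _ (em : ExcludedMiddle 0ℓ) where
  open Classical em

  module _ (p : Baire) (d : dom SADC p) where
    private
      ord = proj₁ d
      ty = proj₂ d
    open TypeFacts p ord ty

    side : ℕ → ℕ
    side x with p (pair 0 x) ≟ 1 | h x
    ... | yes _ | inj₁ _ = 1
    ... | _     | _      = 0

    side-in : ∀ x → side x ≡ 1 → Lx p x × ∃ λ i → h x ≡ inj₁ i
    side-in x e with p (pair 0 x) ≟ 1 | h x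
    side-in x e  | yes l | inj₁ i = l , i , refl
    side-in x () | yes l | inj₂ i
    side-in x () | no _  | _

    side-out : ∀ x i → Lx p x → h x ≡ inj₁ i → side x ≡ 1
    side-out x i l e with p (pair 0 x) ≟ 1 | h x
    side-out x i l refl | yes _ | .(inj₁ i) = refl
    side-out x i l e    | no n  | _ = ⊥-elim (n l)

    side≤1 : ∀ x → side x ≤ 1
    side≤1 x with p (pair 0 x) ≟ 1 | h x
    ... | yes _ | inj₁ _ = ≤-refl
    ... | yes _ | inj₂ _ = z≤n
    ... | no _  | _      = z≤n

    -- An element of the ω part is below almost all elements and one of the ω* part is above almost
    -- all, so comparison with late elements decides the part.
    eventually-side : ∀ x → ∃ λ b → ∀ s → b ≤ s → Lx p s → p (pair 1 (pair x s)) ≡ side x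
    eventually-side x with p (pair 0 x) ≟ 1 | h x in hx
    ... | no n  | _      = 0 , λ s _ _ → case Char-cases (proj₁ ord) (pair 1 (pair x s)) of λ where
            (inj₁ z) → z
            (inj₂ l) → ⊥-elim (n (proj₁ (proj₁ (proj₂ (proj₂ ord)) x s l)))
    ... | yes lx | inj₁ i = let (b , fin) = finite-below hx in b ⊔ suc x , λ s l ls →
            case connected lx ls (≤-trans (m≤n⊔m b (suc x)) l) of λ where
              (inj₁ lt) → lt
              (inj₂ gt) → ⊥-elim (<⇒≱ (fin s gt) (≤-trans (m≤m⊔n b (suc x)) l))
    ... | yes lx | inj₂ i = let (b , fin) = finite-above hx in b , λ s l ls →
            case Char-cases (proj₁ ord) (pair 1 (pair x s)) of λ where
              (inj₁ z) → z
              (inj₂ lt) → ⊥-elim (<⇒≱ (fin s lt) l)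

    last-≺-limit : ∀ x → ∃ λ s₀ → ∀ s → s₀ ≤ s → last-≺ p x s ≡ side x
    last-≺-limit x =
      let (b , h) = eventually-side x ; (m , l , lm) = proj₁ (proj₂ ord) b
      in suc m , λ s l′ → subst (λ k → last-≺ p x k ≡ side x) (m∸n+n≡m l′) (last-≺-settled p x (side x) b h m l lm (s ∸ suc m))

    ω-element : ℕ → ℕ
    ω-element i = proj₁ (proj₂ (proj₂ ty) (inj₁ i))

    ω-element-h : ∀ i → h (ω-element i) ≡ inj₁ i
    ω-element-h i = proj₂ (proj₂ (proj₂ (proj₂ ty) (inj₁ i)))

    ω-element-side : ∀ i → side (ω-element i) ≡ 1
    ω-element-side i = side-out (ω-element i) i (proj₁ (proj₂ (proj₂ (proj₂ ty) (inj₁ i)))) (ω-element-h i)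

    side-infinite : Infinite (λ x → side x ≡ 1)
    side-infinite n = by-contra λ none → injection-unbounded ω-element
      (λ i j e → cong idx (trans (sym (ω-element-h i)) (trans (cong h e) (ω-element-h j)))) n
      (λ i → ≰⇒> λ l → none (ω-element i , l , ω-element-side i))

    side-solution : sol SADC p side
    side-solution = (side≤1 , (λ x e → proj₁ (side-in x e)) , side-infinite) ,
      inj₁ λ y e → let (b , fin) = finite-below (proj₂ (proj₂ (side-in y e))) in b , λ x (_ , l) → fin x l

  SADC≤lim : SADC ≤C lim
  SADC≤lim = record
    { fwd = λ p _ k → last-≺ p (fst k) (snd k)
    ; fwd-dom = λ p d x → let (s₀ , c) = last-≺-limit p d x in side p d x , s₀ , λ s l → trans (at p x s) (c s l)
    ; fwd-cont = λ p _ k → let (u , c) = last-≺-cont p (fst k) (snd k) in u , λ p′ _ e → c p′ e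
    -- The solution `g` of `lim` equals `side p d` at every argument. Correctness is proved for the
    -- latter, and continuity is read off from the former.
    ; bwd = λ p d g _ → side p d
    ; bwd-sol = λ p d g _ → side-solution p d
    ; bwd-cont = λ p d g s n → suc n , λ p′ d′ g′ s′ _ e →
        trans (sym (value p d g s n)) (trans (e n ≤-refl) (value p′ d′ g′ s′ n)) }
    where
    at : ∀ p x s → last-≺ p (fst (pair x s)) (snd (pair x s)) ≡ last-≺ p x s
    at p x s = cong₂ (last-≺ p) (left-pair x s) (right-pair x s)
    value : ∀ p d g → sol lim (λ k → last-≺ p (fst k) (snd k)) g → ∀ x → g x ≡ side p d x
    value p d g s x = let (s₀ , c) = last-≺-limit p d x ; (s₁ , c′) = s x in
      trans (sym (c′ (s₀ ⊔ s₁) (m≤n⊔m s₀ s₁))) (trans (at p x (s₀ ⊔ s₁)) (c (s₀ ⊔ s₁) (m≤m⊔n s₀ s₁)))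

-- Diagonalising against chains

-- An order on ω given by an isomorphism `h` onto ω + ω* and its inverse, split into `e₁` and `e₂`.
-- If closeness controlled `h` alone, a limit could fail to be onto.
record OrderCode : Set where
  field
    h     : ℕ → ℕ ⊎ ℕ
    e₁ e₂ : Baire

  e : ℕ ⊎ ℕ → ℕ
  e = [ e₁ , e₂ ]′

  field
    eh : ∀ x → e (h x) ≡ x
    he : ∀ z → h (e z) ≡ z

open OrderCode

entry : (ℕ → ℕ ⊎ ℕ) → ℕ × ℕ → ℕ
entry h (zero , x)          = 1
entry h (suc zero , q)      = less (h (fst q)) (h (snd q))
entry h (suc (suc _) , _)   = 0

order : OrderCode → Baire
order c k = entry (h c) (unpair k)

order-L : ∀ c x → Lx (order c) x
order-L c x = cong (entry (h c)) (unpair-pair 0 x)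

order-less : ∀ c x y → order c (pair 1 (pair x y)) ≡ less (h c x) (h c y)
order-less c x y = trans (cong (entry (h c)) (unpair-pair 1 (pair x y)))
  (cong₂ (λ a b → less (h c a) (h c b)) (left-pair x y) (right-pair x y))

order-in : ∀ c x y → h c x ≺ h c y → Ltx (order c) x y
order-in c x y l = trans (order-less c x y) (less-in l)

order-out : ∀ c x y → Ltx (order c) x y → h c x ≺ h c y
order-out c x y l = less-out (trans (sym (order-less c x y)) l)

order-IsLinOrd : ∀ c → IsLinOrd (order c)
order-IsLinOrd c = (λ k → entry≤1 (unpair k)) , (λ n → n , ≤-refl , order-L c n) , (λ x y _ → order-L c x , order-L c y)
  , (λ x l → ≺-irrefl (order-out c x x l))
  , (λ x y z l l′ → order-in c x z (≺-trans (order-out c x y l) (order-out c y z l′)))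
  , λ x y _ _ ne → case ≺-total (h c x) (h c y) of λ where
      (inj₁ l) → inj₁ (order-in c x y l)
      (inj₂ (inj₁ eq)) → ⊥-elim (ne (trans (sym (eh c x)) (trans (cong (e c) eq) (eh c y))))
      (inj₂ (inj₂ l)) → inj₂ (order-in c y x l)
  where
  entry≤1 : ∀ q → entry (h c) q ≤ 1
  entry≤1 (zero , _)        = ≤-refl
  entry≤1 (suc zero , q)    = less≤1 (h c (fst q)) (h c (snd q))
  entry≤1 (suc (suc _) , _) = z≤n

order-type : ∀ c → TypeωPlusωStar (order c)
order-type c = h c , (λ x y _ _ → order-out c x y , order-in c x y) , λ z → e c z , order-L c (e c z) , he c z

order-dom : ∀ c → dom SADCω (order c)
order-dom c = (order-IsLinOrd c , order-type c) , order-L c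

order-near : ∀ c d m → (∀ x y → x < m → y < m → less (h c x) (h c y) ≡ less (h d x) (h d y)) → order c ~[ m ] order d
order-near c d m same k k<m = go (unpair k) (pair-unpair k)
  where
  go : ∀ q → pair (proj₁ q) (proj₂ q) ≡ k → entry (h c) q ≡ entry (h d) q
  go (zero , _)        _ = refl
  go (suc (suc _) , _) _ = refl
  go (suc zero , q)    eq = same _ _ (≤-<-trans (≤-trans (left≤pair (fst q) (snd q)) q≤) k<m)
                                     (≤-<-trans (≤-trans (right≤pair (fst q) (snd q)) q≤) k<m)
    where
    q≤ : pair (fst q) (snd q) ≤ k
    q≤ = ≤-trans (≤-reflexive (pair-unpair q)) (≤-trans (right≤pair 1 q) (≤-reflexive eq))

infix 4 _≈[_]_

_≈[_]_ : OrderCode → ℕ → OrderCode → Set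
c ≈[ n ] d = h c ~[ n ] h d × e₁ c ~[ n ] e₁ d × e₂ c ~[ n ] e₂ d

code-limit : (c : ℕ → OrderCode) (n : ℕ → ℕ) → (∀ k → k ≤ n k) → (∀ k → n k ≤ n (suc k)) →
  (∀ k → c k ≈[ n k ] c (suc k)) → ∃ λ d → ∀ k → c k ≈[ n k ] d
code-limit c n k≤n n-step close =
    record { h = lh.limit ; e₁ = l₁.limit ; e₂ = l₂.limit
           ; eh = λ x → let k = suc (x ⊔ idx (lh.limit x)) in
               trans (sym (e-limit (lh.limit x) k (<-≤-trans (s≤s (m≤n⊔m x _)) (k≤n k))))
                 (trans (cong (e (c k)) (sym (lh.F-limit k x (<-≤-trans (s≤s (m≤m⊔n x _)) (k≤n k))))) (eh (c k) x))
           ; he = λ z → let k = suc (idx z ⊔ e∞ z) in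
               trans (sym (lh.F-limit k (e∞ z) (<-≤-trans (s≤s (m≤n⊔m (idx z) _)) (k≤n k))))
                 (trans (cong (h (c k)) (sym (e-limit z k (<-≤-trans (s≤s (m≤m⊔n (idx z) _)) (k≤n k))))) (he (c k) z)) }
  , λ k → lh.F-limit k , l₁.F-limit k , l₂.F-limit k
  where
  module lh = Limit (λ k → h (c k)) n k≤n n-step (λ k → proj₁ (close k))
  module l₁ = Limit (λ k → e₁ (c k)) n k≤n n-step (λ k → proj₁ (proj₂ (close k)))
  module l₂ = Limit (λ k → e₂ (c k)) n k≤n n-step (λ k → proj₂ (proj₂ (close k)))
  e∞ : ℕ ⊎ ℕ → ℕ
  e∞ = [ l₁.limit , l₂.limit ]′
  e-limit : ∀ z k → idx z < n k → e (c k) z ≡ e∞ z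
  e-limit (inj₁ j) k l = l₁.F-limit k j l
  e-limit (inj₂ j) k l = l₂.F-limit k j l

-- If a chain lies on one side, place the cut between two of its late elements x and x′.
module _ (in₁ in₂ : ℕ → ℕ ⊎ ℕ) (cut : ∀ i T → i < T → Cut in₁ in₂ i T)
  (split-absurd : ∀ d r → sol SADC (order d) r → ∀ {x x′ i i′} → r ∋ x → r ∋ x′ → h d x ≡ in₁ i → h d x′ ≡ in₂ i′ → ⊥)
  (c : OrderCode) (n : ℕ) (r : Baire) (r-inf : Infinite (r ∋_))
  (one-side : ∀ y → r ∋ y → ∃ λ i → h c y ≡ in₁ i) where

  private
    bound : ∀ m → ∃ λ b → ∀ y → y < m → idx (h c y) < b
    bound m = collect (λ y b → idx (h c y) < b) (λ l q → ≤-trans q l) m (λ y _ → suc (idx (h c y)) , ≤-refl)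

    -- Only the numbers `e c (in₁ j)` with `j < B` have index below `B` on this side, so an infinite
    -- chain contained in the side leaves them behind.
    deep : ∀ B → ∃ λ x → r ∋ x × ∃ λ i → h c x ≡ in₁ i × B ≤ i
    deep B =
      let (b , q) = collect (λ j b → e c (in₁ j) < b) (λ l q → ≤-trans q l) B (λ j _ → suc (e c (in₁ j)) , ≤-refl)
          (x , l , x∈) = r-inf b
          (i , hx) = one-side x x∈
      in x , x∈ , i , hx , ≮⇒≥ λ i<B → <⇒≱ (subst (_< b) (trans (cong (e c) (sym hx)) (eh c x)) (q i i<B)) l

    module _ (x i x′ i′ : ℕ) (x∈ : r ∋ x) (x′∈ : r ∋ x′) (hx : h c x ≡ in₁ i) (hx′ : h c x′ ≡ in₁ i′) (i<i′ : i < i′)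
      (n≤i : n ≤ i) (early : ∀ y → y < n → idx (h c y) ≤ i) (m : ℕ) (T : ℕ) (i′<T : i′ < T)
      (late : ∀ y → y < m → idx (h c y) < T) where
      open Cut (cut i T (<-trans i<i′ i′<T))

      fix-ρ : ∀ z → idx z ≤ i → ρ z ≡ z
      fix-ρ z l = trans (cong ρ (sym (fix z l))) (ρπ z)

      recut : OrderCode
      recut = record
        { h = λ y → π (h c y) ; e₁ = λ j → e c (ρ (inj₁ j)) ; e₂ = λ j → e c (ρ (inj₂ j))
        ; eh = λ y → trans (e-ρ (π (h c y))) (trans (cong (e c) (ρπ (h c y))) (eh c y))
        ; he = λ z → trans (cong (λ w → π (h c w)) (e-ρ z)) (trans (cong π (he c (ρ z))) (πρ z)) }
        where
        e-ρ : ∀ z → [ (λ j → e c (ρ (inj₁ j))) , (λ j → e c (ρ (inj₂ j))) ]′ z ≡ e c (ρ z)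
        e-ρ (inj₁ _) = refl
        e-ρ (inj₂ _) = refl

      preserved : ∀ {z z′} → idx z < T → idx z′ < T → less z z′ ≡ less (π z) (π z′)
      preserved {z} {z′} l l′ with ≺-total z z′
      ... | inj₁ lt = sym (less-in (mono l l′ lt))
      ... | inj₂ (inj₁ refl) = sym (less-0 ≺-irrefl)
      ... | inj₂ (inj₂ gt) = sym (less-0 λ lt → ≺-irrefl (≺-trans lt (mono l′ l gt)))

      recut-refutes : Σ OrderCode λ d → ∃ λ n′ → c ≈[ n ] d × order c ~[ m ] order d ×
        (∀ e → d ≈[ n′ ] e → ∀ r′ → r ~[ suc (x ⊔ x′) ] r′ → ¬ sol SADC (order e) r′)
      recut-refutes = recut , suc (x ⊔ x′)
        , ( (λ y l → sym (fix (h c y) (early y l)))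
          , (λ j l → cong (e c) (sym (fix-ρ (inj₁ j) (≤-trans (<⇒≤ l) n≤i))))
          , (λ j l → cong (e c) (sym (fix-ρ (inj₂ j) (≤-trans (<⇒≤ l) n≤i)))) )
        , order-near c recut m (λ y y′ l l′ → preserved (late y l) (late y′ l′))
        , λ d (near , _) r′ r~r′ r′-sol → split-absurd d r′ r′-sol
            (trans (sym (r~r′ x (s≤s (m≤m⊔n x x′)))) x∈) (trans (sym (r~r′ x′ (s≤s (m≤n⊔m x x′)))) x′∈)
            (trans (sym (near x (s≤s (m≤m⊔n x x′)))) (trans (cong π hx) stays))
            (trans (sym (near x′ (s≤s (m≤n⊔m x x′)))) (trans (cong π hx′) (proj₂ (moves i′ i<i′ i′<T))))

  refute-side : Refutes SADCω order _≈[_]_ c n r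
  refute-side =
    let (B , B-bound) = bound n
        (x , x∈ , i , hx , B≤i) = deep (B ⊔ n)
        (x′ , x′∈ , i′ , hx′ , i<i′) = deep (suc i)
    in suc (x ⊔ x′) , λ m → let (T , T-bound) = bound m in
       recut-refutes x i x′ i′ x∈ x′∈ hx hx′ i<i′ (≤-trans (m≤n⊔m B n) B≤i)
         (λ y l → ≤-trans (<⇒≤ (B-bound y l)) (≤-trans (m≤m⊔n B n) B≤i)) m (T ⊔ suc i′) (m≤n⊔m T (suc i′))
         (λ y l → ≤-trans (T-bound y l) (m≤m⊔n T (suc i′)))

two-sided : ∀ d r → sol SADC (order d) r → ∀ {x x′ i i′} → r ∋ x → r ∋ x′ → h d x ≡ inj₁ i → h d x′ ≡ inj₂ i′ → ⊥
two-sided d r (sub , inj₁ asc) {x} {x′} x∈ x′∈ hx hx′ =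
  case trans (sym hx′) (proj₂ (TypeFacts.ascending-in-ω (order d) (order-IsLinOrd d) (order-type d) sub asc x′ x′∈)) of λ ()
two-sided d r (sub , inj₂ desc) {x} {x′} x∈ x′∈ hx hx′ =
  case trans (sym hx) (proj₂ (TypeFacts.descending-in-ω* (order d) (order-IsLinOrd d) (order-type d) sub desc x x∈)) of λ ()

refute-chain : ∀ c n r → sol SADC (order c) r → Refutes SADCω order _≈[_]_ c n r
refute-chain c n r (sub@(_ , _ , inf) , inj₁ asc) = refute-side inj₁ inj₂ cut₁ two-sided c n r inf
  (TypeFacts.ascending-in-ω (order c) (order-IsLinOrd c) (order-type c) sub asc)
refute-chain c n r (sub@(_ , _ , inf) , inj₂ desc) =
  refute-side inj₂ inj₁ cut₂ (λ d r s x∈ x′∈ hx hx′ → two-sided d r s x′∈ x∈ hx′ hx) c n r inf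
    (TypeFacts.descending-in-ω* (order c) (order-IsLinOrd c) (order-type c) sub desc)

SADCω-diagonal : Diagonal SADCω
SADCω-diagonal = record
  { I         = OrderCode
  ; inst      = order
  ; inst-dom  = order-dom
  ; _≈[_]_    = _≈[_]_
  ; ≈-refl    = (λ _ _ → refl) , (λ _ _ → refl) , (λ _ _ → refl)
  ; ≈-trans   = λ (a , b , c) (a′ , b′ , c′) → ~-trans a a′ , ~-trans b b′ , ~-trans c c′
  ; ≈-mono    = λ l (a , b , c) → ~-≤ l a , ~-≤ l b , ~-≤ l c
  ; inst-cont = λ c m → m , λ d (near , _) → order-near c d m λ x y l l′ → cong₂ less (near x l) (near y l′)
  ; complete  = code-limit
  ; refute    = refute-chain
  }

alternating : OrderCode
alternating = record { h = h′ ; e₁ = λ n → n + n ; e₂ = λ n → suc (n + n) ; eh = eh′ ; he = he′ }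
  where
  bump : ℕ ⊎ ℕ → ℕ ⊎ ℕ
  bump (inj₁ n) = inj₁ (suc n)
  bump (inj₂ n) = inj₂ (suc n)
  h′ : ℕ → ℕ ⊎ ℕ
  h′ zero          = inj₁ 0
  h′ (suc zero)    = inj₂ 0
  h′ (suc (suc n)) = bump (h′ n)
  E : ℕ ⊎ ℕ → ℕ
  E = [ (λ n → n + n) , (λ n → suc (n + n)) ]′
  E-bump : ∀ z → E (bump z) ≡ suc (suc (E z))
  E-bump (inj₁ n) = cong suc (+-suc n n)
  E-bump (inj₂ n) = cong (λ k → suc (suc k)) (+-suc n n)
  eh′ : ∀ x → E (h′ x) ≡ x
  eh′ zero          = refl
  eh′ (suc zero)    = refl
  eh′ (suc (suc n)) = trans (E-bump (h′ n)) (cong (λ k → suc (suc k)) (eh′ n))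
  h-E : ∀ z → h′ (E (bump z)) ≡ bump (h′ (E z))
  h-E z = cong h′ (E-bump z)
  he′ : ∀ z → h′ (E z) ≡ z
  he′ (inj₁ zero)    = refl
  he′ (inj₁ (suc n)) = trans (h-E (inj₁ n)) (cong bump (he′ (inj₁ n)))
  he′ (inj₂ zero)    = refl
  he′ (inj₂ (suc n)) = trans (h-E (inj₂ n)) (cong bump (he′ (inj₂ n)))

-- Programming with primitive recursive terms

iter : ℕ → (ℕ → ℕ → ℕ) → ℕ → ℕ
iter b s zero    = b
iter b s (suc n) = s n (iter b s n)

enc : ∀ {n} → Vec ℕ n → ℕ
enc []      = 0
enc (x ∷ ρ) = pair x (enc ρ)

Sem : ℕ → Set
Sem n = Baire → Vec ℕ n → ℕ

record Def (n : ℕ) (F : Sem n) : Set where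
  constructor def
  field
    tm : Tm
    ok : ∀ p ρ → eval tm p (enc ρ) ≡ F p ρ
open Def

Def-cong : ∀ {n} {F G : Sem n} → (∀ p ρ → F p ρ ≡ G p ρ) → Def n F → Def n G
Def-cong e d = def (tm d) (λ p ρ → trans (ok d p ρ) (e p ρ))

var : ∀ {n} (i : Fin n) → Def n (λ _ ρ → lookup ρ i)
var zero    = def Lₜ (λ { _ (x ∷ ρ) → left-pair x (enc ρ) })
var (suc i) = def (tm (var i) ∘ₜ Rₜ) (λ { p (x ∷ ρ) →
  trans (cong (eval (tm (var i)) p) (right-pair x (enc ρ))) (ok (var i) p ρ) })

lit : ∀ {n} k → Def n (λ _ _ → k)
lit k = def (constₜ k) (λ p ρ → eval-const k p (enc ρ))

module _ {n : ℕ} where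

  succ : ∀ {F : Sem n} → Def n F → Def n (λ p ρ → suc (F p ρ))
  succ a = def (Sₜ ∘ₜ tm a) (λ p ρ → cong suc (ok a p ρ))

  orc : ∀ {F : Sem n} → Def n F → Def n (λ p ρ → p (F p ρ))
  orc a = def (Oₜ ∘ₜ tm a) (λ p ρ → cong p (ok a p ρ))

  lft : ∀ {F : Sem n} → Def n F → Def n (λ p ρ → fst (F p ρ))
  lft a = def (Lₜ ∘ₜ tm a) (λ p ρ → cong fst (ok a p ρ))

  rgt : ∀ {F : Sem n} → Def n F → Def n (λ p ρ → snd (F p ρ))
  rgt a = def (Rₜ ∘ₜ tm a) (λ p ρ → cong snd (ok a p ρ))

  pr : ∀ {F G : Sem n} → Def n F → Def n G → Def n (λ p ρ → pair (F p ρ) (G p ρ))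
  pr a b = def ⟪ tm a , tm b ⟫ (λ p ρ → cong₂ pair (ok a p ρ) (ok b p ρ))

  -- `recₜ` passes parameter, counter and accumulator as a pair nested to the left. `shuffle` turns
  -- it into the code of an environment that starts with accumulator and counter.
  loop : ∀ {B C : Sem n} {S : Sem (suc (suc n))} → Def n B → Def (suc (suc n)) S → Def n C →
         Def n (λ p ρ → iter (B p ρ) (λ i acc → S p (acc ∷ i ∷ ρ)) (C p ρ))
  loop {B} {C} {S} b s c = def (recₜ (tm b) (tm s ∘ₜ shuffle) ∘ₜ ⟪ Iₜ , tm c ⟫) λ p ρ →
      trans (cong₂ (recAux (eval (tm b) p) (eval (tm s ∘ₜ shuffle) p))
               (left-pair (enc ρ) (eval (tm c) p (enc ρ))) (right-pair (enc ρ) (eval (tm c) p (enc ρ))))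
        (trans (cong (recAux (eval (tm b) p) (eval (tm s ∘ₜ shuffle) p) (enc ρ)) (ok c p ρ)) (run p ρ (C p ρ)))
    where
    shuffle : Tm
    shuffle = ⟪ Rₜ , ⟪ Rₜ ∘ₜ Lₜ , Lₜ ∘ₜ Lₜ ⟫ ⟫
    shuffled : ∀ p y i a → eval shuffle p (pair (pair y i) a) ≡ pair a (pair i y)
    shuffled p y i a rewrite unpair-pair (pair y i) a | unpair-pair y i = refl
    run : ∀ p ρ k → recAux (eval (tm b) p) (eval (tm s ∘ₜ shuffle) p) (enc ρ) k ≡ iter (B p ρ) (λ i acc → S p (acc ∷ i ∷ ρ)) k
    run p ρ zero    = ok b p ρ
    run p ρ (suc k) = trans (cong (eval (tm s) p) (shuffled p (enc ρ) k _))
      (trans (cong (λ a → eval (tm s) p (pair a (pair k (enc ρ)))) (run p ρ k)) (ok s p (_ ∷ k ∷ ρ)))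

  at₂ : ∀ {F : Sem 2} {X Y : Sem n} → Def 2 F → Def n X → Def n Y → Def n (λ p ρ → F p (X p ρ ∷ Y p ρ ∷ []))
  at₂ {F} a x y = def (tm a ∘ₜ ⟪ tm x , ⟪ tm y , Zₜ ⟫ ⟫) λ p ρ →
    trans (cong₂ (λ u v → eval (tm a) p (pair u (pair v 0))) (ok x p ρ) (ok y p ρ)) (ok a p (_ ∷ _ ∷ []))

cnd : ℕ → ℕ → ℕ → ℕ
cnd zero    a b = b
cnd (suc _) a b = a

module _ {n : ℕ} where

  add : ∀ {F G : Sem n} → Def n F → Def n G → Def n (λ p ρ → F p ρ + G p ρ)
  add {F} {G} a b = Def-cong (λ p ρ → sem (F p ρ) (G p ρ)) (loop a (succ (var zero)) b)
    where
    sem : ∀ x y → iter x (λ _ acc → suc acc) y ≡ x + y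
    sem x zero    = sym (+-identityʳ x)
    sem x (suc y) = trans (cong suc (sem x y)) (sym (+-suc x y))

  prd : ∀ {F : Sem n} → Def n F → Def n (λ p ρ → pred (F p ρ))
  prd {F} a = Def-cong (λ p ρ → sem (F p ρ)) (loop (lit 0) (var (suc zero)) a)
    where
    sem : ∀ x → iter 0 (λ i _ → i) x ≡ pred x
    sem zero    = refl
    sem (suc x) = refl

  cond : ∀ {F G H : Sem n} → Def n F → Def n G → Def n H → Def n (λ p ρ → cnd (F p ρ) (G p ρ) (H p ρ))
  cond {F} {G} {H} c a b = def (recₜ (tm b) (tm a ∘ₜ (Lₜ ∘ₜ Lₜ)) ∘ₜ ⟪ Iₜ , tm c ⟫) λ p ρ →
      trans (cong₂ (recAux (eval (tm b) p) (eval (tm a ∘ₜ (Lₜ ∘ₜ Lₜ)) p))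
               (left-pair (enc ρ) (eval (tm c) p (enc ρ))) (right-pair (enc ρ) (eval (tm c) p (enc ρ))))
        (trans (cong (recAux (eval (tm b) p) (eval (tm a ∘ₜ (Lₜ ∘ₜ Lₜ)) p) (enc ρ)) (ok c p ρ)) (sem p ρ (F p ρ)))
    where
    sem : ∀ p ρ k → recAux (eval (tm b) p) (eval (tm a ∘ₜ (Lₜ ∘ₜ Lₜ)) p) (enc ρ) k ≡ cnd k (G p ρ) (H p ρ)
    sem p ρ zero    = ok b p ρ
    sem p ρ (suc k) = trans (cong (eval (tm a) p)
      (trans (cong fst (left-pair (pair (enc ρ) k) _)) (left-pair (enc ρ) k))) (ok a p ρ)

monus : ∀ {n} {F G : Sem n} → Def n F → Def n G → Def n (λ p ρ → F p ρ ∸ G p ρ)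
monus {F = F} {G} a b = Def-cong (λ p ρ → sem (F p ρ) (G p ρ)) (loop a (prd (var zero)) b)
  where
  sem : ∀ x y → iter x (λ _ acc → pred acc) y ≡ x ∸ y
  sem x zero    = refl
  sem x (suc y) = trans (cong pred (sem x y)) (pred[m∸n]≡m∸[1+n] x y)

data Bit (P : Set) : ℕ → Set where
  true  : P → Bit P 1
  false : ¬ P → Bit P 0

Bit-map : ∀ {P Q k} → (P → Q) → (Q → P) → Bit P k → Bit Q k
Bit-map f g (true p)   = true (f p)
Bit-map f g (false ¬p) = false (¬p ∘ g)

Bit-in : ∀ {P k} → Bit P k → P → k ≡ 1
Bit-in (true _)   _ = refl
Bit-in (false ¬p) p = ⊥-elim (¬p p)

Bit-out : ∀ {P k} → Bit P k → k ≡ 1 → P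
Bit-out (true p) _ = p

Bit-≤1 : ∀ {P k} → Bit P k → k ≤ 1
Bit-≤1 (true _)  = ≤-refl
Bit-≤1 (false _) = z≤n

record Dcd (n : ℕ) (Φ : Baire → Vec ℕ n → Set) : Set where
  constructor dcd
  field
    {val} : Sem n
    code  : Def n val
    bit   : ∀ p ρ → Bit (Φ p ρ) (val p ρ)
open Dcd

infix 5 _≤ᶠ_ _≡ᶠ_
infixr 4 _∧ᶠ_
infixr 3 _∨ᶠ_

_≤ᶠ_ : ∀ {n} {F G : Sem n} → Def n F → Def n G → Dcd n (λ p ρ → F p ρ ≤ G p ρ)
_≤ᶠ_ {F = F} {G} a b = dcd (monus (lit 1) (monus a b)) (λ p ρ → sem (F p ρ) (G p ρ))
  where
  sem : ∀ x y → Bit (x ≤ y) (1 ∸ (x ∸ y))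
  sem x y with x ∸ y in eq
  ... | zero  = true (m∸n≡0⇒m≤n eq)
  ... | suc k = subst (Bit _) (sym (0∸n≡0 k)) (false λ l → case trans (sym eq) (m≤n⇒m∸n≡0 l) of λ ())

_∧ᶠ_ : ∀ {n Φ Ψ} → Dcd n Φ → Dcd n Ψ → Dcd n (λ p ρ → Φ p ρ × Ψ p ρ)
_∧ᶠ_ a b = dcd (cond (code a) (code b) (lit 0)) (λ p ρ → sem (bit a p ρ) (bit b p ρ))
  where
  sem : ∀ {P Q i j} → Bit P i → Bit Q j → Bit (P × Q) (cnd i j 0)
  sem (true p)   (true q)   = true (p , q)
  sem (true p)   (false ¬q) = false (¬q ∘ proj₂)
  sem (false ¬p) _          = false (¬p ∘ proj₁)

_∨ᶠ_ : ∀ {n Φ Ψ} → Dcd n Φ → Dcd n Ψ → Dcd n (λ p ρ → Φ p ρ ⊎ Ψ p ρ)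
_∨ᶠ_ a b = dcd (cond (code a) (lit 1) (code b)) (λ p ρ → sem (bit a p ρ) (bit b p ρ))
  where
  sem : ∀ {P Q i j} → Bit P i → Bit Q j → Bit (P ⊎ Q) (cnd i 1 j)
  sem (true p)   _          = true (inj₁ p)
  sem (false ¬p) (true q)   = true (inj₂ q)
  sem (false ¬p) (false ¬q) = false [ ¬p , ¬q ]′

¬ᶠ_ : ∀ {n Φ} → Dcd n Φ → Dcd n (λ p ρ → ¬ Φ p ρ)
¬ᶠ a = dcd (cond (code a) (lit 0) (lit 1)) (λ p ρ → sem (bit a p ρ))
  where
  sem : ∀ {P i} → Bit P i → Bit (¬ P) (cnd i 0 1)
  sem (true p)   = false (λ ¬p → ¬p p)
  sem (false ¬p) = true ¬p

_≡ᶠ_ : ∀ {n} {F G : Sem n} → Def n F → Def n G → Dcd n (λ p ρ → F p ρ ≡ G p ρ)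
a ≡ᶠ b = dcd (code (a ≤ᶠ b ∧ᶠ b ≤ᶠ a)) (λ p ρ → Bit-map (λ (l , g) → ≤-antisym l g) (λ e → ≤-reflexive e , ≤-reflexive (sym e)) (bit (a ≤ᶠ b ∧ᶠ b ≤ᶠ a) p ρ))

Below : ∀ {n} → Sem n → (Baire → Vec ℕ (suc n) → Set) → Baire → Vec ℕ n → Set
Below C Φ p ρ = ∃ λ i → i < C p ρ × Φ p (i ∷ ρ)

∃ᶠ : ∀ {n} {C : Sem n} {Φ} → Def n C → Dcd (suc n) Φ → Dcd n (Below C Φ)
∃ᶠ {n} {C} {Φ} c a = dcd (loop (lit 0) (cond (at-i (code a)) (lit 1) (var zero)) c) (λ p ρ → sem p ρ (C p ρ))
  where
  at-i : ∀ {F : Sem (suc n)} → Def (suc n) F → Def (suc (suc n)) (λ { p (acc ∷ i ∷ ρ) → F p (i ∷ ρ) })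
  at-i d = def (tm d ∘ₜ Rₜ) (λ { p (acc ∷ i ∷ ρ) → trans (cong (eval (tm d) p) (right-pair acc (enc (i ∷ ρ)))) (ok d p (i ∷ ρ)) })
  extend : ∀ {P : ℕ → Set} {k i j} → Bit (P k) i → Bit (∃ λ i → i < k × P i) j → Bit (∃ λ i → i < suc k × P i) (cnd i 1 j)
  extend (true p)   _                    = true (_ , ≤-refl , p)
  extend (false ¬p) (true (i , l , q))   = true (i , m≤n⇒m≤1+n l , q)
  extend (false ¬p) (false none)         = false λ (i , l , q) → case m≤n⇒m<n∨m≡n (≤-pred l) of λ where
    (inj₁ i<k)  → none (i , i<k , q)
    (inj₂ refl) → ¬p q
  sem : ∀ p ρ k → Bit (∃ λ i → i < k × Φ p (i ∷ ρ)) (iter 0 (λ i acc → cnd (val a p (i ∷ ρ)) 1 acc) k)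
  sem p ρ zero    = false λ { (_ , () , _) }
  sem p ρ (suc k) = extend {λ i → Φ p (i ∷ ρ)} (bit a p (k ∷ ρ)) (sem p ρ k)

sub₂ : ∀ {n Φ} {X Y : Sem n} → Dcd 2 Φ → Def n X → Def n Y → Dcd n (λ p ρ → Φ p (X p ρ ∷ Y p ρ ∷ []))
sub₂ a x y = dcd (at₂ (code a) x y) (λ p ρ → bit a p (_ ∷ _ ∷ []))

totalₜ : ∀ {F : Sem 1} → Def 1 F → Tm
totalₜ d = Sₜ ∘ₜ (tm d ∘ₜ ⟪ Lₜ , Zₜ ⟫)

totalₜ-computes : ∀ {F : Sem 1} (d : Def 1 F) p → Computes (totalₜ d) p (λ n → F p (n ∷ []))
totalₜ-computes d p n = 0 , cong suc (trans (cong (λ k → eval (tm d) p (pair k 0)) (left-pair n 0)) (ok d p (n ∷ []))) , λ _ ()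

-- The value is 0 until the condition holds and a successor at the first stage where it does. This
-- is the normal form behind `Conv`, so unbounded search needs no further construct.
searchₜ : ∀ {Φ} {F : Sem 2} → Dcd 2 Φ → Def 2 F → Tm
searchₜ a d = tm (cond (code a) (succ d) (lit 0)) ∘ₜ ⟪ Lₜ , ⟪ Rₜ , Zₜ ⟫ ⟫

search-least : ∀ {P : ℕ → Set} {b : ℕ → ℕ} → (∀ s → Bit (P s) (b s)) → ∃ P → ∃ λ s → P s × b s ≡ 1 × (∀ s′ → s′ < s → b s′ ≡ 0)
search-least {P} {b} bits (s , ps) = case below (suc s) of λ where
    (inj₁ r) → r
    (inj₂ none) → case trans (sym (Bit-in (bits s) ps)) (none s ≤-refl) of λ ()
  where
  below : ∀ n → (∃ λ s → P s × b s ≡ 1 × (∀ s′ → s′ < s → b s′ ≡ 0)) ⊎ (∀ s → s < n → b s ≡ 0)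
  below zero    = inj₂ λ _ ()
  below (suc n) with below n
  ... | inj₁ r = inj₁ r
  ... | inj₂ none with b n in eq | bits n
  ...   | .1 | true p  = inj₁ (n , p , eq , none)
  ...   | .0 | false _ = inj₂ λ s l → case m≤n⇒m<n∨m≡n (≤-pred l) of λ where
            (inj₁ s<n)  → none s s<n
            (inj₂ refl) → eq

searchₜ-computes : ∀ {Φ} {F : Sem 2} (a : Dcd 2 Φ) (d : Def 2 F) p → (∀ n → ∃ λ s → Φ p (n ∷ s ∷ [])) →
  Σ Baire λ q → Computes (searchₜ a d) p q × ∀ n → ∃ λ s → Φ p (n ∷ s ∷ []) × (∀ s′ → s′ < s → ¬ Φ p (n ∷ s′ ∷ [])) × q n ≡ F p (n ∷ s ∷ [])
searchₜ-computes {Φ} {F} a d p total =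
    (λ n → F p (n ∷ s n ∷ []))
  , (λ n → s n
       , trans (value n (s n)) (cong (λ k → cnd k (suc (F p (n ∷ s n ∷ []))) 0) (proj₁ (proj₂ (proj₂ (least n)))))
       , λ s′ l → trans (value n s′) (cong (λ k → cnd k (suc (F p (n ∷ s′ ∷ []))) 0) (proj₂ (proj₂ (proj₂ (least n))) s′ l)))
  , λ n → s n , proj₁ (proj₂ (least n))
       , (λ s′ l φ → case trans (sym (Bit-in (bit a p (n ∷ s′ ∷ [])) φ)) (proj₂ (proj₂ (proj₂ (least n))) s′ l) of λ ())
       , refl
  where
  least : ∀ n → ∃ λ s → Φ p (n ∷ s ∷ []) × val a p (n ∷ s ∷ []) ≡ 1 × (∀ s′ → s′ < s → val a p (n ∷ s′ ∷ []) ≡ 0)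
  least n = search-least (λ s → bit a p (n ∷ s ∷ [])) (total n)
  s : ℕ → ℕ
  s n = proj₁ (least n)
  value : ∀ n s → eval (searchₜ a d) p (pair n s) ≡ cnd (val a p (n ∷ s ∷ [])) (suc (F p (n ∷ s ∷ []))) 0
  value n s = trans (cong₂ (λ u v → eval (tm (cond (code a) (succ d) (lit 0))) p (pair u (pair v 0))) (left-pair n s) (right-pair n s))
    (ok (cond (code a) (succ d) (lit 0)) p (n ∷ s ∷ []))

-- Reducing wRSgr to RT22

open Def
open Dcd

leftO rightO : Baire → Baire
leftO p n  = p (n + n)
rightO p n = p (suc (n + n))

join-left : ∀ f g n → leftO (join f g) n ≡ f n
join-left f g zero    = refl
join-left f g (suc n) rewrite +-suc n n = join-left (λ k → f (suc k)) (λ k → g (suc k)) n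

join-right : ∀ f g n → rightO (join f g) n ≡ g n
join-right f g zero    = refl
join-right f g (suc n) rewrite +-suc n n = join-right (λ k → f (suc k)) (λ k → g (suc k)) n

Access : (Baire → Baire) → Set
Access O = ∀ {n} {F : Sem n} → Def n F → Def n (λ p ρ → O p (F p ρ))

orcL : Access leftO
orcL e = orc (add e e)

orcR : Access rightO
orcR e = orc (succ (add e e))

v₀ : ∀ {n} → Def (suc n) (λ _ ρ → lookup ρ zero)
v₀ = var zero

v₁ : ∀ {n} → Def (suc (suc n)) (λ _ ρ → lookup ρ (suc zero))
v₁ = var (suc zero)

v₂ : ∀ {n} → Def (suc (suc (suc n))) (λ _ ρ → lookup ρ (suc (suc zero)))
v₂ = var (suc (suc zero))

v₃ : ∀ {n} → Def (suc (suc (suc (suc n)))) (λ _ ρ → lookup ρ (suc (suc (suc zero))))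
v₃ = var (suc (suc (suc zero)))

-- The least vertex not below `x`. Colouring `x` and `y` by the edge between their next vertices
-- handles arbitrary infinite vertex sets without enumerating them in order.
Next : Baire → ℕ → ℕ → Set
Next q x a = x ≤ a × q (pair 0 a) ≡ 1 × ¬ (∃ λ i → i < a × x ≤ i × q (pair 0 i) ≡ 1)

Next-unique : ∀ q x a b → Next q x a → Next q x b → a ≡ b
Next-unique q x a b (l , v , n) (l′ , v′ , n′) with <-cmp a b
... | tri< a<b _ _ = ⊥-elim (n′ (a , a<b , l , v))
... | tri≈ _ e _   = e
... | tri> _ _ b<a = ⊥-elim (n (b , b<a , l′ , v′))

Next-cong : ∀ {q q′} → (∀ n → q n ≡ q′ n) → ∀ x a → Next q x a → Next q′ x a
Next-cong e x a (l , v , n) = l , trans (sym (e (pair 0 a))) v , λ (i , i<a , l′ , v′) → n (i , i<a , l′ , trans (e (pair 0 i)) v′)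

nextᶠ : ∀ O → Access O → Dcd 2 (λ p ρ → Next (O p) (lookup ρ zero) (lookup ρ (suc zero)))
nextᶠ O o = v₀ ≤ᶠ v₁ ∧ᶠ o (pr (lit 0) v₁) ≡ᶠ lit 1 ∧ᶠ ¬ᶠ (∃ᶠ v₁ (v₁ ≤ᶠ v₀ ∧ᶠ o (pr (lit 0) v₀) ≡ᶠ lit 1))

module _ (em : ExcludedMiddle 0ℓ) where
  open Classical em

  Next-exists : ∀ q → Infinite (Vx q) → ∀ x → ∃ (Next q x)
  Next-exists q inf x = let (m , l , v) = inf x
                            (a , (l′ , v′) , min) = least (λ a → x ≤ a × Vx q a) (m , l , v)
                        in a , l′ , v′ , λ (i , i<a , l″ , v″) → min i i<a (l″ , v″)

abstract
  found : Dcd 2 (λ p ρ → Next p (fst (lookup ρ zero)) (fst (lookup ρ (suc zero))) ×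
                         Next p (snd (lookup ρ zero)) (snd (lookup ρ (suc zero))))
  found = sub₂ (nextᶠ id orc) (lft v₀) (lft v₁) ∧ᶠ sub₂ (nextᶠ id orc) (rgt v₀) (rgt v₁)
  edge : Def 2 (λ p ρ → p (pair 1 (pair (fst (lookup ρ (suc zero))) (snd (lookup ρ (suc zero))))))
  edge = orc (pr (lit 1) (pr (lft v₁) (rgt v₁)))
  -- The image of a homogeneous set under `Next` is decidable because a number is never above its
  -- next vertex, which bounds the search.
  member : Dcd 1 (λ p ρ → ∃ λ x → x < suc (lookup ρ zero) × rightO p x ≡ 1 × Next (leftO p) x (lookup ρ zero))
  member = ∃ᶠ (succ v₀) (orcR v₀ ≡ᶠ lit 1 ∧ᶠ sub₂ (nextᶠ leftO orcL) v₀ v₁)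

module FromGraph (em : ExcludedMiddle 0ℓ) (f : Baire) (graph : IsGraph f) where

  abstract
    next : ∀ x → ∃ (Next f x)
    next = Next-exists em f (proj₁ (proj₂ graph))

    colouring : Σ Baire λ q → Computes (searchₜ found edge) f q × ∀ n → ∃ λ s →
      (Next f (fst n) (fst s) × Next f (snd n) (snd s)) ×
      (∀ s′ → s′ < s → ¬ (Next f (fst n) (fst s′) × Next f (snd n) (snd s′))) ×
      q n ≡ f (pair 1 (pair (fst s) (snd s)))
    colouring = searchₜ-computes found edge f λ n →
      let (a , na) = next (fst n) ; (b , nb) = next (snd n)
      in pair a b , subst (Next f (fst n)) (sym (left-pair a b)) na , subst (Next f (snd n)) (sym (right-pair a b)) nb

  c : Baire
  c = proj₁ colouring

  c-edge : ∀ x y a b → Next f x a → Next f y b → c (pair x y) ≡ f (pair 1 (pair a b))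
  c-edge x y a b na nb = let (s , (na′ , nb′) , _ , e) = proj₂ (proj₂ colouring) (pair x y) in
    trans e (cong₂ (λ u v → f (pair 1 (pair u v)))
      (Next-unique f x (fst s) a (subst (λ k → Next f k (fst s)) (left-pair x y) na′) na)
      (Next-unique f y (snd s) b (subst (λ k → Next f k (snd s)) (right-pair x y) nb′) nb))

  module _ (g : Baire) (g-inf : Infinite (g ∋_)) (i : ℕ)
    (hom : ∀ x y → g ∋ x → g ∋ y → x < y → c (pair x y) ≡ i) where
    r : Baire
    r v = val member (join f g) (v ∷ [])

    r-in : ∀ x v → g ∋ x → Next f x v → r ∋ v
    r-in x v x∈ nx = Bit-in (bit member (join f g) (v ∷ []))
      (x , s≤s (proj₁ nx) , trans (join-right f g x) x∈ , Next-cong (λ n → sym (join-left f g n)) x v nx)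

    r-out : ∀ v → r ∋ v → ∃ λ x → g ∋ x × Next f x v
    r-out v v∈ = let (x , _ , x∈ , nx) = Bit-out (bit member (join f g) (v ∷ [])) v∈
                   in x , trans (sym (join-right f g x)) x∈ , Next-cong (join-left f g) x v nx

    -- Two elements of `g` may have the same next vertex. This cannot produce an edge, as the graph
    -- has no loops.
    degree : ∀ v → r ∋ v → Infinite (HN f r v) ⊎ Empty (HN f r v)
    degree v v∈ = by (i ≟ 1) (r-out v v∈)
      where
      by : Dec (i ≡ 1) → (∃ λ x → g ∋ x × Next f x v) → Infinite (HN f r v) ⊎ Empty (HN f r v)
      by (yes refl) (x , x∈ , nx) = inj₁ λ m →
        let (y , l , y∈) = g-inf (m ⊔ suc x) ; (b , nb) = next y
        in b , ≤-trans (≤-trans (m≤m⊔n m (suc x)) l) (proj₁ nb) , r-in y b y∈ nb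
         , trans (sym (c-edge x y v b nx nb)) (hom x y x∈ y∈ (≤-trans (m≤n⊔m m (suc x)) l))
      by (no ne) (x , x∈ , nx) = inj₂ λ w (w∈ , e) → let (y , y∈ , ny) = r-out w w∈ in
        case <-cmp x y of λ where
          (tri< l _ _) → ne (trans (sym (hom x y x∈ y∈ l)) (trans (c-edge x y v w nx ny) e))
          (tri≈ _ eq _) → proj₂ (proj₂ (proj₁ (proj₂ (proj₂ graph)) v w e))
                            (Next-unique f x v w nx (subst (λ k → Next f k w) (sym eq) ny))
          (tri> _ _ l) → ne (trans (sym (hom y x y∈ x∈ l)) (trans (c-edge y x w v ny nx) (proj₂ (proj₂ (proj₂ graph)) v w e)))

    r-sol : sol wRSgr f r
    r-sol = ( (λ v → Bit-≤1 (bit member (join f g) (v ∷ [])))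
            , (λ v v∈ → proj₁ (proj₂ (proj₂ (proj₂ (r-out v v∈)))))
            , λ n → let (x , l , x∈) = g-inf n ; (a , na) = next x in a , ≤-trans l (proj₁ na) , r-in x a x∈ na )
          , degree

wRSgr≤RT22 : ExcludedMiddle 0ℓ → wRSgr ≤W RT22
wRSgr≤RT22 em = searchₜ found edge , totalₜ (code member) , λ f graph → let open FromGraph em f graph in
    c , proj₁ (proj₂ colouring)
  , (λ x y _ → let (a , na) = next x ; (b , nb) = next y
               in ≤-trans (≤-reflexive (c-edge x y a b na nb)) (proj₁ graph (pair 1 (pair a b))))
  , λ g ((_ , _ , inf) , i , hom) → r g inf i hom , totalₜ-computes (code member) (join f g) , r-sol g inf i hom

-- Graphs on all of ω given by decidable relations

graphᶠ : ∀ {Φ} → Dcd 2 Φ → Dcd 1 (λ p ρ → fst (lookup ρ zero) ≡ 0 ⊎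
  (fst (lookup ρ zero) ≡ 1 ×
   Φ p (fst (snd (lookup ρ zero)) ∷ snd (snd (lookup ρ zero)) ∷ [])))
graphᶠ a = lft v₀ ≡ᶠ lit 0 ∨ᶠ lft v₀ ≡ᶠ lit 1 ∧ᶠ sub₂ a (lft (rgt v₀)) (rgt (rgt v₀))

module GraphOn {Φ} (a : Dcd 2 Φ) (p : Baire)
  (irreflexive : ∀ x → ¬ Φ p (x ∷ x ∷ [])) (symmetric : ∀ x y → Φ p (x ∷ y ∷ []) → Φ p (y ∷ x ∷ [])) where

  G : Baire
  G k = val (graphᶠ a) p (k ∷ [])

  computes : Computes (totalₜ (code (graphᶠ a))) p G
  computes = totalₜ-computes (code (graphᶠ a)) p

  vertex : ∀ x → Vx G x
  vertex x = Bit-in (bit (graphᶠ a) p (pair 0 x ∷ [])) (inj₁ (left-pair 0 x))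

  edge-in : ∀ x y → Φ p (x ∷ y ∷ []) → Ex G x y
  edge-in x y φ = Bit-in (bit (graphᶠ a) p (pair 1 (pair x y) ∷ []))
    (inj₂ (left-pair 1 (pair x y) , subst (λ k → Φ p (fst k ∷ snd k ∷ [])) (sym (right-pair 1 (pair x y)))
      (subst (λ k → Φ p (proj₁ k ∷ proj₂ k ∷ [])) (sym (unpair-pair x y)) φ)))

  edge-out : ∀ x y → Ex G x y → Φ p (x ∷ y ∷ [])
  edge-out x y e = by (Bit-out (bit (graphᶠ a) p (pair 1 (pair x y) ∷ [])) e)
    where
    by : _ → Φ p (x ∷ y ∷ [])
    by (inj₁ z) = case trans (sym z) (left-pair 1 (pair x y)) of λ ()
    by (inj₂ (_ , φ)) = subst (λ k → Φ p (proj₁ k ∷ proj₂ k ∷ [])) (unpair-pair x y)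
      (subst (λ k → Φ p (fst k ∷ snd k ∷ [])) (right-pair 1 (pair x y)) φ)

  isGraph : IsGraph G
  isGraph = (λ k → Bit-≤1 (bit (graphᶠ a) p (k ∷ []))) , (λ n → n , ≤-refl , vertex n)
    , (λ x y e → vertex x , vertex y , λ eq → irreflexive y (subst (λ k → Φ p (k ∷ y ∷ [])) eq (edge-out x y e)))
    , λ x y e → edge-in y x (symmetric x y (edge-out x y e))

-- Reducing RT1fin and COH to wRSg

open Def
open Dcd

SameColour : Baire → ℕ → ℕ → Set
SameColour c x y = ¬ (x ≡ y) × c x ≡ c y

-- A finite, hence searchable, certificate that `s` has at least two neighbours in `h`. One exists
-- because some colour occurs infinitely often in `h`.
Triple : Baire → Baire → ℕ → Set
Triple c h s = h ∋ s × ∃ λ w → w < s × ∃ λ w′ → w′ < w × h ∋ w × h ∋ w′ × c w ≡ c s × c w′ ≡ c s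

abstract
  sameᶠ : Dcd 2 (λ p ρ → SameColour p (lookup ρ zero) (lookup ρ (suc zero)))
  sameᶠ = ¬ᶠ (v₀ ≡ᶠ v₁) ∧ᶠ orc v₀ ≡ᶠ orc v₁

  tripleᶠ : Dcd 2 (λ p ρ → Triple (leftO p) (rightO p) (lookup ρ (suc zero)))
  tripleᶠ = orcR v₁ ≡ᶠ lit 1 ∧ᶠ ∃ᶠ v₁ (∃ᶠ v₀
    (orcR v₁ ≡ᶠ lit 1 ∧ᶠ orcR v₀ ≡ᶠ lit 1 ∧ᶠ orcL v₁ ≡ᶠ orcL v₃ ∧ᶠ orcL v₀ ≡ᶠ orcL v₃))

  classᶠ : Dcd 2 (λ p ρ → rightO p (lookup ρ zero) ≡ 1 × leftO p (lookup ρ zero) ≡ leftO p (lookup ρ (suc zero)))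
  classᶠ = orcR v₀ ≡ᶠ lit 1 ∧ᶠ orcL v₀ ≡ᶠ orcL v₁

module FromColour (em : ExcludedMiddle 0ℓ) (c : Baire) (k : ℕ) (c<k : ∀ n → c n < k) where
  open Classical em
  module Gr = GraphOn sameᶠ c (λ x (ne , _) → ne refl) (λ x y (ne , e) → (λ eq → ne (sym eq)) , sym e)

  module _ (h : Baire) (h-inf : Infinite (h ∋_))
    (degree : ∀ v → h ∋ v → Infinite (HN Gr.G h v) ⊎ AtMostOne (HN Gr.G h v)) where

    p : Baire
    p = join c h

    frequent : ∃ λ i → Infinite (λ x → h ∋ x × c x ≡ i)
    frequent = by-contra λ none →
      let (b , q) = collect (λ i b → ∀ x → b ≤ x → ¬ (h ∋ x × c x ≡ i)) (λ l q x l′ → q x (≤-trans l l′)) k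
                      (λ i _ → not-infinite λ inf → none (i , inf))
          (x , l , x∈) = h-inf b
      in q (c x) (c<k x) x l (x∈ , refl)

    triple-exists : ∃ λ s → Triple (leftO p) (rightO p) s
    triple-exists =
      let (i , inf) = frequent
          (w′ , _ , w′∈ , e′) = inf 0
          (w , w′<w , w∈ , e) = inf (suc w′)
          (s , w<s , s∈ , e″) = inf (suc w)
      in s , trans (join-right c h s) s∈ , w , w<s , w′ , w′<w , trans (join-right c h w) w∈ , trans (join-right c h w′) w′∈
       , trans (join-left c h w) (trans (trans e (sym e″)) (sym (join-left c h s)))
       , trans (join-left c h w′) (trans (trans e′ (sym e″)) (sym (join-left c h s)))

    abstract
      output : Σ Baire λ r → Computes (searchₜ tripleᶠ (code classᶠ)) p r × ∀ n → ∃ λ s →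
        Triple (leftO p) (rightO p) s × (∀ s′ → s′ < s → ¬ Triple (leftO p) (rightO p) s′) × r n ≡ val classᶠ p (n ∷ s ∷ [])
      output = searchₜ-computes tripleᶠ (code classᶠ) p (λ _ → triple-exists)

    r : Baire
    r = proj₁ output

    s₀ : ℕ
    s₀ = proj₁ (proj₂ (proj₂ output) 0)

    triple₀ : Triple (leftO p) (rightO p) s₀
    triple₀ = proj₁ (proj₂ (proj₂ (proj₂ output) 0))

    -- The backward program repeats its search for every input; all these runs find the same `s₀`.
    first-unique : ∀ {s s′} → Triple (leftO p) (rightO p) s → (∀ t → t < s → ¬ Triple (leftO p) (rightO p) t) →
      Triple (leftO p) (rightO p) s′ → (∀ t → t < s′ → ¬ Triple (leftO p) (rightO p) t) → s ≡ s′
    first-unique {s} {s′} t min t′ min′ with <-cmp s s′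
    ... | tri< l _ _ = ⊥-elim (min′ s l t)
    ... | tri≈ _ e _ = e
    ... | tri> _ _ l = ⊥-elim (min s′ l t′)

    r-value : ∀ n → r n ≡ val classᶠ p (n ∷ s₀ ∷ [])
    r-value n = let (s , t , min , e) = proj₂ (proj₂ output) n in
      trans e (cong (λ u → val classᶠ p (n ∷ u ∷ []))
        (first-unique {s} {s₀} t min triple₀ (proj₁ (proj₂ (proj₂ (proj₂ (proj₂ output) 0))))))

    r-out : ∀ n → r ∋ n → h ∋ n × c n ≡ c s₀
    r-out n e = let (a , b) = Bit-out (bit classᶠ p (n ∷ s₀ ∷ [])) (trans (sym (r-value n)) e)
      in trans (sym (join-right c h n)) a , trans (sym (join-left c h n)) (trans b (join-left c h s₀))

    r-in : ∀ n → h ∋ n → c n ≡ c s₀ → r ∋ n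
    r-in n a b = trans (r-value n) (Bit-in (bit classᶠ p (n ∷ s₀ ∷ []))
      (trans (join-right c h n) a , trans (join-left c h n) (trans b (sym (join-left c h s₀)))))

    r-Char : Char r
    r-Char n = ≤-trans (≤-reflexive (r-value n)) (Bit-≤1 (bit classᶠ p (n ∷ s₀ ∷ [])))

    class-infinite : Infinite (HN Gr.G h s₀)
    class-infinite =
      let (s∈ , w , w<s , w′ , w′<w , w∈ , w′∈ , e , e′) = triple₀
          nbr : ∀ v → v < s₀ → rightO p v ≡ 1 → leftO p v ≡ leftO p s₀ → HN Gr.G h s₀ v
          nbr v l v∈ eq = trans (sym (join-right c h v)) v∈ , Gr.edge-in s₀ v
            ((λ eq′ → <⇒≢ l (sym eq′)) , trans (sym (join-left c h s₀)) (trans (sym eq) (join-left c h v)))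
      in case degree s₀ (trans (sym (join-right c h s₀)) s∈) of λ where
           (inj₁ inf) → inf
           (inj₂ amo) → ⊥-elim (<⇒≢ w′<w (amo w′ w (nbr w′ (<-trans w′<w w<s) w′∈ e′) (nbr w w<s w∈ e)))

    r-sol : sol RT1fin c r
    r-sol = ( r-Char , (λ _ _ → tt)
            , λ n → let (x , l , x∈ , e) = class-infinite n in x , l , r-in x x∈ (sym (proj₂ (Gr.edge-out s₀ x e))) )
          , λ x y hx hy → trans (proj₂ (r-out x hx)) (sym (proj₂ (r-out y hy)))

RT1fin≤wRSg : ExcludedMiddle 0ℓ → RT1fin ≤W wRSg
RT1fin≤wRSg em = totalₜ (code (graphᶠ sameᶠ)) , searchₜ tripleᶠ (code classᶠ) , λ c (k , c<k) →
  let open FromColour em c k c<k in Gr.G , Gr.computes , Gr.isGraph ,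
  λ h ((_ , _ , inf) , degree) → r h inf degree , proj₁ (proj₂ (output h inf degree)) , r-sol h inf degree

-- The first n bits A₀(x), …, Aₙ₋₁(x) read as a binary number, most significant bit first.
prefix : Baire → ℕ → ℕ → ℕ
prefix f x = iter 0 (λ i acc → (acc + acc) + f (pair i x))

prefix-cong : ∀ {f g} → (∀ n → f n ≡ g n) → ∀ x n → prefix f x n ≡ prefix g x n
prefix-cong e x zero    = refl
prefix-cong e x (suc n) = cong₂ _+_ (cong₂ _+_ (prefix-cong e x n) (prefix-cong e x n)) (e (pair n x))

-- Doubling turns a strict inequality between prefixes into a gap of at least 2, which one appended
-- bit cannot close.
prefix-step : ∀ {f} → Char f → ∀ x y n → prefix f x (suc n) ≤ prefix f y (suc n) → prefix f x n ≤ prefix f y n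
prefix-step {f} cf x y n l = ≮⇒≥ λ lt → <⇒≱ (begin-strict
    b + b + f (pair n y)  ≤⟨ +-monoʳ-≤ (b + b) (cf (pair n y)) ⟩
    b + b + 1             ≡⟨ +-comm (b + b) 1 ⟩
    suc (b + b)           <⟨ s≤s (≤-reflexive (sym (+-suc b b))) ⟩
    suc b + suc b         ≤⟨ +-mono-≤ lt lt ⟩
    a + a                 ≤⟨ m≤m+n (a + a) (f (pair n x)) ⟩
    a + a + f (pair n x)  ∎) l
  where
  open ≤-Reasoning
  a b : ℕ
  a = prefix f x n
  b = prefix f y n

prefix-mono : ∀ {f} → Char f → ∀ x y {m n} → m ≤ n → prefix f x n ≤ prefix f y n → prefix f x m ≤ prefix f y m
prefix-mono cf x y {m} {zero}  z≤n l = l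
prefix-mono cf x y {m} {suc n} m≤n l with m≤n⇒m<n∨m≡n m≤n
... | inj₁ m<n  = prefix-mono cf x y (≤-pred m<n) (prefix-step cf x y n l)
... | inj₂ refl = l

prefix-bit : ∀ {f} → Char f → ∀ x y n → prefix f x (suc n) ≡ prefix f y (suc n) → f (pair n x) ≡ f (pair n y)
prefix-bit {f} cf x y n e = +-cancelˡ-≡ (prefix f x n + prefix f x n) _ _
  (trans e (cong (λ k → k + k + f (pair n y)) (sym same)))
  where
  same : prefix f x n ≡ prefix f y n
  same = ≤-antisym (prefix-step cf x y n (≤-reflexive e)) (prefix-step cf y x n (≤-reflexive (sym e)))

prefix-bound : ∀ {f} → Char f → ∀ n → ∃ λ b → ∀ x → prefix f x n ≤ b
prefix-bound cf zero    = 0 , λ _ → z≤n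
prefix-bound cf (suc n) = let (b , h) = prefix-bound cf n in b + b + 1 , λ x → +-mono-≤ (+-mono-≤ (h x) (h x)) (cf (pair n x))

-- The smaller vertex also sets the precision of the comparison. Adjacency is thus decidable, and
-- every fixed bit is compared by almost all vertices.
Adj : Baire → ℕ → ℕ → Set
Adj f x y = (x < y × prefix f x x ≤ prefix f y x) ⊎ (y < x × prefix f y y ≤ prefix f x y)

Adj-sym : ∀ f x y → Adj f x y → Adj f y x
Adj-sym f x y (inj₁ q) = inj₂ q
Adj-sym f x y (inj₂ q) = inj₁ q

Adj-irrefl : ∀ f x → ¬ Adj f x x
Adj-irrefl f x (inj₁ (l , _)) = <-irrefl refl l
Adj-irrefl f x (inj₂ (l , _)) = <-irrefl refl l

Adj-cong : ∀ {f g} → (∀ n → f n ≡ g n) → ∀ x y → Adj f x y → Adj g x y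
Adj-cong {f} {g} e x y (inj₁ (l , q)) = inj₁ (l , subst (_≤ prefix g y x) (prefix-cong e x x) (subst (prefix f x x ≤_) (prefix-cong e y x) q))
Adj-cong {f} {g} e x y (inj₂ (l , q)) = inj₂ (l , subst (_≤ prefix g x y) (prefix-cong e y y) (subst (prefix f y y ≤_) (prefix-cong e x y) q))

Adj-prefix : ∀ f x y → x < y → Adj f x y → prefix f x x ≤ prefix f y x
Adj-prefix f x y l (inj₁ (_ , q)) = q
Adj-prefix f x y l (inj₂ (g , _)) = ⊥-elim (<-asym l g)

non-Adj-prefix : ∀ f x y → x < y → ¬ Adj f x y → prefix f y x ≤ prefix f x x
non-Adj-prefix f x y l n = <⇒≤ (≰⇒> λ q → n (inj₁ (l , q)))

Homogeneous : Baire → (ℕ → Set) → ℕ → Set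
Homogeneous f C i = Finite (λ x → C x × ¬ (f (pair i x) ≡ 1)) ⊎ Finite (λ x → C x × f (pair i x) ≡ 1)

CohesiveFor : Baire → (ℕ → Set) → Set
CohesiveFor f C = Infinite C × ∀ i → Homogeneous f C i

-- Before stage `y` two neighbours of `z` in `H` have appeared, so `z` is known to have infinite
-- degree in `H`.
Active : Baire → (ℕ → Set) → ℕ → ℕ → Set
Active f H z y = H z × ∃ λ w → w < y × ∃ λ w′ → w′ < w × H w × H w′ × Adj f z w × Adj f z w′

-- Which of the two cases holds is not decidable, so the choice at `y` uses what is known by then.
-- While fewer than two vertices are known to have infinite degree everything is chosen; from then
-- on only elements adjacent to all the known ones below them are.
Chosen : Baire → (ℕ → Set) → ℕ → Set
Chosen f H y = H y × (¬ (∃ λ z → z < y × ∃ λ z′ → z′ < z × Active f H z y × Active f H z′ y)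
                      ⊎ ¬ (∃ λ z → z < y × Active f H z y × ¬ Adj f z y))

private
  module _ (O : Baire → Baire) (o : Access O) where
    prefixᵈ : Def 2 (λ p ρ → prefix (O p) (lookup ρ zero) (lookup ρ (suc zero)))
    prefixᵈ = loop (lit 0) (add (add v₀ v₀) (o (pr v₁ v₂))) v₁

    prefix-at : ∀ {n} {X N : Sem n} → Def n X → Def n N → Def n (λ p ρ → prefix (O p) (X p ρ) (N p ρ))
    prefix-at = at₂ prefixᵈ

    abstract
      adjᶠ : Dcd 2 (λ p ρ → Adj (O p) (lookup ρ zero) (lookup ρ (suc zero)))
      adjᶠ = (succ v₀ ≤ᶠ v₁ ∧ᶠ prefix-at v₀ v₀ ≤ᶠ prefix-at v₁ v₀) ∨ᶠ (succ v₁ ≤ᶠ v₀ ∧ᶠ prefix-at v₁ v₁ ≤ᶠ prefix-at v₀ v₁)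

  inH : ∀ {n} {F : Sem n} → Def n F → Dcd n (λ p ρ → rightO p (F p ρ) ≡ 1)
  inH d = orcR d ≡ᶠ lit 1

  abstract
    activeᶠ : Dcd 2 (λ p ρ → Active (leftO p) (λ x → rightO p x ≡ 1) (lookup ρ zero) (lookup ρ (suc zero)))
    activeᶠ = inH v₀ ∧ᶠ ∃ᶠ v₁ (∃ᶠ v₀ (inH v₁ ∧ᶠ inH v₀ ∧ᶠ sub₂ (adjᶠ leftO orcL) v₂ v₁ ∧ᶠ sub₂ (adjᶠ leftO orcL) v₂ v₀))

    chosenᶠ : Dcd 1 (λ p ρ → Chosen (leftO p) (λ x → rightO p x ≡ 1) (lookup ρ zero))
    chosenᶠ = inH v₀ ∧ᶠ (¬ᶠ (∃ᶠ v₀ (∃ᶠ v₀ (sub₂ activeᶠ v₁ v₂ ∧ᶠ sub₂ activeᶠ v₀ v₂)))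
                        ∨ᶠ ¬ᶠ (∃ᶠ v₀ (sub₂ activeᶠ v₀ v₁ ∧ᶠ ¬ᶠ sub₂ (adjᶠ leftO orcL) v₀ v₁)))

module _ (em : ExcludedMiddle 0ℓ) where
  open Classical em

  -- Take an element with the least value: all later values are at most this one, and none is
  -- smaller.
  settle : (K : ℕ → Set) → Infinite K → (val : ℕ → ℕ) →
    (∀ z → K z → ∃ λ b → ∀ y → b ≤ y → K y → val y ≤ val z) → ∃ λ v → ∃ λ b → ∀ y → b ≤ y → K y → val y ≡ v
  settle K inf val desc =
    let (x , _ , kx) = inf 0
        (v , (z , kz , e) , min) = least (λ v → ∃ λ z → K z × val z ≡ v) (val x , x , kx , refl)
        (b , h) = desc z kz
    in v , b , λ y l ky → ≤-antisym (≤-trans (h y l ky) (≤-reflexive e)) (≮⇒≥ λ lt → min (val y) lt (y , ky , refl))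

  settle-up : (K : ℕ → Set) → Infinite K → (val : ℕ → ℕ) → (∃ λ m → ∀ x → val x ≤ m) →
    (∀ z → K z → ∃ λ b → ∀ y → b ≤ y → K y → val z ≤ val y) → ∃ λ v → ∃ λ b → ∀ y → b ≤ y → K y → val y ≡ v
  settle-up K inf val (m , bounded) asc =
    let (v , b , h) = settle K inf (λ x → m ∸ val x) λ z kz → let (b , q) = asc z kz in b , λ y l ky → ∸-monoʳ-≤ m (q y l ky)
    in m ∸ v , b , λ y l ky → trans (sym (m∸[m∸n]≡n (bounded y))) (cong (m ∸_) (h y l ky))

module CohesiveSubset (em : ExcludedMiddle 0ℓ) (f : Baire) (cf : Char f) (H : ℕ → Set) (H-inf : Infinite H)
  (degree : ∀ v → H v → Infinite (λ y → H y × Adj f v y) ⊎ AtMostOne (λ y → H y × Adj f v y)) where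
  open Classical em

  A : ℕ → Set
  A v = H v × Infinite (λ y → H y × Adj f v y)

  active-A : ∀ z y → Active f H z y → A z
  active-A z y (hz , w , _ , w′ , w′<w , hw , hw′ , aw , aw′) = hz , (case degree z hz of λ where
    (inj₁ inf) → inf
    (inj₂ amo) → ⊥-elim (<⇒≢ w′<w (amo w′ w (hw′ , aw′) (hw , aw))))

  Adj-trans : ∀ x y z → x < y → y < z → Adj f x y → Adj f y z → Adj f x z
  Adj-trans x y z l l′ a a′ = inj₁ (<-trans l l′ , ≤-trans (Adj-prefix f x y l a)
    (prefix-mono cf y z (<⇒≤ l) (Adj-prefix f y z l′ a′)))

  -- At precision `m`, `z` is strictly below `m` and `m` is at most `y`; so `z` is strictly below
  -- `y`, and more bits cannot reverse this.
  Adj-above : ∀ m z y → m < z → z < y → ¬ Adj f m z → Adj f m y → Adj f z y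
  Adj-above m z y l l′ n a = by-contra λ na → n (inj₁ (l , ≤-trans (Adj-prefix f m y (<-trans l l′) a)
    (prefix-mono cf y z (<⇒≤ l) (non-Adj-prefix f z y l′ na))))

  Adj-between : ∀ a b y → a < b → b < y → Adj f a y → ¬ Adj f b y → Adj f a b
  Adj-between a b y l l′ ay nby = inj₁ (l , ≤-trans (Adj-prefix f a y (<-trans l l′) ay)
    (prefix-mono cf y b (<⇒≤ l) (non-Adj-prefix f b y l′ nby)))

  one-sided : ∀ i → (∃ λ v → ∃ λ b → ∀ y → b ≤ y → Chosen f H y → prefix f y (suc i) ≡ v) → Infinite (Chosen f H) →
    Homogeneous f (Chosen f H) i
  one-sided i (v , b , const) inf =
    let (x , b≤x , cx) = inf b
        same : ∀ y → b ≤ y → Chosen f H y → f (pair i y) ≡ f (pair i x)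
        same y l cy = prefix-bit cf y x i (trans (const y l cy) (sym (const x b≤x cx)))
    in case f (pair i x) ≟ 1 of λ where
         (yes e) → inj₁ (b , λ y (cy , ne) → ≰⇒> λ l → ne (trans (same y l cy) e))
         (no ne) → inj₂ (b , λ y (cy , e) → ≰⇒> λ l → ne (trans (sym (same y l cy)) e))

  from-tail : ∀ {n N v b} → (∀ y → b ≤ y → Chosen f H y × N ≤ y → prefix f y n ≡ v) →
    ∃ λ v → ∃ λ b → ∀ y → b ≤ y → Chosen f H y → prefix f y n ≡ v
  from-tail {N = N} {v} {b} h = v , b ⊔ N , λ y l cy → h y (≤-trans (m≤m⊔n b N) l) (cy , ≤-trans (m≤n⊔m b N) l)

  tail-infinite : ∀ {P : ℕ → Set} → Infinite P → ∀ N → Infinite (λ y → P y × N ≤ y)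
  tail-infinite inf N n = let (y , l , py) = inf (n ⊔ N) in y , ≤-trans (m≤m⊔n n N) l , py , ≤-trans (m≤n⊔m n N) l

  module TwoActive (a₀ a₁ : ℕ) (A₀ : A a₀) (A₁ : A a₁) (a₀<a₁ : a₀ < a₁) where

    -- If `a` were not adjacent to `b`, then `b` would be strictly below `a` and hence adjacent to
    -- all the infinitely many later neighbours of `a`. With two such vertices `a`, an element `b`
    -- of finite degree would have two neighbours, which is why `tail-A` needs both `a₀` and `a₁`.
    nbr-of : ∀ a b → A a → H b → a < b → AtMostOne (λ y → H y × Adj f b y) → Adj f b a
    nbr-of a b (_ , inf) hb a<b amo = by-contra λ nba →
      let (y , b<y , hy , ay) = inf (suc b)
          (y′ , y<y′ , hy′ , ay′) = inf (suc y)
          adj : ∀ y → b < y → Adj f a y → Adj f b y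
          adj y l ay = by-contra λ n → nba (Adj-sym f a b (Adj-between a b y a<b l ay n))
      in <⇒≢ y<y′ (amo y y′ (hy , adj y b<y ay) (hy′ , adj y′ (<-trans b<y y<y′) ay′))

    tail-A : ∀ b → H b → a₁ < b → A b
    tail-A b hb a₁<b = hb , (case degree b hb of λ where
      (inj₁ inf) → inf
      (inj₂ amo) → ⊥-elim (<⇒≢ a₀<a₁ (amo a₀ a₁ (proj₁ A₀ , nbr-of a₀ b A₀ hb (<-trans a₀<a₁ a₁<b) amo)
                                                (proj₁ A₁ , nbr-of a₁ b A₁ hb a₁<b amo))))

    Record : ℕ → Set
    Record m = A m × ∀ z → A z → z < m → Adj f z m

    -- The first later neighbour `y` of `m` in `A` is a record: elements of `A` between `m` and `y`
    -- are not adjacent to `m`, so `Adj-above` applies to them, and those before `m` are handled by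
    -- transitivity.
    next-record : ∀ m → Record m → ∃ λ y → m < y × Record y
    next-record m (Am@(_ , inf) , rec) =
      let (x , l , hx , ax) = inf (suc m ⊔ suc a₁)
          (y , (m<y , Ay , ay) , min) = least (λ y → m < y × A y × Adj f m y)
            (x , ≤-trans (m≤m⊔n (suc m) (suc a₁)) l , tail-A x hx (≤-trans (m≤n⊔m (suc m) (suc a₁)) l) , ax)
      in y , m<y , Ay , λ z Az z<y → case <-cmp z m of λ where
           (tri< z<m _ _) → Adj-trans z m y z<m m<y (rec z Az z<m) ay
           (tri≈ _ refl _) → ay
           (tri> _ _ m<z) → Adj-above m z y m<z z<y (λ az → min z z<y (m<z , Az , az)) ay

    records : Infinite Record
    records zero    = let (m , Am , min) = least A (a₀ , A₀) in m , z≤n , Am , λ z Az l → ⊥-elim (min z l Az)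
    records (suc n) = let (m , l , r) = records n ; (y , m<y , ry) = next-record m r in y , ≤-<-trans l m<y , ry

    chosen-infinite : Infinite (Chosen f H)
    chosen-infinite n = let (y , l , (hy , _) , rec) = records n in
      y , l , hy , inj₂ λ (z , z<y , act , n) → n (rec z (active-A z y act) z<y)

    becomes-active : ∀ z → A z → ∃ λ b → ∀ y → b ≤ y → Active f H z y
    becomes-active z (hz , inf) =
      let (w′ , _ , hw′ , aw′) = inf 0 ; (w , w′<w , hw , aw) = inf (suc w′)
      in suc w , λ y l → hz , w , l , w′ , w′<w , hw , hw′ , aw , aw′

    -- Once `a₀`, `a₁` and `z` have become active, the first alternative of `Chosen` fails and the
    -- second forces adjacency to `z`.
    eventually-adjacent : ∀ z → A z → ∃ λ b → ∀ y → b ≤ y → Chosen f H y → z < y × Adj f z y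
    eventually-adjacent z Az =
      let (b , act) = becomes-active z Az ; (b₀ , act₀) = becomes-active a₀ A₀ ; (b₁ , act₁) = becomes-active a₁ A₁
          B = (b ⊔ suc z) ⊔ (b₀ ⊔ (b₁ ⊔ suc a₁))
          ≤B : ∀ {k y} → B ≤ y → k ≤ b₀ ⊔ (b₁ ⊔ suc a₁) → k ≤ y
          ≤B l l′ = ≤-trans l′ (≤-trans (m≤n⊔m (b ⊔ suc z) (b₀ ⊔ (b₁ ⊔ suc a₁))) l)
          z<y : ∀ {y} → B ≤ y → z < y
          z<y l = ≤-trans (≤-trans (m≤n⊔m b (suc z)) (m≤m⊔n (b ⊔ suc z) (b₀ ⊔ (b₁ ⊔ suc a₁)))) l
      in B , λ y l (_ , c) → z<y l , (case c of λ where
           (inj₁ lone) → ⊥-elim (lone (a₁ , ≤B l (max₃ b₀ b₁ (suc a₁)) , a₀ , a₀<a₁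
             , act₁ y (≤B l (max₂ b₀ b₁ (suc a₁))) , act₀ y (≤B l (max₁ b₀ b₁ (suc a₁)))))
           (inj₂ none) → by-contra λ n → none (z , z<y l
             , act y (≤-trans (≤-trans (m≤m⊔n b (suc z)) (m≤m⊔n (b ⊔ suc z) (b₀ ⊔ (b₁ ⊔ suc a₁)))) l) , n))

    cohesive : CohesiveFor f (Chosen f H)
    cohesive = chosen-infinite , λ i → one-sided i (const i) chosen-infinite
      where
      const : ∀ i → ∃ λ v → ∃ λ b → ∀ y → b ≤ y → Chosen f H y → prefix f y (suc i) ≡ v
      -- From `suc i` on adjacency compares at least `i + 1` bits, and above `a₁` every element of
      -- `H` has infinite degree.
      const i = let N = suc i ⊔ suc a₁
                    (v , b , h) = settle-up em (λ y → Chosen f H y × N ≤ y) (tail-infinite chosen-infinite N) (λ y → prefix f y (suc i))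
                      (prefix-bound cf (suc i))
                      λ z ((hz , _) , N≤z) → let (b , q) = eventually-adjacent z (tail-A z hz (≤-trans (m≤n⊔m (suc i) (suc a₁)) N≤z))
                        in b , λ y l (cy , _) → let (z<y , a) = q y l cy
                           in prefix-mono cf z y (≤-trans (m≤m⊔n (suc i) (suc a₁)) N≤z) (Adj-prefix f z y z<y a)
                in from-tail {n = suc i} {N} {v} {b} h

  module AtMostOneActive (one : ∀ a a′ → A a → A a′ → a ≡ a′) where

    chosen : ∀ y → H y → Chosen f H y
    chosen y hy = hy , inj₁ λ (z , _ , z′ , z′<z , act , act′) → <⇒≢ z′<z (one z′ z (active-A z′ y act′) (active-A z y act))

    bound : ∃ λ N → ∀ y → N ≤ y → ¬ A y
    bound = case em {∃ A} of λ where
      (yes (a , Aa)) → suc a , λ y l Ay → <⇒≢ l (one a y Aa Ay)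
      (no none) → 0 , λ y _ Ay → none (y , Ay)

    -- At most one neighbour exists, so beyond it every element of `H` is strictly below `z` at
    -- precision `z`. The prefixes therefore eventually descend.
    eventually-nonadjacent : ∀ z → H z → ¬ A z → ∃ λ b → ∀ y → b ≤ y → H y → z < y × ¬ Adj f z y
    eventually-nonadjacent z hz ¬Az = case degree z hz of λ where
      (inj₁ inf) → ⊥-elim (¬Az (hz , inf))
      (inj₂ amo) → case em {∃ λ y → H y × Adj f z y} of λ where
        (yes (x , nx)) → suc x ⊔ suc z , λ y l hy → ≤-trans (m≤n⊔m (suc x) (suc z)) l
          , λ a → <⇒≢ (≤-trans (m≤m⊔n (suc x) (suc z)) l) (amo x y nx (hy , a))
        (no none) → suc z , λ y l hy → l , λ a → none (y , hy , a)

    chosen-infinite : Infinite (Chosen f H)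
    chosen-infinite n = let (y , l , hy) = H-inf n in y , l , chosen y hy

    cohesive : CohesiveFor f (Chosen f H)
    cohesive = chosen-infinite , λ i → one-sided i (const i) chosen-infinite
      where
      const : ∀ i → ∃ λ v → ∃ λ b → ∀ y → b ≤ y → Chosen f H y → prefix f y (suc i) ≡ v
      const i = let (N₀ , ¬A) = bound
                    N = suc i ⊔ N₀
                    (v , b , h) = settle em (λ y → Chosen f H y × N ≤ y) (tail-infinite chosen-infinite N) (λ y → prefix f y (suc i))
                      λ z ((hz , _) , N≤z) → let (b , q) = eventually-nonadjacent z hz (¬A z (≤-trans (m≤n⊔m (suc i) N₀) N≤z))
                        in b , λ y l ((hy , _) , _) → let (z<y , n) = q y l hy
                           in prefix-mono cf y z (≤-trans (m≤m⊔n (suc i) N₀) N≤z) (non-Adj-prefix f z y z<y n)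
                in from-tail {n = suc i} {N} {v} {b} h

  cohesive : CohesiveFor f (Chosen f H)
  cohesive = case em {∃ λ a → ∃ λ a′ → A a × A a′ × a < a′} of λ where
    (yes (a , a′ , Aa , Aa′ , l)) → TwoActive.cohesive a a′ Aa Aa′ l
    (no none) → AtMostOneActive.cohesive λ a a′ Aa Aa′ → case <-cmp a a′ of λ where
      (tri< l _ _) → ⊥-elim (none (a , a′ , Aa , Aa′ , l))
      (tri≈ _ e _) → e
      (tri> _ _ l) → ⊥-elim (none (a′ , a , Aa′ , Aa , l))

module FromSets (em : ExcludedMiddle 0ℓ) (f : Baire) (cf : Char f) where
  module Gr = GraphOn (adjᶠ id orc) f (Adj-irrefl f) (Adj-sym f)

  module _ (h : Baire) (h-inf : Infinite (h ∋_))
    (degree : ∀ v → h ∋ v → Infinite (HN Gr.G h v) ⊎ AtMostOne (HN Gr.G h v)) where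

    q : Baire
    q = join f h

    f′ : Baire
    f′ = leftO q

    f′≡f : ∀ n → f′ n ≡ f n
    f′≡f = join-left f h

    H′ : ℕ → Set
    H′ x = rightO q x ≡ 1

    to : ∀ {x} → h ∋ x → H′ x
    to {x} e = trans (join-right f h x) e

    from : ∀ {x} → H′ x → h ∋ x
    from {x} e = trans (sym (join-right f h x)) e

    nbr-to : ∀ {v y} → HN Gr.G h v y → H′ y × Adj f′ v y
    nbr-to {v} {y} (y∈ , e) = to {y} y∈ , Adj-cong (λ n → sym (f′≡f n)) v y (Gr.edge-out v y e)

    nbr-from : ∀ {v y} → H′ y × Adj f′ v y → HN Gr.G h v y
    nbr-from {v} {y} (y∈ , a) = from {y} y∈ , Gr.edge-in v y (Adj-cong f′≡f v y a)

    degree′ : ∀ v → H′ v → Infinite (λ y → H′ y × Adj f′ v y) ⊎ AtMostOne (λ y → H′ y × Adj f′ v y)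
    degree′ v hv = case degree v (from {v} hv) of λ where
      (inj₁ inf) → inj₁ λ n → let (y , l , ny) = inf n in y , l , nbr-to {v} {y} ny
      (inj₂ amo) → inj₂ λ x y nx ny → amo x y (nbr-from {v} {x} nx) (nbr-from {v} {y} ny)

    cohesive′ : CohesiveFor f′ (Chosen f′ H′)
    cohesive′ = CohesiveSubset.cohesive em f′ (λ n → ≤-trans (≤-reflexive (f′≡f n)) (cf n)) H′
      (λ n → let (x , l , x∈) = h-inf n in x , l , to {x} x∈) degree′

    C : Baire
    C y = val chosenᶠ q (y ∷ [])

    C-out : ∀ y → C ∋ y → Chosen f′ H′ y
    C-out y e = Bit-out (bit chosenᶠ q (y ∷ [])) e

    C-sol : sol COH f C
    C-sol = ( (λ y → Bit-≤1 (bit chosenᶠ q (y ∷ []))) , (λ _ _ → tt)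
            , λ n → let (y , l , c) = proj₁ cohesive′ n in y , l , Bit-in (bit chosenᶠ q (y ∷ [])) c )
          , λ i → case proj₂ cohesive′ i of λ where
              (inj₁ (b , fin)) → inj₁ (b , λ x (x∈ , ne) → fin x (C-out x x∈ , λ e → ne (trans (sym (f′≡f (pair i x))) e)))
              (inj₂ (b , fin)) → inj₂ (b , λ x (x∈ , e) → fin x (C-out x x∈ , trans (f′≡f (pair i x)) e))

COH≤wRSg : ExcludedMiddle 0ℓ → COH ≤W wRSg
COH≤wRSg em = totalₜ (code (graphᶠ (adjᶠ id orc))) , totalₜ (code chosenᶠ) , λ f cf →
  let open FromSets em f cf in Gr.G , Gr.computes , Gr.isGraph ,
  λ h ((_ , _ , inf) , degree) → C h inf degree , totalₜ-computes (code chosenᶠ) (join f h) , C-sol h inf degree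

-- Assembling the claims

module _ (em : ExcludedMiddle 0ℓ) where

  private
    SADCω≰wRSgr : ¬ (SADCω ≤C wRSgr)
    SADCω≰wRSgr φ = Diagonal≤wRSgr.impossible em SADCω-diagonal φ alternating

    DNR≰wRSgr : ¬ (DNR ≤C wRSgr)
    DNR≰wRSgr φ = Diagonal≤wRSgr.impossible em DNR-diagonal φ no-columns

  -- `below` refutes `X ≤W Y` by placing `RT1fin` under `Y`; for `SADC` and `DNR` the chain
  -- continues to `lim`. `above` refutes `Y ≤W X` for every `Y` above `SADCω`. Only `DNR` on the
  -- left and `X ≤W RT1fin` need an argument of their own, the latter with `COH` as the problem
  -- below `X`.
  claims : ∀ X → X ≤W RT22 → COH ≤W X → RT1fin ≤W X → X ≤C wRSgr → Claims611 X
  claims X X≤RT22 COH≤X RT1fin≤X X≤wRSgr =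
      (X≤RT22 , above SADCω≤RT22)
    , (COH≤X , λ X≤COH → RT1fin≰COH em (below X≤COH))
    , (RT1fin≤X , λ X≤RT1fin → COH≤RT1fin.impossible em (≤C-trans (≤W⇒≤C COH≤X) (≤W⇒≤C X≤RT1fin)))
    , ((λ X≤lim → RT1fin≤lim.impossible em (below X≤lim)) , above (≤C-trans SADCω≤SADC (SADC≤lim em)))
    , ((λ X≤SRT22 → RT1fin≤SRT22.impossible em (below X≤SRT22)) , above SADCω≤SRT22)
    , ((λ X≤SADC → RT1fin≤lim.impossible em (≤C-trans (below X≤SADC) (SADC≤lim em))) , above SADCω≤SADC)
    , ((λ X≤DNR → RT1fin≤lim.impossible em (≤C-trans (below X≤DNR) (DNR≤lim em)))
      , λ DNR≤X → DNR≰wRSgr (≤C-trans (≤W⇒≤C DNR≤X) X≤wRSgr))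
    where
    below : ∀ {Y} → X ≤W Y → RT1fin ≤C Y
    below X≤Y = ≤C-trans (≤W⇒≤C RT1fin≤X) (≤W⇒≤C X≤Y)
    above : ∀ {Y} → SADCω ≤C Y → ¬ (Y ≤W X)
    above SADCω≤Y Y≤X = SADCω≰wRSgr (≤C-trans SADCω≤Y (≤C-trans (≤W⇒≤C Y≤X) X≤wRSgr))

wRSgr⇒wRSg : ∀ {p q} → sol wRSgr p q → sol wRSg p q
wRSgr⇒wRSg (sub , degree) = sub , λ v v∈ → [ inj₁ , (λ empty → inj₂ λ x y nx _ → ⊥-elim (empty x nx)) ]′ (degree v v∈)

≤wRSg⇒≤wRSgr : ∀ {F} → F ≤W wRSg → F ≤W wRSgr
≤wRSg⇒≤wRSgr (Φ , Ψ , red) = Φ , Ψ , λ f d →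
  let (q , comp , graph , back) = red f d in q , comp , graph , λ g s → back g (wRSgr⇒wRSg {q} {g} s)

wRSgr≤⇒wRSg≤ : ∀ {F} → wRSgr ≤W F → wRSg ≤W F
wRSgr≤⇒wRSg≤ (Φ , Ψ , red) = Φ , Ψ , λ f d →
  let (q , comp , dq , back) = red f d
  in q , comp , dq , λ g s → let (r , comp′ , r-sol) = back g s in r , comp′ , wRSgr⇒wRSg {f} {r} r-sol

≤C-refl : ∀ {F} → F ≤C F
≤C-refl = record
  { fwd = λ f _ → f ; fwd-dom = λ _ d → d ; fwd-cont = λ _ _ n → suc n , λ _ _ e → e n ≤-refl
  ; bwd = λ _ _ g _ → g ; bwd-sol = λ _ _ _ s → s ; bwd-cont = λ _ _ _ _ n → suc n , λ _ _ _ _ _ e → e n ≤-refl }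

wRSg≤wRSgr : wRSg ≤C wRSgr
wRSg≤wRSgr = record
  { fwd = φ.fwd ; fwd-dom = φ.fwd-dom ; fwd-cont = φ.fwd-cont
  ; bwd = φ.bwd ; bwd-sol = λ p _ q s → wRSgr⇒wRSg {p} {q} s ; bwd-cont = φ.bwd-cont }
  where module φ = _≤C_ (≤C-refl {wRSgr})

theorem6p11 : ExcludedMiddle 0ℓ → Claims611 wRSg × Claims611 wRSgr
theorem6p11 em =
    claims em wRSg (wRSgr≤⇒wRSg≤ (wRSgr≤RT22 em)) (COH≤wRSg em) (RT1fin≤wRSg em) wRSg≤wRSgr
  , claims em wRSgr (wRSgr≤RT22 em) (≤wRSg⇒≤wRSgr (COH≤wRSg em)) (≤wRSg⇒≤wRSgr (RT1fin≤wRSg em)) ≤C-refl
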